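{- Let $M\in\mathring K_{>0}$ and let $C\subset\mathring K^n$ be an $M$-cell. Then $C$ satisfies the Whitney arc property.
   Context: Throughout, $K$ is an $\aleph_1$-saturated o-minimal structure expanding a field; "definable" means definable in $K$ with parameters; $|\cdot|$ is the Euclidean norm. $\mathring K$ is the set of finite elements of $K$ (those bounded in absolute value by a natural number), and $\operatorname{st}$ is the standard part map. $M$-functions and $M$-cells ($M\in K_{>0}$). A definable differentiable function $f$ is an $M$-function if $|Df|\le M$ on its domain (operator norm; on a $\mathcal C^1$ cell that is not open, $Df(x)$ is the differential on the tangent space of the cell). In $K^1$ an $M$-cell is a point or an interval $(a,b)$ with $a<b$ in $K$. An $M$-cell in $K^{m+1}$ is either the graph of a definable $\mathcal C^1$ $M$-function $f:X\to K$, or a set $\{(x,r)\in X\times K: f(x)<r<g(x)\}$ with $f<g$ definable $\mathcal C^1$ $M$-functions on $X$, where $X\subseteq K^m$ is an $M$-cell. Whitney arc property. A definable set $A\subset K^n$ satisfies the Whitney arc property if there is a constant $c\in\mathring K_{>0}$ such that for all $x,y\in A$ there is a definable curve (continuous definable map) $\gamma:[0,1]\to A$ with $\gamma(0)=x$, $\gamma(1)=y$ and $\operatorname{length}(\gamma):=\int_0^1|\gamma'|\le c|x-y|$. The integral is the one for the Berarducci-Otero measure $\mathcal L^1$: $\int_0^1|\gamma'|$ is the integral over $[0,1]\subset K$ of $\operatorname{st}(|\gamma'(t)|)$ with respect to $\mathcal L^1$, where $\mathcal L^1$ is the completed measure on the $\sigma$-ring generated by the definable subsets of $K$ of finite diameter,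 with $\mathcal L^1(S)$ equal to the Lebesgue measure of $\operatorname{st}(S)$ for definable $S\subset\mathring K$. It is a real number, and the inequality is understood with the right-hand side replaced by its standard part. -}

module Defs where

open import Algebra.Bundles using (RawMonoid)
open import Algebra.Structures using (IsCommutativeRing)
import Algebra.Definitions.RawMonoid as RawMonoidDefs
open import Data.Fin.Base using (Fin)
open import Data.Integer.Base using (ℤ; +_; -[1+_])
open import Data.List.Base using (List)
open import Data.List.Relation.Unary.All using (All)
open import Data.List.Relation.Unary.Any using (Any)
open import Data.Nat.Base using (ℕ; zero; suc)
open import Data.Product.Base using (Σ-syntax; ∃; ∃-syntax; _×_; _,_; proj₁; proj₂)
open import Data.Rational.Base as ℚ using (ℚ; 0ℚ; ↥_; ↧ₙ_)
import Data.Rational.Properties as ℚ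
open import Data.Vec.Base
  using (Vec; []; _∷_; [_]; head; tail; init; last; lookup; tabulate; zipWith)
import Data.Vec.Base as Vec
import Data.Vec.Functional as Vector
open import Data.Vec.Relation.Unary.All using () renaming (All to AllVec)
open import Function.Bundles using (_⇔_)
open import Level using (Level; 0ℓ; _⊔_) renaming (suc to lsuc)
open import Relation.Binary.Core using (Rel)
open import Relation.Binary.Definitions using (tri<; tri≈; tri>)
open import Relation.Binary.PropositionalEquality using (_≡_; _≢_)
open import Relation.Binary.Structures using (IsStrictTotalOrder)
import Relation.Binary.Construct.Add.Extrema.Strict as Extrema
import Relation.Binary.Construct.StrictToNonStrict as StrictToNonStrict
open import Relation.Nullary using (¬_)
open import Relation.Nullary.Construct.Add.Extrema using (_±)
  renaming ([_] to fin)
open import Relation.Unary using (Pred; _∈_; _∉_; _⊆_; _≐_; _∪_; _∖_; _⊥_; ⋃)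

-- A point of [-∞,∞] is a rounded lower set of rationals, q ∈ below x
-- meaning q < x; the empty set is -∞ and all of ℚ is ∞.  Under excluded
-- middle the proper inhabited ones are exactly the Dedekind reals.
record ℝ̄ (ℓ : Level) : Set (lsuc ℓ) where
  field
    below   : Pred ℚ ℓ
    closed  : ∀ {p q} → p ℚ.< q → q ∈ below → p ∈ below
    rounded : ∀ {p} → p ∈ below → ∃[ q ] p ℚ.< q × q ∈ below

open ℝ̄ public

record ℝ : Set₁ where
  field
    value     : ℝ̄ 0ℓ
    inhabited : ∃[ q ] q ∈ below value
    bounded   : ∃[ q ] q ∉ below value

open ℝ public

infix 4 _≤ᴿ_ _≈ᴿ_ _ℚ<_ _<ℚ_
infixl 6 _+ᴿ_

_≤ᴿ_ : ∀ {a b} → ℝ̄ a → ℝ̄ b → Set (a ⊔ b)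
x ≤ᴿ y = below x ⊆ below y

_≈ᴿ_ : ∀ {a b} → ℝ̄ a → ℝ̄ b → Set (a ⊔ b)
x ≈ᴿ y = x ≤ᴿ y × y ≤ᴿ x

_ℚ<_ : ℚ → ℝ → Set
q ℚ< r = q ∈ below (value r)

_<ℚ_ : ℝ → ℚ → Set
r <ℚ q = ∃[ p ] p ℚ.< q × ¬ (p ℚ< r)

fromℚ : ℚ → ℝ̄ 0ℓ
fromℚ q = record
  { below   = ℚ._< q
  ; closed  = ℚ.<-trans
  ; rounded = ℚ.<-dense
  }

_+ᴿ_ : ℝ̄ 0ℓ → ℝ̄ 0ℓ → ℝ̄ 0ℓ
x +ᴿ y = record
  { below   = λ p → ∃[ a ] ∃[ b ] a ∈ below x × b ∈ below y × p ℚ.< a ℚ.+ b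
  ; closed  = λ { p<q (a , b , a<x , b<y , q<) →
                  a , b , a<x , b<y , ℚ.<-trans p<q q< }
  ; rounded = λ { (a , b , a<x , b<y , p<) → let q , p<q , q< = ℚ.<-dense p< in
                  q , p<q , a , b , a<x , b<y , q< }
  }

-- Multiplication by a rational; only meaningful for a positive one.
scale : ℚ → ℝ̄ 0ℓ → ℝ̄ 0ℓ
scale c x = record
  { below   = λ p → ∃[ a ] a ∈ below x × p ℚ.< c ℚ.* a
  ; closed  = λ { p<q (a , a<x , q<) → a , a<x , ℚ.<-trans p<q q< }
  ; rounded = λ { (a , a<x , p<) → let q , p<q , q< = ℚ.<-dense p< in
                  q , p<q , a , a<x , q< }
  }

sup : ∀ {i} {I : Set i} → (I → ℝ̄ 0ℓ) → ℝ̄ i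
sup x = record
  { below   = λ p → ∃[ i ] p ∈ below (x i)
  ; closed  = λ { p<q (i , q<) → i , closed (x i) p<q q< }
  ; rounded = λ { (i , p<) → let q , p<q , q< = rounded (x i) p< in
                  q , p<q , i , q< }
  }

inf : ∀ {i} {I : Set i} → (I → ℝ̄ 0ℓ) → ℝ̄ i
inf {I = I} x = record
  { below   = λ p → ∃[ q ] p ℚ.< q × ((i : I) → q ∈ below (x i))
  ; closed  = λ { p<q (s , q<s , s<) → s , ℚ.<-trans p<q q<s , s< }
  ; rounded = λ { (s , p<s , s<) → let q , p<q , q<s = ℚ.<-dense p<s in
                  q , p<q , s , q<s , s< }
  }

Σᶠ : ∀ {n} → (Fin n → ℝ̄ 0ℓ) → ℝ̄ 0ℓ
Σᶠ = Vector.foldr _+ᴿ_ (fromℚ 0ℚ)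

partialSum : (ℕ → ℝ̄ 0ℓ) → ℕ → ℝ̄ 0ℓ
partialSum x zero    = fromℚ 0ℚ
partialSum x (suc n) = partialSum x n +ᴿ x n

-- Only meaningful for nonnegative terms.
Σ∞ : (ℕ → ℝ̄ 0ℓ) → ℝ̄ 0ℓ
Σ∞ x = sup (partialSum x)

record IntervalCover (E : Pred ℝ 0ℓ) : Set₁ where
  field
    left right : ℕ → ℚ
    ordered    : ∀ i → left i ℚ.≤ right i
    covers     : ∀ {r} → r ∈ E → ∃[ i ] left i ℚ< r × r <ℚ right i

  totalLength : ℝ̄ 0ℓ
  totalLength = Σ∞ λ i → fromℚ (right i ℚ.- left i)

-- Outer measure, which is Lebesgue measure on the measurable sets; the
-- sets stImage S for S definable are measurable.
Lebesgue : Pred ℝ 0ℓ → ℝ̄ (lsuc 0ℓ)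
Lebesgue E = inf {I = IntervalCover E} IntervalCover.totalLength

record OrderedField : Set₁ where
  infix  4 _<_
  infixl 6 _+_
  infixl 7 _*_
  infix  8 -_
  field
    Carrier            : Set
    _<_                : Rel Carrier 0ℓ
    _+_ _*_            : Carrier → Carrier → Carrier
    -_                 : Carrier → Carrier
    0# 1#              : Carrier
    isCommutativeRing  : IsCommutativeRing _≡_ _+_ _*_ -_ 0# 1#
    isStrictTotalOrder : IsStrictTotalOrder _≡_ _<_
    0≢1                : 0# ≢ 1#
    inverse            : ∀ x → x ≢ 0# → ∃[ y ] x * y ≡ 1#
    +-monoˡ-<          : ∀ z {x y} → x < y → x + z < y + z
    *-pos              : ∀ {x y} → 0# < x → 0# < y → 0# < x * y

  open IsStrictTotalOrder isStrictTotalOrder public using (compare)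
  open StrictToNonStrict _≡_ _<_ public using (_≤_)
  open Extrema _<_ public using (_<±_)

  infixl 6 _-_
  _-_ : Carrier → Carrier → Carrier
  x - y = x + - y

  abs : Carrier → Carrier
  abs x with compare x 0#
  ... | tri< _ _ _ = - x
  ... | tri≈ _ _ _ = x
  ... | tri> _ _ _ = x

  +-rawMonoid : RawMonoid 0ℓ 0ℓ
  +-rawMonoid = record { Carrier = Carrier ; _≈_ = _≡_ ; _∙_ = _+_ ; ε = 0# }

  open RawMonoidDefs +-rawMonoid public using (sum) renaming (_×_ to _×ᴷ_)

  fromℕ : ℕ → Carrier
  fromℕ n = n ×ᴷ 1#

  fromℤ : ℤ → Carrier
  fromℤ (+ n)    = fromℕ n
  fromℤ -[1+ n ] = - fromℕ (suc n)

  -- Comparison with a rational, denominators cleared.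
  infix 4 _ℚ≤ᴷ_ _≤ᴷℚ_
  _ℚ≤ᴷ_ : ℚ → Carrier → Set
  q ℚ≤ᴷ a = fromℤ (↥ q) ≤ a * fromℕ (↧ₙ q)

  _≤ᴷℚ_ : Carrier → ℚ → Set
  a ≤ᴷℚ q = a * fromℕ (↧ₙ q) ≤ fromℤ (↥ q)

  Finite : Pred Carrier 0ℓ
  Finite a = ∃[ n ] abs a ≤ fromℕ n

  -- r is the standard part of a; this forces a to be finite.
  IsSt : Carrier → ℝ → Set
  IsSt a r = (∀ q → q ℚ< r → q ℚ≤ᴷ a) × (∀ q → r <ℚ q → a ≤ᴷℚ q)

  stImage : Pred Carrier 0ℓ → Pred ℝ 0ℓ
  stImage S r = ∃[ a ] a ∈ S × IsSt a r

  infixl 6 _-ᵛ_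
  _-ᵛ_ : ∀ {n} → Vec Carrier n → Vec Carrier n → Vec Carrier n
  _-ᵛ_ = zipWith _-_

  infixl 7 _·ᵛ_ _∙_
  _·ᵛ_ : ∀ {n} → Carrier → Vec Carrier n → Vec Carrier n
  a ·ᵛ v = Vec.map (a *_) v

  _∙_ : ∀ {n} → Vec Carrier n → Vec Carrier n → Carrier
  v ∙ w = sum λ i → lookup v i * lookup w i

  -- d = |v|.  A relation, because the existence of square roots is a
  -- consequence of o-minimality rather than an axiom of ordered fields.
  IsNorm : ∀ {n} → Vec Carrier n → Carrier → Set
  IsNorm v d = 0# ≤ d × d * d ≡ v ∙ v

record Language : Set₁ where
  field
    Fun Relation : ℕ → Set

module Syntax (L : Language) where
  open Language L

  -- Terms and formulas in n variables, in the language L enriched by +,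
  -- ·, < and constants for the elements of P.
  data Term (P : Set) (n : ℕ) : Set where
    var     : Fin n → Term P n
    par     : P → Term P n
    _+̇_ _*̇_ : Term P n → Term P n → Term P n
    fun     : ∀ {k} → Fun k → (Fin k → Term P n) → Term P n

  data Formula (P : Set) : ℕ → Set where
    _≐̇_ _<̇_ : ∀ {n} → Term P n → Term P n → Formula P n
    rel     : ∀ {n k} → Relation k → (Fin k → Term P n) → Formula P n
    ¬̇_      : ∀ {n} → Formula P n → Formula P n
    _∧̇_     : ∀ {n} → Formula P n → Formula P n → Formula P n
    ∃̇_      : ∀ {n} → Formula P (suc n) → Formula P n

record Structure (L : Language) : Set₁ where
  open Language L
  open Syntax L
  field
    orderedField : OrderedField

  open OrderedField orderedField public renaming (Carrier to K)

  field
    funᴵ : ∀ {k} → Fun k → Vec K k → K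
    relᴵ : ∀ {k} → Relation k → Pred (Vec K k) 0ℓ

  eval : ∀ {P n} → (P → K) → Vec K n → Term P n → K
  eval a ρ (var i)    = lookup ρ i
  eval a ρ (par p)    = a p
  eval a ρ (s +̇ t)    = eval a ρ s + eval a ρ t
  eval a ρ (s *̇ t)    = eval a ρ s * eval a ρ t
  eval a ρ (fun F ts) = funᴵ F (tabulate λ i → eval a ρ (ts i))

  Sat : ∀ {P n} → (P → K) → Formula P n → Pred (Vec K n) 0ℓ
  Sat a (s ≐̇ t)    ρ = eval a ρ s ≡ eval a ρ t
  Sat a (s <̇ t)    ρ = eval a ρ s < eval a ρ t
  Sat a (rel R ts) ρ = relᴵ R (tabulate λ i → eval a ρ (ts i))
  Sat a (¬̇ φ)      ρ = ¬ Sat a φ ρ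
  Sat a (φ ∧̇ ψ)    ρ = Sat a φ ρ × Sat a ψ ρ
  Sat a (∃̇ φ)      ρ = ∃[ x ] Sat a φ (x ∷ ρ)

  Definable : ∀ {n} → Pred (Vec K n) 0ℓ → Set
  Definable {n} A = Σ[ φ ∈ Formula K n ] ∀ x → x ∈ A ⇔ Sat (λ p → p) φ x

  Definable₁ : Pred K 0ℓ → Set
  Definable₁ S = Definable {1} λ x → head x ∈ S

  data Piece : Set where
    point    : K → Piece
    interval : K ± → K ± → Piece

  _∈ᴾ_ : K → Piece → Set
  x ∈ᴾ point a      = x ≡ a
  x ∈ᴾ interval a b = a <± fin x × fin x <± b

  OMinimal : Set₁
  OMinimal = ∀ (S : Pred K 0ℓ) → Definable₁ S →
    Σ[ ps ∈ List Piece ] ∀ x → x ∈ S ⇔ Any (x ∈ᴾ_) ps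

  -- Countable parameter sets are presented by enumerations; the language,
  -- and hence the set Γ of formulas, is not assumed countable.
  ℵ₁-Saturated : Set₁
  ℵ₁-Saturated = ∀ (a : ℕ → K) (Γ : Pred (Formula ℕ 1) 0ℓ) →
    (∀ φs → All Γ φs → ∃[ x ] All (λ φ → Sat a φ [ x ]) φs) →
    ∃[ x ] ∀ φ → Γ φ → Sat a φ [ x ]

module Geometry {L : Language} (𝓚 : Structure L) where
  open Structure 𝓚

  -- A map on a subset of Kᵐ is represented by a total function, of which
  -- only the values on that subset matter.

  Graph : ∀ {m} → Pred (Vec K m) 0ℓ → (Vec K m → K) → Pred (Vec K (suc m)) 0ℓ
  Graph X f z = init z ∈ X × last z ≡ f (init z)

  CurveGraph : ∀ {n} → Pred K 0ℓ → (K → Vec K n) → Pred (Vec K (suc n)) 0ℓ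
  CurveGraph I γ z = head z ∈ I × tail z ≡ γ (head z)

  [0,1] : Pred K 0ℓ
  [0,1] t = 0# ≤ t × t ≤ 1#

  -- v = γ′(t) for γ : I → Kⁿ; one-sided at an endpoint of I.
  HasDerivative : ∀ {n} → Pred K 0ℓ → (K → Vec K n) → K → Vec K n → Set
  HasDerivative I γ t v = t ∈ I × ∀ ε → 0# < ε → ∃[ δ ] 0# < δ ×
    (∀ s → s ∈ I → abs (s - t) < δ →
      ∃[ d ] IsNorm (γ s -ᵛ γ t -ᵛ (s - t) ·ᵛ v) d × d ≤ ε * abs (s - t))

  -- Velocities at x of definable curves in X through x: the tangent space
  -- of X at x when X is a C¹ submanifold, as every cell is.
  Tangent : ∀ {m} → Pred (Vec K m) 0ℓ → Vec K m → Pred (Vec K m) 0ℓ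
  Tangent X x v = ∃[ δ ] 0# < δ × ∃[ γ ]
    (let I = λ t → abs t < δ in
      Definable (CurveGraph I γ) ×
      (∀ t → t ∈ I → γ t ∈ X) × γ 0# ≡ x × HasDerivative I γ 0# v)

  -- f : X → K is differentiable at x, and Df(x) is the restriction to the
  -- tangent space of the linear form v ↦ g ∙ v.  When X is not open, g is
  -- not unique, but its restriction is.
  IsDifferential : ∀ {m} → Pred (Vec K m) 0ℓ → (Vec K m → K) →
                   Vec K m → Vec K m → Set
  IsDifferential X f x g = ∀ ε → 0# < ε → ∃[ δ ] 0# < δ ×
    (∀ y → y ∈ X → ∀ d → IsNorm (y -ᵛ x) d → d < δ →
      abs (f y - f x - g ∙ (y -ᵛ x)) ≤ ε * d)

  ContinuousOn : ∀ {m} → Pred (Vec K m) 0ℓ → (Vec K m → Vec K m) → Set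
  ContinuousOn X G = ∀ x → x ∈ X → ∀ ε → 0# < ε → ∃[ δ ] 0# < δ ×
    (∀ y → y ∈ X → ∀ d → IsNorm (y -ᵛ x) d → d < δ →
      ∃[ e ] IsNorm (G y -ᵛ G x) e × e < ε)

  -- On a submanifold X, being C¹ amounts to having differentials given by
  -- a continuous field of linear forms: in local coordinates p on X, take
  -- D(f ∘ p⁻¹)(p x) ∘ p.
  record IsC¹MFunction {m} (M : K) (X : Pred (Vec K m) 0ℓ)
                       (f : Vec K m → K) : Set where
    field
      definable      : Definable (Graph X f)
      G              : Vec K m → Vec K m
      isDifferential : ∀ x → x ∈ X → IsDifferential X f x (G x)
      continuous     : ContinuousOn X G
      bound          : ∀ x → x ∈ X → ∀ v → v ∈ Tangent X x →
                       ∀ d → IsNorm v d → abs (G x ∙ v) ≤ M * d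

  data IsMCell (M : K) : ∀ {n} → Pred (Vec K n) 0ℓ → Set₁ where
    point    : ∀ {C : Pred (Vec K 1) 0ℓ} a →
               C ≐ (λ z → head z ≡ a) →
               IsMCell M C
    interval : ∀ {C : Pred (Vec K 1) 0ℓ} a b → a < b →
               C ≐ (λ z → a < head z × head z < b) →
               IsMCell M C
    graph    : ∀ {m} {X : Pred (Vec K m) 0ℓ} {C : Pred (Vec K (suc m)) 0ℓ} f →
               IsMCell M X → IsC¹MFunction M X f →
               C ≐ Graph X f →
               IsMCell M C
    band     : ∀ {m} {X : Pred (Vec K m) 0ℓ} {C : Pred (Vec K (suc m)) 0ℓ} f g →
               IsMCell M X → IsC¹MFunction M X f → IsC¹MFunction M X g →
               (∀ x → x ∈ X → f x < g x) →
               C ≐ (λ z → init z ∈ X × f (init z) < last z × last z < g (init z)) →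
               IsMCell M C

  FiniteDiameter : Pred K 0ℓ → Set
  FiniteDiameter S = ∃[ n ] ∀ x y → x ∈ S → y ∈ S → abs (x - y) ≤ fromℕ n

  data σRing : Pred K 0ℓ → Set₁ where
    generator  : ∀ {S} → Definable₁ S → FiniteDiameter S → σRing S
    difference : ∀ {A B} → σRing A → σRing B → σRing (A ∖ B)
    union      : ∀ {A : ℕ → Pred K 0ℓ} → (∀ i → σRing (A i)) → σRing (⋃ ℕ A)
    respects   : ∀ {A B} → A ≐ B → σRing A → σRing B

  record InCompletion (μ : Pred K 0ℓ → ℝ̄ 0ℓ) (E : Pred K 0ℓ) : Set₁ where
    field
      core null : Pred K 0ℓ
      core∈     : σRing core
      null∈     : σRing null
      null≈0    : μ null ≈ᴿ fromℚ 0ℚ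
      lower     : core ⊆ E
      upper     : E ⊆ core ∪ null

  -- 𝓛¹ takes irrelevant values on sets outside its domain, which is the
  -- completed σ-ring.  By uniqueness of extensions from generators, these
  -- axioms determine it on all measurable subsets of a bounded interval
  -- of finite elements.
  record BerarducciOteroMeasure : Set₁ where
    field
      𝓛¹ : Pred K 0ℓ → ℝ̄ 0ℓ

    Measurable : Pred K 0ℓ → Set₁
    Measurable = InCompletion 𝓛¹

    field
      nonnegative : ∀ {E} → Measurable E → fromℚ 0ℚ ≤ᴿ 𝓛¹ E
      completed   : ∀ {E} (e : Measurable E) → 𝓛¹ E ≈ᴿ 𝓛¹ (InCompletion.core e)
      σ-additive  : ∀ (E : ℕ → Pred K 0ℓ) → (∀ i → Measurable (E i)) →
                    (∀ {i j} → i ≢ j → E i ⊥ E j) →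
                    𝓛¹ (⋃ ℕ E) ≈ᴿ Σ∞ (λ i → 𝓛¹ (E i))
      lebesgue    : ∀ {S} → Definable₁ S → S ⊆ Finite →
                    𝓛¹ S ≈ᴿ Lebesgue (stImage S)

  module _ (μ : BerarducciOteroMeasure) where
    open BerarducciOteroMeasure μ

    -- A simple function ∑ cᵢ 1_{Eᵢ} below the partial function F ≥ 0
    -- on D (given by its graph, and counted as 0 where undefined).
    record SimpleBelow (D : Pred K 0ℓ) (F : K → ℝ → Set) : Set₁ where
      field
        {size}     : ℕ
        c          : Fin size → ℚ
        E          : Fin size → Pred K 0ℓ
        positive   : ∀ i → 0ℚ ℚ.< c i
        measurable : ∀ i → Measurable (E i)
        disjoint   : ∀ {i j} → i ≢ j → E i ⊥ E j
        inside     : ∀ i → E i ⊆ D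
        below-F    : ∀ i {t} → t ∈ E i → ∃[ r ] F t r × fromℚ (c i) ≤ᴿ value r

      integral : ℝ̄ 0ℓ
      integral = Σᶠ λ i → scale (c i) (𝓛¹ (E i))

    ∫ : (D : Pred K 0ℓ) (F : K → ℝ → Set) → ℝ̄ (lsuc 0ℓ)
    ∫ D F = sup {I = SimpleBelow D F} SimpleBelow.integral

    -- s = |γ′(t)|
    Speed : ∀ {n} → (K → Vec K n) → K → K → Set
    Speed γ t s = ∃[ v ] HasDerivative [0,1] γ t v × IsNorm v s

    length : ∀ {n} → (K → Vec K n) → ℝ̄ (lsuc 0ℓ)
    length γ = ∫ [0,1] λ t r → ∃[ s ] Speed γ t s × IsSt s r

    record CurveIn {n} (A : Pred (Vec K n) 0ℓ) (x y : Vec K n) : Set where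
      field
        γ          : K → Vec K n
        definable  : Definable (CurveGraph [0,1] γ)
        continuous : ∀ t → t ∈ [0,1] → ∀ ε → 0# < ε → ∃[ δ ] 0# < δ ×
                     (∀ s → s ∈ [0,1] → abs (s - t) < δ →
                       ∃[ d ] IsNorm (γ s -ᵛ γ t) d × d < ε)
        into       : ∀ t → t ∈ [0,1] → γ t ∈ A
        source     : γ 0# ≡ x
        target     : γ 1# ≡ y

    -- The standard part is defined on finite elements only, so for the
    -- integrand st |γ′| of the length to make sense |γ′(t)| has to be
    -- finite wherever γ is differentiable (by o-minimality, at all but
    -- finitely many t).  Without this a curve could run through its whole
    -- image in infinitesimal time and contribute nothing to the integral.
    WhitneyArcProperty : ∀ {n} → Pred (Vec K n) 0ℓ → Set₁
    WhitneyArcProperty A = ∃[ c ] 0# < c × Finite c ×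
      (∀ x y → x ∈ A → y ∈ A → Σ[ C ∈ CurveIn A x y ]
        (let open CurveIn C in
          (∀ t s → Speed γ t s → Finite s) ×
          (∃[ d ] IsNorm (x -ᵛ y) d ×
            (∃[ r ] IsSt (c * d) r × length γ ≤ᴿ value r))))

  FinitePoints : ∀ {n} → Pred (Vec K n) 0ℓ
  FinitePoints = AllVec Finite

{-# OPTIONS --safe #-}
-- By induction on cells, any two points x, y of an M-cell are joined by a definable curve
-- γ : [0,1] → C that is differentiable everywhere and Lipschitz with constant c |x - y|, where c
-- depends only on M and the dimension.  Over the base curve γ, a point of height f + α (g - f) is
-- moved to one of height f + β (g - f) by letting the weight run linearly from α to β.  This does
-- not leave the cell, needs no subdivision of [0,1], and preserves differentiability, so the bound
-- on Df can be integrated along γ by the mean value inequality.  The latter follows from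
-- o-minimality, as every definable set that is inhabited and bounded below has an infimum; the same
-- fact provides square roots and hence norms.  Finally, a curve with Lipschitz constant Λ has speed
-- at most Λ, and its length is at most st Λ because 𝓛¹ [0,1] ≤ 1.
module Submission where

open import Algebra.Bundles using (CommutativeRing)
import Algebra.Properties.Ring
import Algebra.Properties.Semiring.Mult
import Algebra.Solver.Ring
open import Algebra.Solver.Ring.AlmostCommutativeRing
  using (AlmostCommutativeRing; fromCommutativeRing; _-Raw-AlmostCommutative⟶_)
open import Axiom.ExcludedMiddle using (ExcludedMiddle)
open import Data.Fin.Base using (Fin; zero; suc; toℕ; inject₁; _↑ˡ_; _↑ʳ_) renaming (fromℕ to maxFin)
open import Data.Integer.Base as ℤ using (ℤ; -[1+_]) renaming (+_ to pos)
import Data.Integer.Properties as ℤ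
open import Data.List.Base using (_∷_)
open import Data.List.Relation.Unary.Any using (Any; here; there)
open import Data.Maybe.Base using (Maybe; just; nothing)
open import Data.Nat.Base as ℕ using (ℕ; zero; suc)
open import Data.Nat.Coprimality using (1-coprimeTo) renaming (sym to coprime-sym)
import Data.Nat.Properties as ℕ
open import Data.Product.Base using (∃-syntax; _×_; _,_; proj₁; proj₂; map₂)
open import Data.Rational.Base as ℚ using (ℚ; 0ℚ; 1ℚ; ↥_; ↧_; ↧ₙ_)
import Data.Rational.Properties as ℚ
import Data.Rational.Solver
open import Data.Sum.Base using (_⊎_; inj₁; inj₂; [_,_]′)
open import Data.Vec.Base
  using (Vec; []; _∷_; [_]; head; init; last; initLast; lookup; tabulate; _∷ʳ_; _++_)
import Data.Vec.Base as Vec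
import Data.Vec.Functional as Vector
import Data.Vec.Properties as Vec
open import Data.Vec.Relation.Unary.All using ([]; _∷_)
open import Function.Base using (id; _∘_)
open import Function.Bundles using (_⇔_; mk⇔; Equivalence)
import Function.Properties.Equivalence as ⇔
open import Level using (0ℓ)
open import Relation.Binary.Bundles using (StrictPartialOrder; StrictTotalOrder)
import Relation.Binary.Construct.Add.Extrema.Strict as Extrema
open import Relation.Binary.Definitions using (tri<; tri≈; tri>)
open import Relation.Binary.PropositionalEquality
  using (_≡_; _≢_; refl; sym; trans; cong; cong₂; subst; subst₂; module ≡-Reasoning)
import Relation.Binary.Reasoning.StrictPartialOrder
open import Relation.Binary.Structures using (IsStrictTotalOrder)
open import Relation.Nullary using (¬_; yes; no; contradiction)
open import Relation.Nullary.Construct.Add.Extrema using (⊥±; ⊤±) renaming ([_] to fin)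
open import Relation.Unary using (Pred; _∈_; _⊆_; _≐_; _∖_; _⊥_; ⋃; ∅)
open import Defs

-- Ordered fields

-- The obstacle is the height. While the weight runs from α to β, the lifted curve drifts vertically
-- at rate (β - α) (g - f), and the gap g - f is not bounded in terms of |x - y|: close points may
-- lie in a very tall fibre. What saves the estimate is that the drift is tied to the total change
-- of height. Let A be a common Lipschitz constant of f and g along the base curve. The gap varies
-- by at most 2A, and (β - α) times the final gap equals the total change of height minus a weighted
-- mean of the increments of f and g, which is at most A in absolute value. So the drift is at most
-- 3A plus the height difference of x and y, and moving at fixed weight costs another A. With A = M
-- Λ, where Λ is at most c times the distance of the projections, a constant c for the base yields c
-- + 4 M c + 1 for the cell above it: finite again, and independent of the gap.

module OrderedFieldProperties (F : OrderedField) where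
  open OrderedField F

  commutativeRing : CommutativeRing 0ℓ 0ℓ
  commutativeRing = record { isCommutativeRing = isCommutativeRing }

  open CommutativeRing commutativeRing public
    using (+-comm; +-assoc; +-identityˡ; +-identityʳ; *-comm; *-assoc; *-identityˡ; *-identityʳ; zeroˡ; zeroʳ; -‿inverseʳ; ring; semiring)
  open Algebra.Properties.Ring ring using (-‿distribˡ-*; -‿distribʳ-*; -‿+-comm; -‿involutive; -0#≈0#)
  open Algebra.Properties.Semiring.Mult semiring using (×-homo-+; ×1-homo-*)

  strictPartialOrder : StrictPartialOrder 0ℓ 0ℓ 0ℓ
  strictPartialOrder = StrictTotalOrder.strictPartialOrder
    (record { isStrictTotalOrder = isStrictTotalOrder })

  module ≤-Reasoning = Relation.Binary.Reasoning.StrictPartialOrder strictPartialOrder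

  open IsStrictTotalOrder isStrictTotalOrder public using ()
    renaming (trans to <-trans; irrefl to <-irrefl; asym to <-asym)

  private
    fromℤ-⊖ : ∀ m n → fromℤ (m ℤ.⊖ n) ≡ fromℕ m - fromℕ n
    fromℤ-⊖ zero    zero    = sym (-‿inverseʳ 0#)
    fromℤ-⊖ zero    (suc n) = sym (+-identityˡ _)
    fromℤ-⊖ (suc m) zero    = sym (trans (cong (fromℕ (suc m) +_) -0#≈0#) (+-identityʳ _))
    fromℤ-⊖ (suc m) (suc n) = begin
      fromℤ (suc m ℤ.⊖ suc n)                  ≡⟨ cong fromℤ (ℤ.[1+m]⊖[1+n]≡m⊖n m n) ⟩
      fromℤ (m ℤ.⊖ n)                          ≡⟨ fromℤ-⊖ m n ⟩
      fromℕ m - fromℕ n                        ≡⟨ +-identityˡ _ ⟨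
      0# + (fromℕ m - fromℕ n)                 ≡⟨ cong (_+ (fromℕ m - fromℕ n)) (-‿inverseʳ 1#) ⟨
      1# - 1# + (fromℕ m - fromℕ n)            ≡⟨ +-assoc 1# (- 1#) _ ⟩
      1# + (- 1# + (fromℕ m - fromℕ n))        ≡⟨ cong (1# +_) (+-assoc (- 1#) _ _) ⟨
      1# + (- 1# + fromℕ m - fromℕ n)          ≡⟨ cong (λ x → 1# + (x - fromℕ n)) (+-comm (- 1#) _) ⟩
      1# + (fromℕ m - 1# - fromℕ n)            ≡⟨ cong (1# +_) (+-assoc (fromℕ m) (- 1#) _) ⟩
      1# + (fromℕ m + (- 1# - fromℕ n))        ≡⟨ +-assoc 1# (fromℕ m) _ ⟨
      1# + fromℕ m + (- 1# - fromℕ n)          ≡⟨ cong (1# + fromℕ m +_) (-‿+-comm 1# (fromℕ n)) ⟩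
      fromℕ (suc m) - fromℕ (suc n)            ∎
      where open ≡-Reasoning

  fromℕ-+ : ∀ m n → fromℕ (m ℕ.+ n) ≡ fromℕ m + fromℕ n
  fromℕ-+ = ×-homo-+ 1#

  fromℕ-* : ∀ m n → fromℕ (m ℕ.* n) ≡ fromℕ m * fromℕ n
  fromℕ-* = ×1-homo-*

  fromℤ-neg : ∀ i → fromℤ (ℤ.- i) ≡ - fromℤ i
  fromℤ-neg (pos zero)  = sym -0#≈0#
  fromℤ-neg (pos (suc n)) = refl
  fromℤ-neg -[1+ n ]  = sym (-‿involutive _)

  fromℤ-+ : ∀ i j → fromℤ (i ℤ.+ j) ≡ fromℤ i + fromℤ j
  fromℤ-+ (pos m)    (pos n)    = fromℕ-+ m n
  fromℤ-+ (pos m)    -[1+ n ] = fromℤ-⊖ m (suc n)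
  fromℤ-+ -[1+ m ] (pos n)    = trans (fromℤ-⊖ n (suc m)) (+-comm _ _)
  fromℤ-+ -[1+ m ] -[1+ n ] = begin
    - fromℕ (suc (suc (m ℕ.+ n)))     ≡⟨ cong (λ k → - fromℕ (suc k)) (ℕ.+-suc m n) ⟨
    - fromℕ (suc m ℕ.+ suc n)         ≡⟨ cong -_ (fromℕ-+ (suc m) (suc n)) ⟩
    - (fromℕ (suc m) + fromℕ (suc n)) ≡⟨ -‿+-comm _ _ ⟨
    - fromℕ (suc m) - fromℕ (suc n)   ∎
    where open ≡-Reasoning

  private
    fromℤ-*⁺ : ∀ m j → fromℤ (pos m ℤ.* j) ≡ fromℕ m * fromℤ j
    fromℤ-*⁺ m (pos n)    = trans (cong fromℤ (sym (ℤ.pos-* m n))) (fromℕ-* m n)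
    fromℤ-*⁺ m -[1+ n ] = begin
      fromℤ (pos m ℤ.* -[1+ n ])      ≡⟨ cong fromℤ (ℤ.neg-distribʳ-* (pos m) (pos (suc n))) ⟨
      fromℤ (ℤ.- (pos m ℤ.* pos (suc n))) ≡⟨ fromℤ-neg (pos m ℤ.* pos (suc n)) ⟩
      - fromℤ (pos m ℤ.* pos (suc n))     ≡⟨ cong -_ (fromℤ-*⁺ m (pos (suc n))) ⟩
      - (fromℕ m * fromℕ (suc n))   ≡⟨ -‿distribʳ-* _ _ ⟩
      fromℕ m * - fromℕ (suc n)     ∎
      where open ≡-Reasoning

  fromℤ-* : ∀ i j → fromℤ (i ℤ.* j) ≡ fromℤ i * fromℤ j
  fromℤ-* (pos m)    j = fromℤ-*⁺ m j
  fromℤ-* -[1+ m ] j = begin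
    fromℤ (-[1+ m ] ℤ.* j)      ≡⟨ cong fromℤ (ℤ.neg-distribˡ-* (pos (suc m)) j) ⟨
    fromℤ (ℤ.- (pos (suc m) ℤ.* j)) ≡⟨ fromℤ-neg (pos (suc m) ℤ.* j) ⟩
    - fromℤ (pos (suc m) ℤ.* j)     ≡⟨ cong -_ (fromℤ-*⁺ (suc m) j) ⟩
    - (fromℕ (suc m) * fromℤ j) ≡⟨ -‿distribˡ-* _ _ ⟩
    - fromℕ (suc m) * fromℤ j   ∎
    where open ≡-Reasoning

  private
    almostCommutativeRing : AlmostCommutativeRing 0ℓ 0ℓ
    almostCommutativeRing = fromCommutativeRing commutativeRing

    -- As a coefficient of the solver, 1 has to denote 1# rather than fromℤ 1, which is 1# + 0#.
    coefficient : ℤ → Carrier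
    coefficient (pos 1) = 1#
    coefficient i       = fromℤ i

    coefficient≡fromℤ : ∀ i → coefficient i ≡ fromℤ i
    coefficient≡fromℤ (pos 0)             = refl
    coefficient≡fromℤ (pos 1)             = sym (+-identityʳ 1#)
    coefficient≡fromℤ (pos (suc (suc _))) = refl
    coefficient≡fromℤ -[1+ _ ]            = refl

    coefficient-morphism : CommutativeRing.rawRing ℤ.+-*-commutativeRing -Raw-AlmostCommutative⟶ almostCommutativeRing
    coefficient-morphism = record
      { ⟦_⟧    = coefficient
      ; +-homo = λ i j → trans (coefficient≡fromℤ (i ℤ.+ j)) (trans (fromℤ-+ i j)
                   (sym (cong₂ _+_ (coefficient≡fromℤ i) (coefficient≡fromℤ j))))
      ; *-homo = λ i j → trans (coefficient≡fromℤ (i ℤ.* j)) (trans (fromℤ-* i j)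
                   (sym (cong₂ _*_ (coefficient≡fromℤ i) (coefficient≡fromℤ j))))
      ; -‿homo = λ i → trans (coefficient≡fromℤ (ℤ.- i)) (trans (fromℤ-neg i)
                   (sym (cong -_ (coefficient≡fromℤ i))))
      ; 0-homo = refl
      ; 1-homo = refl
      }

    _coefficient≟_ : ∀ i j → Maybe (coefficient i ≡ coefficient j)
    i coefficient≟ j with i ℤ.≟ j
    ... | yes i≡j = just (cong coefficient i≡j)
    ... | no  _   = nothing

  open Algebra.Solver.Ring (CommutativeRing.rawRing ℤ.+-*-commutativeRing) almostCommutativeRing coefficient-morphism _coefficient≟_ public
    using (solve; _:=_; _:+_; _:*_; _:-_; :-_; con)

  -- Order, absolute value and finite elements

  abstract
    ≤-refl : ∀ {x} → x ≤ x
    ≤-refl = inj₂ refl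

    ≤-reflexive : ∀ {x y} → x ≡ y → x ≤ y
    ≤-reflexive = inj₂

    <⇒≤ : ∀ {x y} → x < y → x ≤ y
    <⇒≤ = inj₁

    ≤-<-trans : ∀ {x y z} → x ≤ y → y < z → x < z
    ≤-<-trans (inj₁ p)    q = <-trans p q
    ≤-<-trans (inj₂ refl) q = q

    <-≤-trans : ∀ {x y z} → x < y → y ≤ z → x < z
    <-≤-trans p (inj₁ q)    = <-trans p q
    <-≤-trans p (inj₂ refl) = p

    ≤-trans : ∀ {x y z} → x ≤ y → y ≤ z → x ≤ z
    ≤-trans (inj₁ p)    q = <⇒≤ (<-≤-trans p q)
    ≤-trans (inj₂ refl) q = q

    <⇒≱ : ∀ {x y} → x < y → ¬ y ≤ x
    <⇒≱ p q = <-irrefl refl (<-≤-trans p q)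

    ≤-antisym : ∀ {x y} → x ≤ y → y ≤ x → x ≡ y
    ≤-antisym (inj₁ p) q = contradiction q (<⇒≱ p)
    ≤-antisym (inj₂ e) q = e

    ≤-or-> : ∀ x y → x ≤ y ⊎ y < x
    ≤-or-> x y with compare x y
    ... | tri< p _ _ = inj₁ (<⇒≤ p)
    ... | tri≈ _ e _ = inj₁ (≤-reflexive e)
    ... | tri> _ _ p = inj₂ p

    ≤-total : ∀ x y → x ≤ y ⊎ y ≤ x
    ≤-total x y = [ inj₁ , (λ p → inj₂ (<⇒≤ p)) ]′ (≤-or-> x y)

    ≮⇒≥ : ∀ {x y} → ¬ x < y → y ≤ x
    ≮⇒≥ {x} {y} p with ≤-or-> y x
    ... | inj₁ q = q
    ... | inj₂ q = contradiction q p

    ≰⇒> : ∀ {x y} → ¬ x ≤ y → y < x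
    ≰⇒> {x} {y} p with ≤-or-> x y
    ... | inj₁ q = contradiction q p
    ... | inj₂ q = q

    +-monoʳ-< : ∀ z {x y} → x < y → z + x < z + y
    +-monoʳ-< z {x} {y} p = subst₂ _<_ (+-comm x z) (+-comm y z) (+-monoˡ-< z p)

    +-monoˡ-≤ : ∀ z {x y} → x ≤ y → x + z ≤ y + z
    +-monoˡ-≤ z (inj₁ p)    = <⇒≤ (+-monoˡ-< z p)
    +-monoˡ-≤ z (inj₂ refl) = ≤-refl

    +-monoʳ-≤ : ∀ z {x y} → x ≤ y → z + x ≤ z + y
    +-monoʳ-≤ z (inj₁ p)    = <⇒≤ (+-monoʳ-< z p)
    +-monoʳ-≤ z (inj₂ refl) = ≤-refl

    +-mono-≤ : ∀ {x y u v} → x ≤ y → u ≤ v → x + u ≤ y + v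
    +-mono-≤ {y = y} {u} p q = ≤-trans (+-monoˡ-≤ u p) (+-monoʳ-≤ y q)

    +-mono-<-≤ : ∀ {x y u v} → x < y → u ≤ v → x + u < y + v
    +-mono-<-≤ {y = y} {u} p q = <-≤-trans (+-monoˡ-< u p) (+-monoʳ-≤ y q)

    x<y⇒0<y-x : ∀ {x y} → x < y → 0# < y - x
    x<y⇒0<y-x {x} p = subst (_< _) (-‿inverseʳ x) (+-monoˡ-< (- x) p)

    x≤y⇒0≤y-x : ∀ {x y} → x ≤ y → 0# ≤ y - x
    x≤y⇒0≤y-x {x} p = subst (_≤ _) (-‿inverseʳ x) (+-monoˡ-≤ (- x) p)

    0<y-x⇒x<y : ∀ {x y} → 0# < y - x → x < y
    0<y-x⇒x<y {x} {y} p = subst₂ _<_ (+-identityˡ x)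
      (solve 2 (λ x y → y :- x :+ x := y) refl x y) (+-monoˡ-< x p)

    0≤y-x⇒x≤y : ∀ {x y} → 0# ≤ y - x → x ≤ y
    0≤y-x⇒x≤y {x} {y} p = subst₂ _≤_ (+-identityˡ x)
      (solve 2 (λ x y → y :- x :+ x := y) refl x y) (+-monoˡ-≤ x p)

    ≤-from-difference : ∀ {x y d} → y - x ≡ d → 0# ≤ d → x ≤ y
    ≤-from-difference e p = 0≤y-x⇒x≤y (subst (0# ≤_) (sym e) p)

    <-from-difference : ∀ {x y d} → y - x ≡ d → 0# < d → x < y
    <-from-difference e p = 0<y-x⇒x<y (subst (0# <_) (sym e) p)

    neg-mono-≤ : ∀ {x y} → x ≤ y → - y ≤ - x
    neg-mono-≤ {x} {y} p = ≤-from-difference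
      (solve 2 (λ x y → :- x :- :- y := y :- x) refl x y) (x≤y⇒0≤y-x p)

    +-nonneg : ∀ {x y} → 0# ≤ x → 0# ≤ y → 0# ≤ x + y
    +-nonneg p q = subst (_≤ _) (+-identityʳ 0#) (+-mono-≤ p q)

    +-pos-nonneg : ∀ {x y} → 0# < x → 0# ≤ y → 0# < x + y
    +-pos-nonneg p q = subst (_< _) (+-identityʳ 0#) (+-mono-<-≤ p q)

    +-pos : ∀ {x y} → 0# < x → 0# < y → 0# < x + y
    +-pos p q = +-pos-nonneg p (<⇒≤ q)

    *-nonneg : ∀ {x y} → 0# ≤ x → 0# ≤ y → 0# ≤ x * y
    *-nonneg (inj₁ p)    (inj₁ q)    = <⇒≤ (*-pos p q)
    *-nonneg (inj₂ refl) _           = ≤-reflexive (sym (zeroˡ _))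
    *-nonneg (inj₁ _)    (inj₂ refl) = ≤-reflexive (sym (zeroʳ _))

    *-monoˡ-< : ∀ {z} → 0# < z → ∀ {x y} → x < y → x * z < y * z
    *-monoˡ-< {z} z>0 {x} {y} p = <-from-difference
      (solve 3 (λ x y z → y :* z :- x :* z := (y :- x) :* z) refl x y z) (*-pos (x<y⇒0<y-x p) z>0)

    *-monoˡ-≤ : ∀ {z} → 0# ≤ z → ∀ {x y} → x ≤ y → x * z ≤ y * z
    *-monoˡ-≤ {z} z≥0 {x} {y} p = ≤-from-difference
      (solve 3 (λ x y z → y :* z :- x :* z := (y :- x) :* z) refl x y z) (*-nonneg (x≤y⇒0≤y-x p) z≥0)

    *-monoʳ-≤ : ∀ {z} → 0# ≤ z → ∀ {x y} → x ≤ y → z * x ≤ z * y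
    *-monoʳ-≤ {z} z≥0 {x} {y} p = subst₂ _≤_ (*-comm x z) (*-comm y z) (*-monoˡ-≤ z≥0 p)

    *-mono-≤ : ∀ {x y u v} → 0# ≤ x → 0# ≤ v → x ≤ y → u ≤ v → x * u ≤ y * v
    *-mono-≤ {x} {y} {u} {v} x≥0 v≥0 p q = ≤-trans (*-monoʳ-≤ x≥0 q) (*-monoˡ-≤ v≥0 p)

    *-cancelʳ-≤ : ∀ {x y z} → 0# < z → x * z ≤ y * z → x ≤ y
    *-cancelʳ-≤ {x} {y} z>0 p with ≤-or-> x y
    ... | inj₁ q = q
    ... | inj₂ q = contradiction p (<⇒≱ (*-monoˡ-< z>0 q))

    *-cancelʳ-< : ∀ {x y z} → 0# ≤ z → x * z < y * z → x < y
    *-cancelʳ-< {x} {y} z≥0 p with ≤-or-> y x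
    ... | inj₁ q = contradiction (*-monoˡ-≤ z≥0 q) (<⇒≱ p)
    ... | inj₂ q = q

    sq-nonneg : ∀ x → 0# ≤ x * x
    sq-nonneg x with ≤-total 0# x
    ... | inj₁ p = *-nonneg p p
    ... | inj₂ p = subst (0# ≤_) (solve 1 (λ x → (con (pos 0) :- x) :* (con (pos 0) :- x) := x :* x) refl x)
                     (*-nonneg (x≤y⇒0≤y-x p) (x≤y⇒0≤y-x p))

    1>0 : 0# < 1#
    1>0 with sq-nonneg 1#
    ... | inj₁ p = subst (0# <_) (*-identityʳ 1#) p
    ... | inj₂ e = contradiction (trans e (*-identityʳ 1#)) 0≢1

    -- Norms are known only through their squares, so inequalities between them are reduced to
    -- polynomial ones by this cancellation.
    sq-cancel-≤ : ∀ {x y} → 0# ≤ y → x * x ≤ y * y → x ≤ y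
    sq-cancel-≤ {x} {y} y≥0 p with ≤-or-> x y
    ... | inj₁ q = q
    ... | inj₂ q = contradiction p (<⇒≱ (≤-<-trans (*-monoʳ-≤ y≥0 (<⇒≤ q)) (*-monoˡ-< (≤-<-trans y≥0 q) q)))

    sq-cancel-≡ : ∀ {x y} → 0# ≤ x → 0# ≤ y → x * x ≡ y * y → x ≡ y
    sq-cancel-≡ x≥0 y≥0 e =
      ≤-antisym (sq-cancel-≤ y≥0 (≤-reflexive e)) (sq-cancel-≤ x≥0 (≤-reflexive (sym e)))

    -- Certificates for linear arithmetic: the slack of the conclusion is the sum of the slacks of
    -- the hypotheses, an identity left to the ring solver.
    linear₁ : ∀ {x y u v} → u ≤ v → y - x ≡ v - u → x ≤ y
    linear₁ p e = ≤-from-difference e (x≤y⇒0≤y-x p)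

    linear₂ : ∀ {x y u v u′ v′} → u ≤ v → u′ ≤ v′ → y - x ≡ (v - u) + (v′ - u′) → x ≤ y
    linear₂ p q e = ≤-from-difference e (+-nonneg (x≤y⇒0≤y-x p) (x≤y⇒0≤y-x q))

    abs-cases : ∀ x → (0# ≤ x × abs x ≡ x) ⊎ (x ≤ 0# × abs x ≡ - x)
    abs-cases x with compare x 0#
    ... | tri< p _ _ = inj₂ (<⇒≤ p , refl)
    ... | tri≈ _ e _ = inj₁ (≤-reflexive (sym e) , refl)
    ... | tri> _ _ p = inj₁ (<⇒≤ p , refl)

    -0#≡0# : - 0# ≡ 0#
    -0#≡0# = -0#≈0#

    neg-nonneg : ∀ {x} → x ≤ 0# → 0# ≤ - x
    neg-nonneg p = subst (_≤ _) -0#≡0# (neg-mono-≤ p)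

    abs-nonneg : ∀ x → 0# ≤ abs x
    abs-nonneg x with abs-cases x
    ... | inj₁ (p , e) = subst (0# ≤_) (sym e) p
    ... | inj₂ (p , e) = subst (0# ≤_) (sym e) (neg-nonneg p)

    x≤abs : ∀ x → x ≤ abs x
    x≤abs x with abs-cases x
    ... | inj₁ (p , e) = ≤-reflexive (sym e)
    ... | inj₂ (p , e) = ≤-trans p (abs-nonneg x)

    abs-lub : ∀ {x c} → x ≤ c → - x ≤ c → abs x ≤ c
    abs-lub {x} p q with abs-cases x
    ... | inj₁ (_ , e) = subst (_≤ _) (sym e) p
    ... | inj₂ (_ , e) = subst (_≤ _) (sym e) q

    abs-lub-< : ∀ {x c} → x < c → - x < c → abs x < c
    abs-lub-< {x} p q with abs-cases x
    ... | inj₁ (_ , e) = subst (_< _) (sym e) p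
    ... | inj₂ (_ , e) = subst (_< _) (sym e) q

    abs-of-nonneg : ∀ {x} → 0# ≤ x → abs x ≡ x
    abs-of-nonneg {x} p with abs-cases x
    ... | inj₁ (_ , e) = e
    ... | inj₂ (q , e) with ≤-antisym p q
    ...   | refl = trans e -0#≡0#

    abs-sq : ∀ x → abs x * abs x ≡ x * x
    abs-sq x with abs-cases x
    ... | inj₁ (_ , e) = cong₂ _*_ e e
    ... | inj₂ (_ , e) = trans (cong₂ _*_ e e) (solve 1 (λ x → :- x :* :- x := x :* x) refl x)

    -- Both sides are nonnegative with the same square, which avoids a case split on signs.
    abs-* : ∀ x y → abs (x * y) ≡ abs x * abs y
    abs-* x y = sq-cancel-≡ (abs-nonneg _) (*-nonneg (abs-nonneg x) (abs-nonneg y)) (begin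
      abs (x * y) * abs (x * y)       ≡⟨ abs-sq (x * y) ⟩
      x * y * (x * y)                 ≡⟨ solve 2 (λ x y → x :* y :* (x :* y) := x :* x :* (y :* y)) refl x y ⟩
      x * x * (y * y)                 ≡⟨ cong₂ _*_ (abs-sq x) (abs-sq y) ⟨
      abs x * abs x * (abs y * abs y) ≡⟨ solve 2 (λ x y → x :* x :* (y :* y) := x :* y :* (x :* y)) refl (abs x) (abs y) ⟩
      abs x * abs y * (abs x * abs y) ∎)
      where open ≡-Reasoning

    abs-neg : ∀ x → abs (- x) ≡ abs x
    abs-neg x = sq-cancel-≡ (abs-nonneg _) (abs-nonneg x)
      (trans (abs-sq (- x)) (trans (solve 1 (λ x → :- x :* :- x := x :* x) refl x) (sym (abs-sq x))))

    -x≤abs : ∀ x → - x ≤ abs x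
    -x≤abs x = subst (- x ≤_) (abs-neg x) (x≤abs (- x))

    abs-minus-comm : ∀ x y → abs (x - y) ≡ abs (y - x)
    abs-minus-comm x y = trans (cong abs (solve 2 (λ x y → x :- y := :- (y :- x)) refl x y)) (abs-neg (y - x))

    abs-triangle : ∀ x y → abs (x + y) ≤ abs x + abs y
    abs-triangle x y = abs-lub (+-mono-≤ (x≤abs x) (x≤abs y))
      (subst (_≤ abs x + abs y) (-‿+-comm x y) (+-mono-≤ (-x≤abs x) (-x≤abs y)))

    abs-≤-via : ∀ {z} x y → z ≡ x + y → abs z ≤ abs x + abs y
    abs-≤-via x y refl = abs-triangle x y

    inverse-pos : ∀ {x} → 0# < x → ∃[ y ] 0# < y × x * y ≡ 1#
    inverse-pos {x} x>0 = let y , e = inverse x (λ e → <-irrefl (sym e) x>0) in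
      y , *-cancelʳ-< (<⇒≤ x>0) (subst₂ _<_ (sym (zeroˡ x)) (trans (sym e) (*-comm x y)) 1>0) , e

    halve : ∀ {x} → 0# < x → ∃[ h ] 0# < h × h + h ≡ x
    halve {x} x>0 = let y , y>0 , e = inverse-pos (+-pos 1>0 1>0) in
      x * y , *-pos x>0 y>0 , (begin
      x * y + x * y      ≡⟨ solve 2 (λ x y → x :* y :+ x :* y := x :* ((con (pos 1) :+ con (pos 1)) :* y)) refl x y ⟩
      x * ((1# + 1#) * y) ≡⟨ cong (x *_) e ⟩
      x * 1#              ≡⟨ *-identityʳ x ⟩
      x                   ∎)
      where open ≡-Reasoning

    <-dense : ∀ {x y} → x < y → ∃[ z ] x < z × z < y
    <-dense {x} {y} p = let h , h>0 , e = halve (x<y⇒0<y-x p) in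
      x + h
      , <-from-difference (solve 2 (λ x h → x :+ h :- x := h) refl x h) h>0
      , <-from-difference (begin
          y - (x + h)   ≡⟨ solve 3 (λ x y h → y :- (x :+ h) := (y :- x) :- h) refl x y h ⟩
          (y - x) - h   ≡⟨ cong (_- h) e ⟨
          h + h - h     ≡⟨ solve 1 (λ h → h :+ h :- h := h) refl h ⟩
          h             ∎) h>0
      where open ≡-Reasoning

    x<x+pos : ∀ {x d} → 0# < d → x < x + d
    x<x+pos {x} {d} = <-from-difference (solve 2 (λ x d → x :+ d :- x := d) refl x d)

    x-pos<x : ∀ {x d} → 0# < d → x - d < x
    x-pos<x {x} {d} = <-from-difference (solve 2 (λ x d → x :- (x :- d) := d) refl x d)

    x≤x+nonneg : ∀ {x d} → 0# ≤ d → x ≤ x + d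
    x≤x+nonneg {x} {d} = ≤-from-difference (solve 2 (λ x d → x :+ d :- x := d) refl x d)

    pos-multiple-below : ∀ C {ε} → 0# ≤ C → 0# < ε → ∃[ δ ] 0# < δ × C * δ < ε
    pos-multiple-below C {ε} C≥0 ε>0 =
      -- δ = ε / (C + 1); the added 1 covers C = 0 and makes the inequality strict.
      let y , y>0 , e = inverse-pos (<-≤-trans 1>0 (subst (1# ≤_) (+-comm 1# C) (x≤x+nonneg C≥0))) in
      ε * y , *-pos ε>0 y>0 , <-from-difference (begin
      ε - C * (ε * y)                         ≡⟨ cong (_- C * (ε * y)) (*-identityʳ ε) ⟨
      ε * 1# - C * (ε * y)                    ≡⟨ cong (λ o → ε * o - C * (ε * y)) e ⟨
      ε * ((C + 1#) * y) - C * (ε * y)        ≡⟨ solve 3 (λ C ε y → ε :* ((C :+ con (pos 1)) :* y) :- C :* (ε :* y) := ε :* y) refl C ε y ⟩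
      ε * y                                   ∎) (*-pos ε>0 y>0)
      where open ≡-Reasoning

    pos-min : ∀ {x y} → 0# < x → 0# < y → ∃[ z ] 0# < z × z ≤ x × z ≤ y
    pos-min {x} {y} x>0 y>0 with ≤-total x y
    ... | inj₁ p = x , x>0 , ≤-refl , p
    ... | inj₂ p = y , y>0 , p , ≤-refl

    -- The factor C spares its users from rescaling ε when several errors add up.
    ≤-from-ε : ∀ C {x y} → 0# ≤ C → (∀ ε → 0# < ε → x ≤ y + C * ε) → x ≤ y
    ≤-from-ε C {x} {y} C≥0 h with ≤-or-> x y
    ... | inj₁ p = p
    ... | inj₂ y<x = let δ , δ>0 , Cδ< = pos-multiple-below C C≥0 (x<y⇒0<y-x y<x) in
      contradiction (h δ δ>0)
      (<⇒≱ (<-from-difference (solve 3 (λ x y c → x :- (y :+ c) := (x :- y) :- c) refl x y (C * δ)) (x<y⇒0<y-x Cδ<)))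

    fromℕ-nonneg : ∀ n → 0# ≤ fromℕ n
    fromℕ-nonneg zero    = ≤-refl
    fromℕ-nonneg (suc n) = +-nonneg (<⇒≤ 1>0) (fromℕ-nonneg n)

    fromℕ-suc-pos : ∀ n → 0# < fromℕ (suc n)
    fromℕ-suc-pos n = +-pos-nonneg 1>0 (fromℕ-nonneg n)

    finite-0 : Finite 0#
    finite-0 = 0 , ≤-reflexive (abs-of-nonneg ≤-refl)

    finite-1 : Finite 1#
    finite-1 = 1 , ≤-reflexive (trans (abs-of-nonneg (<⇒≤ 1>0)) (sym (+-identityʳ 1#)))

    finite-+ : ∀ {x y} → Finite x → Finite y → Finite (x + y)
    finite-+ {x} {y} (m , p) (n , q) =
      m ℕ.+ n , ≤-trans (abs-triangle x y) (subst (_ ≤_) (sym (fromℕ-+ m n)) (+-mono-≤ p q))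

    finite-* : ∀ {x y} → Finite x → Finite y → Finite (x * y)
    finite-* {x} {y} (m , p) (n , q) = m ℕ.* n
      , subst₂ _≤_ (sym (abs-* x y)) (sym (fromℕ-* m n)) (*-mono-≤ (abs-nonneg x) (fromℕ-nonneg n) p q)

    finite-neg : ∀ {x} → Finite x → Finite (- x)
    finite-neg {x} (n , p) = n , subst (_≤ _) (sym (abs-neg x)) p

    finite-abs : ∀ {x} → Finite x → Finite (abs x)
    finite-abs {x} (n , p) = n , subst (_≤ _) (sym (abs-of-nonneg (abs-nonneg x))) p

    finite-≤ : ∀ {x y} → 0# ≤ x → x ≤ y → Finite y → Finite x
    finite-≤ {x} {y} x≥0 x≤y (n , p) =
      n , ≤-trans (subst (_≤ abs y) (sym (abs-of-nonneg x≥0)) (≤-trans x≤y (x≤abs y))) p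

-- Definable sets

-- Formulas address coordinates by `lookup`, whereas vectors are split by `init` and `last`; this
-- and the next lemma translate between the two.
tabulate-inject₁ : ∀ {A : Set} {n} (xs : Vec A (suc n)) → tabulate (lookup xs ∘ inject₁) ≡ init xs
tabulate-inject₁ {n = zero}  (x ∷ []) = refl
tabulate-inject₁ {n = suc n} (x ∷ xs) = cong (x ∷_) (tabulate-inject₁ xs)

lookup-maxFin : ∀ {A : Set} {n} (xs : Vec A (suc n)) → lookup xs (maxFin n) ≡ last xs
lookup-maxFin {n = zero}  (x ∷ []) = refl
lookup-maxFin {n = suc n} (x ∷ xs) = lookup-maxFin xs

init-∷ʳ-last : ∀ {A : Set} {n} (xs : Vec A (suc n)) → init xs ∷ʳ last xs ≡ xs
init-∷ʳ-last xs = sym (proj₂ (proj₂ (initLast xs)))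

≡⇒⇔ : {A B : Set} → A ≡ B → A ⇔ B
≡⇒⇔ refl = ⇔.refl

module Definability {L : Language} (𝓚 : Structure L) where
  open Structure 𝓚
  open Syntax L
  open OrderedFieldProperties orderedField
  open Equivalence using (to; from)

  substTerm : ∀ {P m n} → Vec (Term P n) m → Term P m → Term P n
  substTerm ts (var i)    = lookup ts i
  substTerm ts (par p)    = par p
  substTerm ts (s +̇ t)    = substTerm ts s +̇ substTerm ts t
  substTerm ts (s *̇ t)    = substTerm ts s *̇ substTerm ts t
  substTerm ts (fun F us) = fun F λ i → substTerm ts (us i)

  eval-substTerm : ∀ {P m n} (a : P → K) (ρ : Vec K n) (ts : Vec (Term P n) m) t →
                   eval a ρ (substTerm ts t) ≡ eval a (Vec.map (eval a ρ) ts) t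
  eval-substTerm a ρ ts (var i)    = sym (Vec.lookup-map i (eval a ρ) ts)
  eval-substTerm a ρ ts (par p)    = refl
  eval-substTerm a ρ ts (s +̇ t)    = cong₂ _+_ (eval-substTerm a ρ ts s) (eval-substTerm a ρ ts t)
  eval-substTerm a ρ ts (s *̇ t)    = cong₂ _*_ (eval-substTerm a ρ ts s) (eval-substTerm a ρ ts t)
  eval-substTerm a ρ ts (fun F us) = cong (funᴵ F) (Vec.tabulate-cong λ i → eval-substTerm a ρ ts (us i))

  vars : ∀ {P m n} → (Fin m → Fin n) → Vec (Term P n) m
  vars σ = tabulate (var ∘ σ)

  eval-vars : ∀ {P m n} (a : P → K) (ρ : Vec K n) (σ : Fin m → Fin n) →
              Vec.map (eval a ρ) (vars σ) ≡ tabulate (lookup ρ ∘ σ)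
  eval-vars a ρ σ = sym (Vec.tabulate-∘ (eval a ρ) (var ∘ σ))

  weaken : ∀ {P n} → Term P n → Term P (suc n)
  weaken = substTerm (vars suc)

  eval-weaken : ∀ {P n} (a : P → K) x (ρ : Vec K n) t → eval a (x ∷ ρ) (weaken t) ≡ eval a ρ t
  eval-weaken a x ρ t = trans (eval-substTerm a (x ∷ ρ) (vars suc) t)
    (cong (λ ρ → eval a ρ t) (trans (eval-vars a (x ∷ ρ) suc) (Vec.tabulate∘lookup ρ)))

  lift : ∀ {P m n} → Vec (Term P n) m → Vec (Term P (suc n)) (suc m)
  lift ts = var zero ∷ Vec.map weaken ts

  eval-lift : ∀ {P m n} (a : P → K) x (ρ : Vec K n) (ts : Vec (Term P n) m) →
              Vec.map (eval a (x ∷ ρ)) (lift ts) ≡ x ∷ Vec.map (eval a ρ) ts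
  eval-lift a x ρ ts = cong (x ∷_)
    (trans (sym (Vec.map-∘ _ weaken ts)) (Vec.map-cong (eval-weaken a x ρ) ts))

  substFormula : ∀ {P m n} → Vec (Term P n) m → Formula P m → Formula P n
  substFormula ts (s ≐̇ t)    = substTerm ts s ≐̇ substTerm ts t
  substFormula ts (s <̇ t)    = substTerm ts s <̇ substTerm ts t
  substFormula ts (rel R us) = rel R λ i → substTerm ts (us i)
  substFormula ts (¬̇ φ)      = ¬̇ substFormula ts φ
  substFormula ts (φ ∧̇ ψ)    = substFormula ts φ ∧̇ substFormula ts ψ
  substFormula ts (∃̇ φ)      = ∃̇ substFormula (lift ts) φ

  Sat-substFormula : ∀ {P m n} (a : P → K) (ρ : Vec K n) (ts : Vec (Term P n) m) φ →
                     Sat a (substFormula ts φ) ρ ⇔ Sat a φ (Vec.map (eval a ρ) ts)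
  Sat-substFormula a ρ ts (s ≐̇ t) = ≡⇒⇔ (cong₂ _≡_ (eval-substTerm a ρ ts s) (eval-substTerm a ρ ts t))
  Sat-substFormula a ρ ts (s <̇ t) = ≡⇒⇔ (cong₂ _<_ (eval-substTerm a ρ ts s) (eval-substTerm a ρ ts t))
  Sat-substFormula a ρ ts (rel R us) = ≡⇒⇔ (cong (relᴵ R) (Vec.tabulate-cong λ i → eval-substTerm a ρ ts (us i)))
  Sat-substFormula a ρ ts (¬̇ φ) = mk⇔ (_∘ from IH) (_∘ to IH)
    where IH = Sat-substFormula a ρ ts φ
  Sat-substFormula a ρ ts (φ ∧̇ ψ) =
    mk⇔ (λ (p , q) → to IHφ p , to IHψ q) (λ (p , q) → from IHφ p , from IHψ q)
    where
    IHφ = Sat-substFormula a ρ ts φ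
    IHψ = Sat-substFormula a ρ ts ψ
  Sat-substFormula a ρ ts (∃̇ φ) = mk⇔ (map₂ λ {x} → to (IH x)) (map₂ λ {x} → from (IH x))
    where
    IH : ∀ x → Sat a (substFormula (lift ts) φ) (x ∷ ρ) ⇔ Sat a φ (x ∷ Vec.map (eval a ρ) ts)
    IH x = subst (λ σ → Sat a (substFormula (lift ts) φ) (x ∷ ρ) ⇔ Sat a φ σ) (eval-lift a x ρ ts) (Sat-substFormula a (x ∷ ρ) (lift ts) φ)

  definable-resp : ∀ {n} {A B : Pred (Vec K n) 0ℓ} → (∀ z → z ∈ A ⇔ z ∈ B) → Definable A → Definable B
  definable-resp e (φ , p) = φ , λ z → ⇔.trans (⇔.sym (e z)) (p z)

  definable-∩ : ∀ {n} {A B : Pred (Vec K n) 0ℓ} → Definable A → Definable B → Definable (λ z → z ∈ A × z ∈ B)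
  definable-∩ (φ , p) (ψ , q) = φ ∧̇ ψ , λ z →
    mk⇔ (λ (u , v) → to (p z) u , to (q z) v) (λ (u , v) → from (p z) u , from (q z) v)

  definable-∁ : ∀ {n} {A : Pred (Vec K n) 0ℓ} → Definable A → Definable (λ z → ¬ z ∈ A)
  definable-∁ (φ , p) = ¬̇ φ , λ z → mk⇔ (_∘ from (p z)) (_∘ to (p z))

  definable-∃ : ∀ {n} {A : Pred (Vec K (suc n)) 0ℓ} → Definable A → Definable (λ z → ∃[ x ] (x ∷ z) ∈ A)
  definable-∃ (φ , p) = ∃̇ φ , λ z → mk⇔ (map₂ (to (p _))) (map₂ (from (p _)))

  definable-∃ᵛ : ∀ m {n} {A : Pred (Vec K (m ℕ.+ n)) 0ℓ} → Definable A → Definable {n} (λ z → ∃[ p ] (p ++ z) ∈ A)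
  definable-∃ᵛ zero    {A = A} d = definable-resp (λ z → mk⇔ ([] ,_) λ { ([] , a) → a }) d
  definable-∃ᵛ (suc m) {A = A} d = definable-resp
    (λ z → mk⇔ (λ (p , x , a) → x ∷ p , a) λ { (x ∷ p , a) → p , x , a })
    (definable-∃ᵛ m (definable-∃ d))

  -- Terms are substituted for the variables of the formula. The map is given twice, by the terms
  -- `ts` and as the function `h`, so that the resulting set can be stated without `eval`.
  definable-preimage : ∀ {m n} {A : Pred (Vec K m) 0ℓ} (ts : Vec (Term K n) m) (h : Vec K n → Vec K m) →
                       (∀ z → Vec.map (eval id z) ts ≡ h z) → Definable A → Definable (λ z → h z ∈ A)
  definable-preimage ts h e (φ , p) = substFormula ts φ , λ z →
    ⇔.trans (p (h z)) (subst (λ y → Sat id φ y ⇔ Sat id (substFormula ts φ) z) (e z) (⇔.sym (Sat-substFormula id z ts φ)))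

  definable-≡ : ∀ {n} (s t : Term K n) → Definable (λ z → eval id z s ≡ eval id z t)
  definable-≡ s t = s ≐̇ t , λ z → ⇔.refl

  definable-< : ∀ {n} (s t : Term K n) → Definable (λ z → eval id z s < eval id z t)
  definable-< s t = s <̇ t , λ z → ⇔.refl

  -- Atomic formulas contain only the strict order, so the weak one is obtained as the negation of
  -- its converse.
  definable-≤ : ∀ {n} (s t : Term K n) → Definable (λ z → eval id z s ≤ eval id z t)
  definable-≤ s t = definable-resp (λ z → mk⇔ ≮⇒≥ (λ p q → <⇒≱ q p)) (definable-∁ (definable-< t s))

  definable₁ : ∀ {S : Pred K 0ℓ} → Definable {1} (λ z → lookup z zero ∈ S) → Definable₁ S
  definable₁ = definable-resp λ { (x ∷ []) → ⇔.refl }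

-- Infima of definable sets

module OMinimality (em : ∀ {ℓ} → ExcludedMiddle ℓ) {L : Language} (𝓚 : Structure L)
                   (ominimal : Structure.OMinimal 𝓚) where
  open Structure 𝓚
  open Syntax L
  open OrderedFieldProperties orderedField
  open Definability 𝓚
  open Equivalence using (to; from)

  IsLowerBound IsInfimum : Pred K 0ℓ → Pred K 0ℓ
  IsLowerBound S ℓ = ∀ {x} → x ∈ S → ℓ ≤ x
  IsInfimum S i = IsLowerBound S i × (∀ {ℓ} → IsLowerBound S ℓ → ℓ ≤ i)

  common-lower-point : ∀ x y → ∃[ z ] z < x × z < y
  common-lower-point x y with ≤-total x y
  ... | inj₁ p = x - 1# , x-pos<x 1>0 , <-≤-trans (x-pos<x 1>0) p
  ... | inj₂ p = y - 1# , <-≤-trans (x-pos<x 1>0) p , x-pos<x 1>0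

  between-below : ∀ {a} x y → a < x → a < y → ∃[ z ] a < z × z < x × z < y
  between-below {a} x y a<x a<y with ≤-total x y
  ... | inj₁ p = let z , a<z , z<x = <-dense a<x in z , a<z , z<x , <-≤-trans z<x p
  ... | inj₂ p = let z , a<z , z<y = <-dense a<y in z , a<z , <-≤-trans z<y p , z<y

  -- The infimum of an inhabited interval is its left end, because everything between that end and a
  -- given element x belongs to the interval. For the same reason a left end -∞ contradicts the
  -- lower bound, and a left end ∞ leaves no element.
  piece-infimum : ∀ p {x ℓ} → x ∈ᴾ p → IsLowerBound (_∈ᴾ p) ℓ → ∃[ i ] IsInfimum (_∈ᴾ p) i
  piece-infimum (point a) refl low = a , (λ { refl → ≤-refl }) , λ low → low refl
  piece-infimum (interval ⊥± b) {x} {ℓ} (_ , x<b) low =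
    let z , z<x , z<ℓ = common-lower-point x ℓ in
    contradiction (low (Extrema.⊥±<[ z ] , Extrema.<±-trans _<_ <-trans Extrema.[ z<x ] x<b)) (<⇒≱ z<ℓ)
  piece-infimum (interval (fin a) b) {x} (Extrema.[ a<x ] , x<b) low =
    a , (λ { (Extrema.[ a<y ] , _) → <⇒≤ a<y }) , greatest
    where
    greatest : ∀ {u} → IsLowerBound (_∈ᴾ interval (fin a) b) u → u ≤ a
    greatest {u} low with ≤-or-> u a
    ... | inj₁ p = p
    ... | inj₂ a<u = let z , a<z , z<x , z<u = between-below x u a<x a<u in
      contradiction (low (Extrema.[ a<z ] , Extrema.<±-trans _<_ <-trans Extrema.[ z<x ] x<b)) (<⇒≱ z<u)
  piece-infimum (interval ⊤± b) (() , _) low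

  -- The infimum of a union is the smaller of the two infima. Excluded middle singles out empty
  -- pieces, which may occur in the list and have no infimum.
  pieces-infimum : ∀ ps {x ℓ} → Any (x ∈ᴾ_) ps → IsLowerBound (λ x → Any (x ∈ᴾ_) ps) ℓ →
                   ∃[ i ] IsInfimum (λ x → Any (x ∈ᴾ_) ps) i
  pieces-infimum (p ∷ ps) x∈ low with em {P = ∃[ x ] x ∈ᴾ p} | em {P = ∃[ x ] Any (x ∈ᴾ_) ps}
  ... | no ∄p | no ∄ps = contradiction x∈ λ { (here x∈p) → ∄p (_ , x∈p) ; (there x∈ps) → ∄ps (_ , x∈ps) }
  ... | yes (x , x∈p) | no ∄ps =
    let i , low-i , greatest = piece-infimum p x∈p (low ∘ here) in
    i , (λ { (here y∈p) → low-i y∈p ; (there y∈ps) → contradiction (_ , y∈ps) ∄ps })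
      , λ low → greatest (low ∘ here)
  ... | no ∄p | yes (x , x∈ps) =
    let i , low-i , greatest = pieces-infimum ps x∈ps (low ∘ there) in
    i , (λ { (here y∈p) → contradiction (_ , y∈p) ∄p ; (there y∈ps) → low-i y∈ps })
      , λ low → greatest (low ∘ there)
  ... | yes (x , x∈p) | yes (y , y∈ps)
    with piece-infimum p x∈p (low ∘ here) | pieces-infimum ps y∈ps (low ∘ there)
  ...   | i , low-i , greatest-i | j , low-j , greatest-j with ≤-total i j
  ...     | inj₁ i≤j = i , (λ { (here y∈p) → low-i y∈p ; (there y∈ps) → ≤-trans i≤j (low-j y∈ps) })
                         , λ low → greatest-i (low ∘ here)
  ...     | inj₂ j≤i = j , (λ { (here y∈p) → ≤-trans j≤i (low-i y∈p) ; (there y∈ps) → low-j y∈ps })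
                         , λ low → greatest-j (low ∘ there)

  infimum : ∀ {S : Pred K 0ℓ} → Definable₁ S → ∀ {x ℓ} → x ∈ S → IsLowerBound S ℓ → ∃[ i ] IsInfimum S i
  infimum {S} d {x} x∈S low with ominimal S d
  ... | ps , e = let i , low-i , greatest = pieces-infimum ps (to (e x) x∈S) (λ y∈ → low (from (e _) y∈)) in
    i , (λ y∈S → low-i (to (e _) y∈S)) , λ low → greatest (λ y∈ → low (from (e _) y∈))

  -- Real induction. If there were a counterexample, the infimum of all of them would satisfy P by
  -- `limit`, and by `step` so would the points just after it, so that a larger lower bound would
  -- exist. The start at a is the case of `limit` with vacuous assumption.
  interval-induction : ∀ {P : Pred K 0ℓ} {a b} → Definable₁ (λ x → (a ≤ x × x ≤ b) × ¬ P x) →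
    (∀ c → a ≤ c → c ≤ b → (∀ x → a ≤ x → x < c → P x) → P c) →
    (∀ c → a ≤ c → c < b → P c → ∃[ δ ] 0# < δ × (∀ x → c < x → x < c + δ → x ≤ b → P x)) →
    ∀ x → a ≤ x → x ≤ b → P x
  interval-induction {P} {a} {b} d limit step x a≤x x≤b with em {P = P x}
  ... | yes Px = Px
  ... | no ¬Px = contradiction (greatest i+δ-lower) (<⇒≱ (x<x+pos δ>0))
    where
    S : Pred K 0ℓ
    S x = (a ≤ x × x ≤ b) × ¬ P x
    inf-S : ∃[ i ] IsInfimum S i
    inf-S = infimum d ((a≤x , x≤b) , ¬Px) (λ s → proj₁ (proj₁ s))
    i = proj₁ inf-S
    low = proj₁ (proj₂ inf-S)
    greatest = proj₂ (proj₂ inf-S)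
    a≤i : a ≤ i
    a≤i = greatest (λ s → proj₁ (proj₁ s))
    i≤b : i ≤ b
    i≤b = ≤-trans (low ((a≤x , x≤b) , ¬Px)) x≤b
    P-below : ∀ y → a ≤ y → y < i → P y
    P-below y a≤y y<i with em {P = P y}
    ... | yes Py = Py
    ... | no ¬Py = contradiction (low ((a≤y , ≤-trans (<⇒≤ y<i) i≤b) , ¬Py)) (<⇒≱ y<i)
    Pi : P i
    Pi = limit i a≤i i≤b P-below
    i<b : i < b
    i<b with i≤b
    ... | inj₁ p = p
    ... | inj₂ e = contradiction (subst P (≤-antisym i≤x (subst (x ≤_) (sym e) x≤b)) Pi) ¬Px
      where i≤x = low ((a≤x , x≤b) , ¬Px)
    extension = step i a≤i i<b Pi
    δ = proj₁ extension
    δ>0 = proj₁ (proj₂ extension)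
    i+δ-lower : IsLowerBound S (i + δ)
    i+δ-lower {y} s with ≤-or-> (i + δ) y
    ... | inj₁ p = p
    ... | inj₂ y<i+δ with low s
    ...   | inj₁ i<y = contradiction (proj₂ (proj₂ extension) y i<y y<i+δ (proj₂ (proj₁ s))) (proj₂ s)
    ...   | inj₂ e   = contradiction (subst P e Pi) (proj₂ s)

  NonnegWithSquareAbove : K → Pred K 0ℓ
  NonnegWithSquareAbove a x = 0# ≤ x × a ≤ x * x

  infimum-sq : ∀ {a i} → 0# ≤ a → IsInfimum (NonnegWithSquareAbove a) i → 0# ≤ i × i * i ≡ a
  infimum-sq {a} {i} a≥0 (low , greatest) = i≥0 , ≤-antisym i²≤a a≤i²
    where
    i≥0 : 0# ≤ i
    i≥0 = greatest proj₁
    a≤i² : a ≤ i * i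
    a≤i² with ≤-or-> a (i * i)
    ... | inj₁ p = p
    ... | inj₂ i²<a = contradiction (greatest i+δ-lower) (<⇒≱ (x<x+pos δ>0))
      where
      -- For δ ≤ 1 the square of i + δ is at most i² + (2i + 1) δ, so δ is chosen with (2i + 1) δ <
      -- a - i².
      small = pos-multiple-below (i + i + 1#) (+-nonneg (+-nonneg i≥0 i≥0) (<⇒≤ 1>0)) (x<y⇒0<y-x i²<a)
      small′ = pos-min 1>0 (proj₁ (proj₂ small))
      δ = proj₁ small′
      δ>0 = proj₁ (proj₂ small′)
      δ≤1 = proj₁ (proj₂ (proj₂ small′))
      cδ<a-i² : (i + i + 1#) * δ < a - i * i
      cδ<a-i² = ≤-<-trans (*-monoʳ-≤ (+-nonneg (+-nonneg i≥0 i≥0) (<⇒≤ 1>0)) (proj₂ (proj₂ (proj₂ small′))))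
                          (proj₂ (proj₂ small))
      [i+δ]²≤a : (i + δ) * (i + δ) ≤ a
      [i+δ]²≤a = ≤-from-difference
        (solve 3 (λ i δ a → a :- (i :+ δ) :* (i :+ δ) :=
           ((a :- i :* i) :- (i :+ i :+ con (pos 1)) :* δ) :+ δ :* (con (pos 1) :- δ)) refl i δ a)
        (+-nonneg (<⇒≤ (x<y⇒0<y-x cδ<a-i²)) (*-nonneg (<⇒≤ δ>0) (x≤y⇒0≤y-x δ≤1)))
      i+δ-lower : IsLowerBound (NonnegWithSquareAbove a) (i + δ)
      i+δ-lower (y≥0 , a≤y²) = sq-cancel-≤ y≥0 (≤-trans [i+δ]²≤a a≤y²)
    -- Otherwise one Newton step from i leads to a smaller element of NonnegWithSquareAbove a.
    i²≤a : i * i ≤ a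
    i²≤a with ≤-or-> (i * i) a
    ... | inj₁ p = p
    ... | inj₂ a<i² = contradiction (low i-δ∈S) (<⇒≱ (x-pos<x δ>0))
      where
      i>0 : 0# < i
      i>0 with i≥0
      ... | inj₁ p = p
      ... | inj₂ e = contradiction a≥0 (<⇒≱ (<-≤-trans a<i² (≤-reflexive (trans (cong (_* i) (sym e)) (zeroˡ i)))))
      inv = inverse-pos (+-pos i>0 i>0)
      y = proj₁ inv
      y>0 = proj₁ (proj₂ inv)
      2iy≡1 = proj₂ (proj₂ inv)
      δ = (i * i - a) * y
      δ>0 : 0# < δ
      δ>0 = *-pos (x<y⇒0<y-x a<i²) y>0
      2iδ≡i²-a : (i + i) * δ ≡ i * i - a
      2iδ≡i²-a = trans (solve 3 (λ i a y → (i :+ i) :* ((i :* i :- a) :* y) := (i :* i :- a) :* ((i :+ i) :* y)) refl i a y)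
        (trans (cong ((i * i - a) *_) 2iy≡1) (*-identityʳ _))
      i-δ∈S : i - δ ∈ NonnegWithSquareAbove a
      i-δ∈S = *-cancelʳ-≤ (+-pos i>0 i>0) (≤-from-difference
            (trans (solve 2 (λ i δ → (i :- δ) :* (i :+ i) :- con (pos 0) :* (i :+ i) := i :* i :+ i :* i :- (i :+ i) :* δ) refl i δ)
              (trans (cong (λ w → i * i + i * i - w) 2iδ≡i²-a)
                (solve 2 (λ i a → i :* i :+ i :* i :- (i :* i :- a) := i :* i :+ a) refl i a)))
            (+-nonneg (sq-nonneg i) a≥0))
        , ≤-from-difference
            (trans (solve 3 (λ i δ a → (i :- δ) :* (i :- δ) :- a := δ :* δ :+ ((i :* i :- a) :- (i :+ i) :* δ)) refl i δ a)
              (trans (cong (λ w → δ * δ + ((i * i - a) - w)) 2iδ≡i²-a)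
                (solve 3 (λ i δ a → δ :* δ :+ ((i :* i :- a) :- (i :* i :- a)) := δ :* δ) refl i δ a)))
            (sq-nonneg δ)

  abstract
    sqrt : ∀ {a} → 0# ≤ a → ∃[ d ] 0# ≤ d × d * d ≡ a
    sqrt {a} a≥0 = let i , inf = infimum definable a+1∈ proj₁ in i , infimum-sq a≥0 inf
      where
      definable : Definable₁ (NonnegWithSquareAbove a)
      definable = definable₁ {NonnegWithSquareAbove a} (definable-∩
        (definable-≤ (par 0#) (var zero))
        (definable-≤ (par a) (var zero *̇ var zero)))
      a+1∈ : a + 1# ∈ NonnegWithSquareAbove a
      a+1∈ = +-nonneg a≥0 (<⇒≤ 1>0) , ≤-from-difference
        (solve 1 (λ a → (a :+ con (pos 1)) :* (a :+ con (pos 1)) :- a := a :* a :+ a :+ con (pos 1)) refl a)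
        (+-nonneg (+-nonneg (*-nonneg a≥0 a≥0) a≥0) (<⇒≤ 1>0))

-- The mean value inequality

module UnitInterval (em : ∀ {ℓ} → ExcludedMiddle ℓ) {L : Language} (𝓚 : Structure L)
                    (ominimal : Structure.OMinimal 𝓚) where
  open Structure 𝓚
  open Syntax L
  open OrderedFieldProperties orderedField
  open Definability 𝓚
  open OMinimality em 𝓚 ominimal
  open Geometry 𝓚 using ([0,1])

  FunctionGraph : (K → K) → Pred (Vec K 2) 0ℓ
  FunctionGraph φ z = lookup z zero ∈ [0,1] × lookup z (suc zero) ≡ φ (lookup z zero)

  DerivativeAt : (K → K) → K → K → Set
  DerivativeAt φ t a = ∀ ε → 0# < ε → ∃[ δ ] 0# < δ ×
    (∀ s → s ∈ [0,1] → abs (s - t) < δ → abs (φ s - φ t - (s - t) * a) ≤ ε * abs (s - t))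

  -- The part of a derivative bound that the mean value inequality consumes: increments are compared
  -- with the one point t only, and δ may depend on t.
  GrowthAt : (K → K) → K → K → Set
  GrowthAt φ t D = ∃[ δ ] 0# < δ × (∀ s → s ∈ [0,1] → abs (s - t) < δ → abs (φ s - φ t) ≤ D * abs (s - t))

  ContinuousAt : (K → K) → K → Set
  ContinuousAt φ t = ∀ ε → 0# < ε → ∃[ δ ] 0# < δ × (∀ s → s ∈ [0,1] → abs (s - t) < δ → abs (φ s - φ t) ≤ ε)

  derivative⇒growth : ∀ {φ t a B} → DerivativeAt φ t a → abs a ≤ B → ∀ ε → 0# < ε → GrowthAt φ t (B + ε)
  derivative⇒growth {φ} {t} {a} {B} d a≤B ε ε>0 = let δ , δ>0 , bound = d ε ε>0 in δ , δ>0 , λ s s∈ s-t<δ →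
    begin
      abs (φ s - φ t)
        ≤⟨ abs-≤-via (φ s - φ t - (s - t) * a) ((s - t) * a)
             (solve 3 (λ x y z → x :- y := x :- y :- z :+ z) refl (φ s) (φ t) ((s - t) * a)) ⟩
      abs (φ s - φ t - (s - t) * a) + abs ((s - t) * a)
        ≤⟨ +-mono-≤ (bound s s∈ s-t<δ) (≤-reflexive (abs-* (s - t) a)) ⟩
      ε * abs (s - t) + abs (s - t) * abs a
        ≤⟨ +-monoʳ-≤ _ (*-monoʳ-≤ (abs-nonneg (s - t)) a≤B) ⟩
      ε * abs (s - t) + abs (s - t) * B
        ≡⟨ solve 3 (λ x ε B → ε :* x :+ x :* B := (B :+ ε) :* x) refl (abs (s - t)) ε B ⟩
      (B + ε) * abs (s - t) ∎
    where open ≤-Reasoning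

  derivative⇒continuous : ∀ {φ t a} → DerivativeAt φ t a → ContinuousAt φ t
  derivative⇒continuous {φ} {t} {a} d ε ε>0 =
    let δ₁ , δ₁>0 , growth = derivative⇒growth d ≤-refl 1# 1>0
        δ₂ , δ₂>0 , Cδ₂<ε = pos-multiple-below C C≥0 ε>0
        δ , δ>0 , δ≤δ₁ , δ≤δ₂ = pos-min δ₁>0 δ₂>0
    in δ , δ>0 , λ s s∈ s-t<δ →
      ≤-trans (growth s s∈ (<-≤-trans s-t<δ δ≤δ₁))
        (≤-trans (*-monoʳ-≤ C≥0 (≤-trans (<⇒≤ s-t<δ) δ≤δ₂)) (<⇒≤ Cδ₂<ε))
    where
    C = abs a + 1#
    C≥0 : 0# ≤ C
    C≥0 = +-nonneg (abs-nonneg a) (<⇒≤ 1>0)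

  between-above : ∀ {a} x y → x < a → y < a → ∃[ z ] x < z × y < z × z < a
  between-above {a} x y x<a y<a with ≤-total x y
  ... | inj₁ p = let z , y<z , z<a = <-dense y<a in z , ≤-<-trans p y<z , y<z , z<a
  ... | inj₂ p = let z , x<z , z<a = <-dense x<a in z , x<z , ≤-<-trans p x<z , z<a

  -- Interval induction on the inequality with b replaced by x. At a limit c it is passed on from
  -- some x < c by the growth bound at c read to the left, and beyond c it is extended by the same
  -- bound read to the right.
  increment-bound : ∀ {φ D} → Definable (FunctionGraph φ) →
                    (∀ t → 0# < t → t < 1# → GrowthAt φ t D) →
                    ∀ {a b} → 0# < a → b < 1# → a ≤ b → φ b - φ a ≤ D * (b - a)
  increment-bound {φ} {D} definable growth {a} {b} a>0 b<1 a≤b =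
    interval-induction {P} definable-¬P limit step b a≤b ≤-refl
    where
    P : Pred K 0ℓ
    P x = φ x - φ a ≤ D * (x - a)
    in-[0,1] : ∀ {x} → a ≤ x → x ≤ b → x ∈ [0,1]
    in-[0,1] a≤x x≤b = ≤-trans (<⇒≤ a>0) a≤x , ≤-trans x≤b (<⇒≤ b<1)
    -- The intercept of the line of slope D through (a, φ a). Since terms have no subtraction,
    -- failure of P is expressed by φ lying above this line.
    line : K
    line = φ a - D * a
    φ-above-line : ∀ x → line + D * x < φ x ⇔ (¬ P x)
    φ-above-line x = mk⇔
      (λ p q → <⇒≱ (<-from-difference
        (solve 5 (λ u v D x a → (u :- v) :- D :* (x :- a) := u :- ((v :- D :* a) :+ D :* x)) refl (φ x) (φ a) D x a)
        (x<y⇒0<y-x p)) q)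
      (λ q → <-from-difference
        (solve 5 (λ u v D x a → u :- ((v :- D :* a) :+ D :* x) := (u :- v) :- D :* (x :- a)) refl (φ x) (φ a) D x a)
        (x<y⇒0<y-x (≰⇒> q)))
    -- Formulas reach φ only through its graph, so the value φ x is quantified.
    definable-¬P : Definable₁ (λ x → (a ≤ x × x ≤ b) × ¬ P x)
    definable-¬P = definable₁ {λ x → (a ≤ x × x ≤ b) × ¬ P x} (definable-resp
      (λ z → mk⇔
        (λ ((a≤x , x≤b) , v , (_ , v≡) , above) →
          (a≤x , x≤b) , Equivalence.to (φ-above-line _) (subst (line + D * lookup z zero <_) v≡ above))
        (λ ((a≤x , x≤b) , ¬Px) →
          (a≤x , x≤b) , φ (lookup z zero) , (in-[0,1] a≤x x≤b , refl) , Equivalence.from (φ-above-line _) ¬Px))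
      (definable-∩ (definable-∩ (definable-≤ (par a) (var zero)) (definable-≤ (var zero) (par b)))
        (definable-∃ {A = λ z → (lookup z (suc zero) ∷ lookup z zero ∷ []) ∈ FunctionGraph φ ×
                                line + D * lookup z (suc zero) < lookup z zero}
          (definable-∩
            (definable-preimage (var (suc zero) ∷ var zero ∷ []) _ (λ _ → refl) definable)
            (definable-< (par line +̇ (par D *̇ var (suc zero))) (var zero))))))
    limit : ∀ c → a ≤ c → c ≤ b → (∀ x → a ≤ x → x < c → P x) → P c
    limit c (inj₂ refl) c≤b below =
      ≤-reflexive (solve 3 (λ u D c → u :- u := D :* (c :- c)) refl (φ c) D c)
    limit c (inj₁ a<c) c≤b below =
      let δ , δ>0 , g = growth c (<-trans a>0 a<c) (≤-<-trans c≤b b<1)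
          x , a<x , c-δ<x , x<c = between-above a (c - δ) a<c (x-pos<x δ>0)
          x-c<δ = abs-lub-<
            (<-trans (<-from-difference (solve 2 (λ x c → con (pos 0) :- (x :- c) := c :- x) refl x c) (x<y⇒0<y-x x<c)) δ>0)
            (<-from-difference (solve 3 (λ x c δ → δ :- :- (x :- c) := x :- (c :- δ)) refl x c δ) (x<y⇒0<y-x c-δ<x))
          gx = g x (in-[0,1] (<⇒≤ a<x) (≤-trans (<⇒≤ x<c) c≤b)) x-c<δ
          x-c≡ = trans (abs-minus-comm x c) (abs-of-nonneg (<⇒≤ (x<y⇒0<y-x x<c)))
          increment = ≤-trans (-x≤abs (φ x - φ c)) (subst (λ d → abs (φ x - φ c) ≤ D * d) x-c≡ gx)
      in linear₂ increment (below x (<⇒≤ a<x) x<c)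
           (solve 7 (λ u v w D a x c → D :* (c :- a) :- (w :- u) :=
              (D :* (c :- x) :- :- (v :- w)) :+ (D :* (x :- a) :- (v :- u))) refl (φ a) (φ x) (φ c) D a x c)
    step : ∀ c → a ≤ c → c < b → P c → ∃[ δ ] 0# < δ × (∀ x → c < x → x < c + δ → x ≤ b → P x)
    step c a≤c c<b Pc =
      let δ , δ>0 , g = growth c (<-≤-trans a>0 a≤c) (<-trans c<b b<1)
      in δ , δ>0 , λ x c<x x<c+δ x≤b →
        let x-c≡ = abs-of-nonneg (<⇒≤ (x<y⇒0<y-x c<x))
            x-c<δ = subst (_< δ) (sym x-c≡)
              (<-from-difference (solve 3 (λ x c δ → δ :- (x :- c) := c :+ δ :- x) refl x c δ) (x<y⇒0<y-x x<c+δ))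
            gx = g x (in-[0,1] (≤-trans a≤c (<⇒≤ c<x)) x≤b) x-c<δ
            increment = ≤-trans (x≤abs (φ x - φ c)) (subst (λ d → abs (φ x - φ c) ≤ D * d) x-c≡ gx)
        in linear₂ increment Pc
             (solve 7 (λ u v w D a x c → D :* (x :- a) :- (v :- u) :=
                (D :* (x :- c) :- (v :- w)) :+ (D :* (c :- a) :- (w :- u))) refl (φ a) (φ x) (φ c) D a x c)

  neg-definable : ∀ {φ} → Definable (FunctionGraph φ) → Definable (FunctionGraph (λ t → - φ t))
  neg-definable {φ} definable = definable-resp
    (λ z → mk⇔
      (λ (t∈ , e) → t∈ , trans (solve 1 (λ x → x := :- (:- con (pos 1) :* x)) refl (lookup z (suc zero))) (cong -_ e))
      (λ (t∈ , e) → t∈ , trans (cong (- 1# *_) e) (solve 1 (λ x → :- con (pos 1) :* :- x := x) refl (φ (lookup z zero)))))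
    (definable-preimage (var zero ∷ (par (- 1#) *̇ var (suc zero)) ∷ []) (λ z → lookup z zero ∷ (- 1# * lookup z (suc zero)) ∷ [])
      (λ _ → refl) definable)

  neg-growth : ∀ {φ t D} → GrowthAt φ t D → GrowthAt (λ t → - φ t) t D
  neg-growth {φ} {t} {D} (δ , δ>0 , g) = δ , δ>0 , λ s s∈ s-t<δ →
    subst (_≤ D * abs (s - t))
      (trans (abs-minus-comm (φ s) (φ t)) (cong abs (solve 2 (λ x y → y :- x := :- x :- :- y) refl (φ s) (φ t))))
      (g s s∈ s-t<δ)

  interior-lipschitz : ∀ {φ D} → Definable (FunctionGraph φ) →
                       (∀ t → 0# < t → t < 1# → GrowthAt φ t D) →
                       ∀ {s t} → 0# < s → s < 1# → 0# < t → t < 1# → abs (φ s - φ t) ≤ D * abs (s - t)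
  interior-lipschitz {φ} {D} definable growth {s} {t} s>0 s<1 t>0 t<1 =
    [ increasing t>0 s<1
    , (λ s≤t → subst₂ (λ x y → x ≤ D * y) (abs-minus-comm (φ t) (φ s)) (abs-minus-comm t s) (increasing s>0 t<1 s≤t))
    ]′ (≤-total t s)
    where
    increasing : ∀ {s t} → 0# < t → s < 1# → t ≤ s → abs (φ s - φ t) ≤ D * abs (s - t)
    increasing {s} {t} t>0 s<1 t≤s = subst (λ d → abs (φ s - φ t) ≤ D * d) (sym (abs-of-nonneg (x≤y⇒0≤y-x t≤s)))
      (abs-lub (increment-bound definable growth t>0 s<1 t≤s)
        (subst (_≤ D * (s - t)) (solve 2 (λ x y → :- x :- :- y := :- (x :- y)) refl (φ s) (φ t))
          (increment-bound {λ t → - φ t} (neg-definable {φ} definable)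
            (λ t t>0 t<1 → neg-growth {φ} (growth t t>0 t<1)) t>0 s<1 t≤s)))

  -- The affine map of [0,1] onto [η, 1 - η]. It moves every point by at most η and brings the end
  -- points into the open interval, where the derivative is bounded.
  shrink : K → K → K
  shrink η s = η + (1# - (η + η)) * s

  module _ {η} (η>0 : 0# < η) (2η<1 : η + η < 1#) where
    shrink>0 : ∀ {s} → s ∈ [0,1] → 0# < shrink η s
    shrink>0 (s≥0 , _) = +-pos-nonneg η>0 (*-nonneg (<⇒≤ (x<y⇒0<y-x 2η<1)) s≥0)

    shrink<1 : ∀ {s} → s ∈ [0,1] → shrink η s < 1#
    shrink<1 {s} (_ , s≤1) = <-from-difference
      (solve 2 (λ η s → con (pos 1) :- (η :+ (con (pos 1) :- (η :+ η)) :* s) :=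
         η :+ (con (pos 1) :- (η :+ η)) :* (con (pos 1) :- s)) refl η s)
      (+-pos-nonneg η>0 (*-nonneg (<⇒≤ (x<y⇒0<y-x 2η<1)) (x≤y⇒0≤y-x s≤1)))

    shrink-near : ∀ {s} → s ∈ [0,1] → abs (shrink η s - s) ≤ η
    shrink-near {s} (s≥0 , s≤1) = abs-lub
      (≤-from-difference (solve 2 (λ η s → η :- (η :+ (con (pos 1) :- (η :+ η)) :* s :- s) := (η :+ η) :* s) refl η s)
        (*-nonneg 2η≥0 s≥0))
      (≤-from-difference (solve 2 (λ η s → η :- :- (η :+ (con (pos 1) :- (η :+ η)) :* s :- s) := (η :+ η) :* (con (pos 1) :- s)) refl η s)
        (*-nonneg 2η≥0 (x≤y⇒0≤y-x s≤1)))
      where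
      2η≥0 : 0# ≤ η + η
      2η≥0 = <⇒≤ (+-pos η>0 η>0)

    shrink-contracts : ∀ s t → abs (shrink η s - shrink η t) ≤ abs (s - t)
    shrink-contracts s t = begin
      abs (shrink η s - shrink η t)
        ≡⟨ cong abs (solve 3 (λ η s t → η :+ (con (pos 1) :- (η :+ η)) :* s :- (η :+ (con (pos 1) :- (η :+ η)) :* t) :=
             (con (pos 1) :- (η :+ η)) :* (s :- t)) refl η s t) ⟩
      abs ((1# - (η + η)) * (s - t))      ≡⟨ abs-* (1# - (η + η)) (s - t) ⟩
      abs (1# - (η + η)) * abs (s - t)    ≡⟨ cong (_* abs (s - t)) (abs-of-nonneg (<⇒≤ (x<y⇒0<y-x 2η<1))) ⟩
      (1# - (η + η)) * abs (s - t)
        ≤⟨ ≤-from-difference (solve 2 (λ η x → x :- (con (pos 1) :- (η :+ η)) :* x := (η :+ η) :* x) refl η (abs (s - t)))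
             (*-nonneg (<⇒≤ (+-pos η>0 η>0)) (abs-nonneg (s - t))) ⟩
      abs (s - t) ∎
      where open ≤-Reasoning

  -- No bound is assumed at the endpoints, where the velocity of a curve is one-sided and so
  -- need not be a tangent vector in the sense of Tangent.
  lipschitz-from-derivative : ∀ {φ B} → 0# ≤ B → Definable (FunctionGraph φ) →
    (∀ t → t ∈ [0,1] → ∃[ a ] DerivativeAt φ t a × (0# < t → t < 1# → abs a ≤ B)) →
    ∀ {s t} → s ∈ [0,1] → t ∈ [0,1] → abs (φ s - φ t) ≤ B * abs (s - t)
  lipschitz-from-derivative {φ} {B} B≥0 definable derivative {s} {t} s∈ t∈ =
    ≤-from-ε (1# + 1#) (<⇒≤ (+-pos 1>0 1>0)) λ ε ε>0 →
      let δ₁ , δ₁>0 , near-s = continuous s s∈ ε ε>0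
          δ₂ , δ₂>0 , near-t = continuous t t∈ ε ε>0
          δ₃ , δ₃>0 , δ₃≤δ₁ , δ₃≤δ₂ = pos-min δ₁>0 δ₂>0
          δ₄ , δ₄>0 , δ₄≤1 , δ₄≤δ₃ = pos-min 1>0 δ₃>0
          -- η is a quarter of δ₄, and δ₄ is at most 1 and at most δ₃; hence η + η < 1 and η < δ₃.
          η₀ , η₀>0 , η₀+η₀≡δ₄ = halve δ₄>0
          η , η>0 , η+η≡η₀ = halve η₀>0
          η<η₀ = subst (η <_) η+η≡η₀ (x<x+pos η>0)
          η₀<δ₄ = subst (η₀ <_) η₀+η₀≡δ₄ (x<x+pos η₀>0)
          2η<1 = subst (_< 1#) (sym η+η≡η₀) (<-≤-trans η₀<δ₄ δ₄≤1)
          η<δ₃ = <-≤-trans (<-trans η<η₀ η₀<δ₄) δ₄≤δ₃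
          s′ = shrink η s
          t′ = shrink η t
          s′>0 = shrink>0 η>0 2η<1 s∈
          s′<1 = shrink<1 η>0 2η<1 s∈
          t′>0 = shrink>0 η>0 2η<1 t∈
          t′<1 = shrink<1 η>0 2η<1 t∈
      in begin
      abs (φ s - φ t)
        ≤⟨ abs-≤-via (φ s - φ s′) (φ s′ - φ t)
             (solve 3 (λ x y z → x :- z := x :- y :+ (y :- z)) refl (φ s) (φ s′) (φ t)) ⟩
      abs (φ s - φ s′) + abs (φ s′ - φ t)
        ≤⟨ +-monoʳ-≤ _ (abs-≤-via (φ s′ - φ t′) (φ t′ - φ t)
             (solve 3 (λ x y z → x :- z := x :- y :+ (y :- z)) refl (φ s′) (φ t′) (φ t))) ⟩
      abs (φ s - φ s′) + (abs (φ s′ - φ t′) + abs (φ t′ - φ t))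
        ≤⟨ +-mono-≤ (subst (_≤ ε) (abs-minus-comm (φ s′) (φ s))
             (near-s s′ (<⇒≤ s′>0 , <⇒≤ s′<1) (≤-<-trans (shrink-near η>0 2η<1 s∈) (<-≤-trans η<δ₃ δ₃≤δ₁))))
           (+-mono-≤ (≤-trans (interior s′>0 s′<1 t′>0 t′<1) (*-monoʳ-≤ B≥0 (shrink-contracts η>0 2η<1 s t)))
             (near-t t′ (<⇒≤ t′>0 , <⇒≤ t′<1) (≤-<-trans (shrink-near η>0 2η<1 t∈) (<-≤-trans η<δ₃ δ₃≤δ₂)))) ⟩
      ε + (B * abs (s - t) + ε)
        ≡⟨ solve 2 (λ ε x → ε :+ (x :+ ε) := x :+ (con (pos 1) :+ con (pos 1)) :* ε) refl ε (B * abs (s - t)) ⟩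
      B * abs (s - t) + (1# + 1#) * ε ∎
    where
    open ≤-Reasoning
    continuous : ∀ t → t ∈ [0,1] → ContinuousAt φ t
    continuous t t∈ = derivative⇒continuous (proj₁ (proj₂ (derivative t t∈)))
    interior : ∀ {s t} → 0# < s → s < 1# → 0# < t → t < 1# → abs (φ s - φ t) ≤ B * abs (s - t)
    interior {s} {t} s>0 s<1 t>0 t<1 = ≤-from-ε (abs (s - t)) (abs-nonneg (s - t)) λ ε ε>0 →
      subst (abs (φ s - φ t) ≤_)
        (solve 3 (λ B ε x → (B :+ ε) :* x := B :* x :+ x :* ε) refl B ε (abs (s - t)))
        (interior-lipschitz definable
          (λ t t>0 t<1 → let a , d , bound = derivative t (<⇒≤ t>0 , <⇒≤ t<1) in
            derivative⇒growth d (bound t>0 t<1) ε ε>0)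
          s>0 s<1 t>0 t<1)

-- Euclidean norm

module EuclideanNorm (em : ∀ {ℓ} → ExcludedMiddle ℓ) {L : Language} (𝓚 : Structure L)
                     (ominimal : Structure.OMinimal 𝓚) where
  open Structure 𝓚
  open OrderedFieldProperties orderedField
  open OMinimality em 𝓚 ominimal using (sqrt)
  open Geometry 𝓚 using (FinitePoints)

  ∙-nonneg : ∀ {n} (v : Vec K n) → 0# ≤ v ∙ v
  ∙-nonneg []      = ≤-refl
  ∙-nonneg (x ∷ v) = +-nonneg (sq-nonneg x) (∙-nonneg v)

  ∙-minus : ∀ {n} (u v w : Vec K n) → u ∙ (v -ᵛ w) ≡ u ∙ v - u ∙ w
  ∙-minus []      []      []      = sym (-‿inverseʳ 0#)
  ∙-minus (x ∷ u) (y ∷ v) (z ∷ w) = trans (cong (x * (y - z) +_) (∙-minus u v w))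
    (solve 5 (λ x y z a b → x :* (y :- z) :+ (a :- b) := x :* y :+ a :- (x :* z :+ b)) refl x y z (u ∙ v) (u ∙ w))

  ∙-scale : ∀ {n} (u : Vec K n) a v → u ∙ (a ·ᵛ v) ≡ a * (u ∙ v)
  ∙-scale []      a []      = sym (zeroʳ a)
  ∙-scale (x ∷ u) a (y ∷ v) = trans (cong (x * (a * y) +_) (∙-scale u a v))
    (solve 4 (λ x a y b → x :* (a :* y) :+ a :* b := a :* (x :* y :+ b)) refl x a y (u ∙ v))

  ∙-comm : ∀ {n} (v w : Vec K n) → v ∙ w ≡ w ∙ v
  ∙-comm []      []      = refl
  ∙-comm (x ∷ v) (y ∷ w) = cong₂ _+_ (*-comm x y) (∙-comm v w)

  ∙-∷ʳ : ∀ {n} (v w : Vec K n) x y → (v ∷ʳ x) ∙ (w ∷ʳ y) ≡ v ∙ w + x * y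
  ∙-∷ʳ []      []      x y = +-comm _ _
  ∙-∷ʳ (a ∷ v) (b ∷ w) x y = trans (cong (a * b +_) (∙-∷ʳ v w x y)) (sym (+-assoc _ _ _))

  abstract
    norm : ∀ {n} → Vec K n → K
    norm v = proj₁ (sqrt (∙-nonneg v))

    norm-isNorm : ∀ {n} (v : Vec K n) → IsNorm v (norm v)
    norm-isNorm v = proj₂ (sqrt (∙-nonneg v))

  norm-nonneg : ∀ {n} (v : Vec K n) → 0# ≤ norm v
  norm-nonneg v = proj₁ (norm-isNorm v)

  norm-sq : ∀ {n} (v : Vec K n) → norm v * norm v ≡ v ∙ v
  norm-sq v = proj₂ (norm-isNorm v)

  -- Norms enter the definitions as a relation; this identifies each norm supplied there with the
  -- function `norm`.
  norm-unique : ∀ {n} {v : Vec K n} {d} → IsNorm v d → d ≡ norm v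
  norm-unique {v = v} (d≥0 , d²≡) = sq-cancel-≡ d≥0 (norm-nonneg v) (trans d²≡ (sym (norm-sq v)))

  -- By induction on the dimension. Each step is the planar case for the vectors (X, A) and (Y, B),
  -- where Lagrange's identity gives the defect of the squares as (X B - A Y)².
  cauchy-schwarz : ∀ {n} (v w : Vec K n) → abs (v ∙ w) ≤ norm v * norm w
  cauchy-schwarz [] [] = subst (_≤ norm [] * norm []) (sym (abs-of-nonneg ≤-refl)) (*-nonneg (norm-nonneg []) (norm-nonneg []))
  cauchy-schwarz (x ∷ v) (y ∷ w) =
    ≤-trans (abs-triangle (x * y) (v ∙ w)) (≤-trans (+-mono-≤ (≤-reflexive (abs-* x y)) (cauchy-schwarz v w))
      (sq-cancel-≤ (*-nonneg (norm-nonneg (x ∷ v)) (norm-nonneg (y ∷ w))) squares))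
    where
    X Y A B : K
    X = abs x
    Y = abs y
    A = norm v
    B = norm w
    norms : norm (x ∷ v) * norm (y ∷ w) * (norm (x ∷ v) * norm (y ∷ w)) ≡ (X * X + A * A) * (Y * Y + B * B)
    norms = trans (solve 2 (λ a b → a :* b :* (a :* b) := a :* a :* (b :* b)) refl (norm (x ∷ v)) (norm (y ∷ w)))
      (cong₂ _*_ (trans (norm-sq (x ∷ v)) (sym (cong₂ _+_ (abs-sq x) (norm-sq v))))
                 (trans (norm-sq (y ∷ w)) (sym (cong₂ _+_ (abs-sq y) (norm-sq w)))))
    squares : (X * Y + A * B) * (X * Y + A * B) ≤ norm (x ∷ v) * norm (y ∷ w) * (norm (x ∷ v) * norm (y ∷ w))
    squares = subst ((X * Y + A * B) * (X * Y + A * B) ≤_) (sym norms) (≤-from-difference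
      (solve 4 (λ X Y A B → (X :* X :+ A :* A) :* (Y :* Y :+ B :* B) :- (X :* Y :+ A :* B) :* (X :* Y :+ A :* B) :=
         (X :* B :- A :* Y) :* (X :* B :- A :* Y)) refl X Y A B)
      (sq-nonneg _))

  norm-minus : ∀ {n} (v w : Vec K n) → norm (v -ᵛ w) ≤ norm v + norm w
  norm-minus v w = sq-cancel-≤ (+-nonneg (norm-nonneg v) (norm-nonneg w)) (≤-from-difference
    (trans (cong (λ q → (norm v + norm w) * (norm v + norm w) - q) expand)
      (solve 3 (λ a b c → (a :+ b) :* (a :+ b) :- (a :* a :- (c :+ c) :+ b :* b) := (a :* b :+ c) :+ (a :* b :+ c)) refl
        (norm v) (norm w) (v ∙ w)))
    (+-nonneg nonneg nonneg))
    where
    expand : norm (v -ᵛ w) * norm (v -ᵛ w) ≡ norm v * norm v - (v ∙ w + v ∙ w) + norm w * norm w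
    expand = begin
      norm (v -ᵛ w) * norm (v -ᵛ w)          ≡⟨ norm-sq (v -ᵛ w) ⟩
      (v -ᵛ w) ∙ (v -ᵛ w)                    ≡⟨ ∙-minus (v -ᵛ w) v w ⟩
      (v -ᵛ w) ∙ v - (v -ᵛ w) ∙ w            ≡⟨ cong₂ _-_ (∙-comm (v -ᵛ w) v) (∙-comm (v -ᵛ w) w) ⟩
      v ∙ (v -ᵛ w) - w ∙ (v -ᵛ w)            ≡⟨ cong₂ _-_ (∙-minus v v w) (∙-minus w v w) ⟩
      v ∙ v - v ∙ w - (w ∙ v - w ∙ w)        ≡⟨ cong (λ c → v ∙ v - v ∙ w - (c - w ∙ w)) (∙-comm w v) ⟩
      v ∙ v - v ∙ w - (v ∙ w - w ∙ w)
        ≡⟨ solve 3 (λ a b c → a :- c :- (c :- b) := a :- (c :+ c) :+ b) refl (v ∙ v) (w ∙ w) (v ∙ w) ⟩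
      v ∙ v - (v ∙ w + v ∙ w) + w ∙ w        ≡⟨ cong₂ (λ a b → a - (v ∙ w + v ∙ w) + b) (norm-sq v) (norm-sq w) ⟨
      norm v * norm v - (v ∙ w + v ∙ w) + norm w * norm w ∎
      where open ≡-Reasoning
    nonneg : 0# ≤ norm v * norm w + v ∙ w
    nonneg = linear₁ (≤-trans (-x≤abs (v ∙ w)) (cauchy-schwarz v w))
      (solve 2 (λ a c → a :+ c :- con (pos 0) := a :- :- c) refl (norm v * norm w) (v ∙ w))

  norm-scale : ∀ {n} a (v : Vec K n) → norm (a ·ᵛ v) ≡ abs a * norm v
  norm-scale a v = sym (norm-unique (*-nonneg (abs-nonneg a) (norm-nonneg v) , (begin
    abs a * norm v * (abs a * norm v)   ≡⟨ solve 2 (λ x y → x :* y :* (x :* y) := x :* x :* (y :* y)) refl (abs a) (norm v) ⟩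
    abs a * abs a * (norm v * norm v)   ≡⟨ cong₂ _*_ (abs-sq a) (norm-sq v) ⟩
    a * a * (v ∙ v)                     ≡⟨ *-assoc a a (v ∙ v) ⟩
    a * (a * (v ∙ v))                   ≡⟨ cong (a *_) (∙-scale v a v) ⟨
    a * (v ∙ (a ·ᵛ v))                  ≡⟨ cong (a *_) (∙-comm v (a ·ᵛ v)) ⟩
    a * ((a ·ᵛ v) ∙ v)                  ≡⟨ ∙-scale (a ·ᵛ v) a v ⟨
    (a ·ᵛ v) ∙ (a ·ᵛ v)                 ∎)))
    where open ≡-Reasoning

  norm-singleton : ∀ x → norm [ x ] ≡ abs x
  norm-singleton x = sym (norm-unique (abs-nonneg x , trans (abs-sq x) (sym (+-identityʳ (x * x)))))

  norm-∷ʳ-sq : ∀ {n} (v : Vec K n) x → norm (v ∷ʳ x) * norm (v ∷ʳ x) ≡ norm v * norm v + abs x * abs x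
  norm-∷ʳ-sq v x = trans (norm-sq (v ∷ʳ x)) (trans (∙-∷ʳ v v x x) (sym (cong₂ _+_ (norm-sq v) (abs-sq x))))

  norm-∷ʳ-≤ : ∀ {n} (v : Vec K n) x → norm (v ∷ʳ x) ≤ norm v + abs x
  norm-∷ʳ-≤ v x = sq-cancel-≤ (+-nonneg (norm-nonneg v) (abs-nonneg x))
    (subst (_≤ (norm v + abs x) * (norm v + abs x)) (sym (norm-∷ʳ-sq v x)) (≤-from-difference
      (solve 2 (λ a b → (a :+ b) :* (a :+ b) :- (a :* a :+ b :* b) := a :* b :+ a :* b) refl (norm v) (abs x))
      (+-nonneg nonneg nonneg)))
    where
    nonneg : 0# ≤ norm v * abs x
    nonneg = *-nonneg (norm-nonneg v) (abs-nonneg x)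

  norm≤norm-∷ʳ : ∀ {n} (v : Vec K n) x → norm v ≤ norm (v ∷ʳ x)
  norm≤norm-∷ʳ v x = sq-cancel-≤ (norm-nonneg (v ∷ʳ x))
    (subst (norm v * norm v ≤_) (sym (norm-∷ʳ-sq v x)) (x≤x+nonneg (sq-nonneg (abs x))))

  abs≤norm-∷ʳ : ∀ {n} (v : Vec K n) x → abs x ≤ norm (v ∷ʳ x)
  abs≤norm-∷ʳ v x = sq-cancel-≤ (norm-nonneg (v ∷ʳ x))
    (subst (abs x * abs x ≤_) (trans (+-comm (abs x * abs x) (norm v * norm v)) (sym (norm-∷ʳ-sq v x)))
      (x≤x+nonneg (sq-nonneg (norm v))))

  norm-∷-≤ : ∀ {n} x (v : Vec K n) → norm (x ∷ v) ≤ abs x + norm v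
  norm-∷-≤ x v = sq-cancel-≤ (+-nonneg (abs-nonneg x) (norm-nonneg v))
    (subst (_≤ (abs x + norm v) * (abs x + norm v)) (trans (cong₂ _+_ (abs-sq x) (norm-sq v)) (sym (norm-sq (x ∷ v))))
      (≤-from-difference
        (solve 2 (λ a b → (a :+ b) :* (a :+ b) :- (a :* a :+ b :* b) := a :* b :+ a :* b) refl (abs x) (norm v))
        (+-nonneg nonneg nonneg)))
    where
    nonneg : 0# ≤ abs x * norm v
    nonneg = *-nonneg (abs-nonneg x) (norm-nonneg v)

  norm-minus-finite : ∀ {n} {v w : Vec K n} → FinitePoints v → FinitePoints w → Finite (norm (v -ᵛ w))
  norm-minus-finite {v = []} {[]} [] [] = finite-≤ (norm-nonneg []) (≤-reflexive (sym (norm-unique (≤-refl , zeroʳ 0#)))) finite-0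
  norm-minus-finite {v = x ∷ v} {y ∷ w} (fx ∷ fv) (fy ∷ fw) =
    finite-≤ (norm-nonneg (x - y ∷ (v -ᵛ w))) (norm-∷-≤ (x - y) (v -ᵛ w))
      (finite-+ (finite-abs (finite-+ fx (finite-neg fy))) (norm-minus-finite fv fw))

-- Lipschitz arcs

module SmoothArcs (em : ∀ {ℓ} → ExcludedMiddle ℓ) {L : Language} (𝓚 : Structure L)
                  (ominimal : Structure.OMinimal 𝓚) where
  open Structure 𝓚
  open Syntax L
  open OrderedFieldProperties orderedField
  open Definability 𝓚
  open OMinimality em 𝓚 ominimal
  open UnitInterval em 𝓚 ominimal
  open EuclideanNorm em 𝓚 ominimal
  open Geometry 𝓚

  -- The invariant carried through the induction on cells. The Lipschitz constant controls speed and
  -- length; differentiability at every t, without exceptional points, lets the functions that bound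
  -- the next cell be composed with γ by the chain rule.
  record SmoothArc {n} (γ : K → Vec K n) (Λ : K) : Set where
    field
      definable      : Definable (CurveGraph [0,1] γ)
      lipschitz      : ∀ {s t} → s ∈ [0,1] → t ∈ [0,1] → norm (γ s -ᵛ γ t) ≤ Λ * abs (s - t)
      differentiable : ∀ t → t ∈ [0,1] → ∃[ v ] HasDerivative [0,1] γ t v

  minus-minus : ∀ {n} (v w : Vec K n) → v -ᵛ (v -ᵛ w) ≡ w
  minus-minus []      []      = refl
  minus-minus (x ∷ v) (y ∷ w) = cong₂ _∷_ (solve 2 (λ x y → x :- (x :- y) := y) refl x y) (minus-minus v w)

  0∈[0,1] : 0# ∈ [0,1]
  0∈[0,1] = ≤-refl , <⇒≤ 1>0

  1∈[0,1] : 1# ∈ [0,1]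
  1∈[0,1] = <⇒≤ 1>0 , ≤-refl

  -- Supplies a point for a nontrivial difference quotient at t, taken to the right of t except at t
  -- = 1.
  nearby : ∀ {t δ} → t ∈ [0,1] → 0# < δ → ∃[ s ] s ∈ [0,1] × 0# < abs (s - t) × abs (s - t) < δ
  nearby {t} {δ} (t≥0 , inj₁ t<1) δ>0 =
    let s , t<s , s<1 , s<t+δ = between-below 1# (t + δ) t<1 (x<x+pos δ>0)
        s-t>0 = x<y⇒0<y-x t<s
        e = abs-of-nonneg (<⇒≤ s-t>0)
    in s , (≤-trans t≥0 (<⇒≤ t<s) , <⇒≤ s<1) , subst (0# <_) (sym e) s-t>0 , subst (_< δ) (sym e)
         (<-from-difference (solve 3 (λ s t δ → δ :- (s :- t) := t :+ δ :- s) refl s t δ) (x<y⇒0<y-x s<t+δ))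
  nearby {t} {δ} (t≥0 , inj₂ refl) δ>0 =
    let s , 0<s , 1-δ<s , s<1 = between-above 0# (1# - δ) 1>0 (x-pos<x δ>0)
        1-s>0 = x<y⇒0<y-x s<1
        e = trans (abs-minus-comm s 1#) (abs-of-nonneg (<⇒≤ 1-s>0))
    in s , (<⇒≤ 0<s , <⇒≤ s<1) , subst (0# <_) (sym e) 1-s>0 , subst (_< δ) (sym e)
         (<-from-difference (solve 2 (λ s δ → δ :- (con (pos 1) :- s) := s :- (con (pos 1) :- δ)) refl s δ) (x<y⇒0<y-x 1-δ<s))

  private
    abs-1-0 : abs (1# - 0#) ≡ 1#
    abs-1-0 = trans (cong abs (solve 0 (con (pos 1) :- con (pos 0) := con (pos 1)) refl)) (abs-of-nonneg (<⇒≤ 1>0))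

  lipschitz-constant-nonneg : ∀ {n} {γ : K → Vec K n} {Λ} → SmoothArc γ Λ → 0# ≤ Λ
  lipschitz-constant-nonneg {γ = γ} {Λ} arc = ≤-trans (norm-nonneg (γ 1# -ᵛ γ 0#))
    (subst (norm (γ 1# -ᵛ γ 0#) ≤_) (trans (cong (Λ *_) abs-1-0) (*-identityʳ Λ))
      (SmoothArc.lipschitz arc 1∈[0,1] 0∈[0,1]))

  -- Difference quotients have norm at most Λ, and v is within ε of one of them.
  velocity-bound : ∀ {n} {γ : K → Vec K n} {Λ t v} → SmoothArc γ Λ → HasDerivative [0,1] γ t v → norm v ≤ Λ
  velocity-bound {γ = γ} {Λ} {t} {v} arc (t∈ , derivative) = ≤-from-ε 1# (<⇒≤ 1>0) λ ε ε>0 →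
    let δ , δ>0 , approx = derivative ε ε>0
        s , s∈ , 0<h , h<δ = nearby t∈ δ>0
        d , isNorm , d≤ = approx s s∈ h<δ
        h = abs (s - t)
        Δ = γ s -ᵛ γ t
    in *-cancelʳ-≤ 0<h (begin
      norm v * h                                 ≡⟨ *-comm (norm v) h ⟩
      h * norm v                                 ≡⟨ norm-scale (s - t) v ⟨
      norm ((s - t) ·ᵛ v)                        ≡⟨ cong norm (minus-minus Δ ((s - t) ·ᵛ v)) ⟨
      norm (Δ -ᵛ (Δ -ᵛ (s - t) ·ᵛ v))            ≤⟨ norm-minus Δ (Δ -ᵛ (s - t) ·ᵛ v) ⟩
      norm Δ + norm (Δ -ᵛ (s - t) ·ᵛ v)          ≤⟨ +-mono-≤ (SmoothArc.lipschitz arc s∈ t∈)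
                                                      (subst (_≤ ε * h) (norm-unique isNorm) d≤) ⟩
      Λ * h + ε * h                              ≡⟨ solve 3 (λ Λ h ε → Λ :* h :+ ε :* h := (Λ :+ con (pos 1) :* ε) :* h) refl Λ h ε ⟩
      (Λ + 1# * ε) * h                           ∎)
    where open ≤-Reasoning

  -- The chain rule for f restricted to X. It makes sense also when X is not open, as g acts on all
  -- of Kᵐ and f is evaluated only at points of γ.
  composite-derivative : ∀ {m} {X : Pred (Vec K m) 0ℓ} {f γ Λ t g v} → SmoothArc γ Λ →
                         (∀ t → t ∈ [0,1] → γ t ∈ X) →
                         IsDifferential X f (γ t) g → HasDerivative [0,1] γ t v →
                         DerivativeAt (f ∘ γ) t (g ∙ v)
  composite-derivative {X = X} {f} {γ} {Λ} {t} {g} {v} arc into differential (t∈ , derivative) ε ε>0 =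
    -- With h = |s - t|, the linear approximation of f errs by at most ε′ Λ h, and that of γ, paired
    -- with g, by at most |g| ε′ h.
    let ε′ , ε′>0 , Cε′<ε = pos-multiple-below (Λ + norm g) C≥0 ε>0
        δ₁ , δ₁>0 , approx-f = differential ε′ ε′>0
        δ₂ , δ₂>0 , approx-γ = derivative ε′ ε′>0
        δ₃ , δ₃>0 , Λδ₃<δ₁ = pos-multiple-below Λ Λ≥0 δ₁>0
        δ , δ>0 , δ≤δ₂ , δ≤δ₃ = pos-min δ₂>0 δ₃>0
    in δ , δ>0 , λ s s∈ h<δ →
      let h = abs (s - t)
          h≥0 = abs-nonneg (s - t)
          Δ = γ s -ᵛ γ t
          normΔ≤ = SmoothArc.lipschitz arc s∈ t∈
          d , isNorm , d≤ = approx-γ s s∈ (<-≤-trans h<δ δ≤δ₂)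
          rest≤ = subst (_≤ ε′ * h) (norm-unique isNorm) d≤
          f-rest≤ = approx-f (γ s) (into s s∈) (norm Δ) (norm-isNorm Δ)
            (≤-<-trans normΔ≤ (≤-<-trans (*-monoʳ-≤ Λ≥0 (≤-trans (<⇒≤ h<δ) δ≤δ₃)) Λδ₃<δ₁))
          g-rest≡ = trans (∙-minus g Δ ((s - t) ·ᵛ v)) (cong (λ w → g ∙ Δ - w) (∙-scale g (s - t) v))
      in begin
        abs (f (γ s) - f (γ t) - (s - t) * (g ∙ v))
          ≤⟨ abs-≤-via (f (γ s) - f (γ t) - g ∙ Δ) (g ∙ (Δ -ᵛ (s - t) ·ᵛ v))
               (trans (solve 3 (λ x w z → x :- z := x :- w :+ (w :- z)) refl (f (γ s) - f (γ t)) (g ∙ Δ) ((s - t) * (g ∙ v)))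
                 (cong (f (γ s) - f (γ t) - g ∙ Δ +_) (sym g-rest≡))) ⟩
        abs (f (γ s) - f (γ t) - g ∙ Δ) + abs (g ∙ (Δ -ᵛ (s - t) ·ᵛ v))
          ≤⟨ +-mono-≤ (≤-trans f-rest≤ (*-monoʳ-≤ (<⇒≤ ε′>0) normΔ≤))
               (≤-trans (cauchy-schwarz g (Δ -ᵛ (s - t) ·ᵛ v)) (*-monoʳ-≤ (norm-nonneg g) rest≤)) ⟩
        ε′ * (Λ * h) + norm g * (ε′ * h)
          ≡⟨ solve 4 (λ ε Λ g h → ε :* (Λ :* h) :+ g :* (ε :* h) := (Λ :+ g) :* ε :* h) refl ε′ Λ (norm g) h ⟩
        (Λ + norm g) * ε′ * h
          ≤⟨ *-monoˡ-≤ h≥0 (<⇒≤ Cε′<ε) ⟩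
        ε * h ∎
    where
    open ≤-Reasoning
    Λ≥0 : 0# ≤ Λ
    Λ≥0 = lipschitz-constant-nonneg arc
    C≥0 : 0# ≤ Λ + norm g
    C≥0 = +-nonneg Λ≥0 (norm-nonneg g)

  -- The witnessing curve is γ with time shifted by t. `Tangent` demands it on both sides of time 0,
  -- so δ is kept below both t and 1 - t.
  velocity-tangent : ∀ {m} {X : Pred (Vec K m) 0ℓ} {γ Λ t v} → SmoothArc γ Λ → (∀ t → t ∈ [0,1] → γ t ∈ X) →
                     0# < t → t < 1# → HasDerivative [0,1] γ t v → v ∈ Tangent X (γ t)
  velocity-tangent {m} {X} {γ} {Λ} {t} {v} arc into t>0 t<1 (t∈ , derivative) =
    δ , δ>0 , shifted , definable , (λ τ τ∈ → into (t + τ) (shift∈ τ τ∈)) , cong γ (+-identityʳ t) ,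
    0∈I , λ ε ε>0 → let δ′ , δ′>0 , approx = derivative ε ε>0 in δ′ , δ′>0 , λ τ τ∈ τ<δ′ →
      let same = solve 2 (λ t τ → t :+ τ :- t := τ :- con (pos 0)) refl t τ
          d , isNorm , d≤ = approx (t + τ) (shift∈ τ τ∈) (subst (λ u → abs u < δ′) (sym same) τ<δ′)
      in d , subst₂ (λ p u → IsNorm (γ (t + τ) -ᵛ p -ᵛ u ·ᵛ v) d) (cong γ (sym (+-identityʳ t))) same isNorm
           , subst (λ u → d ≤ ε * abs u) same d≤
    where
    shifted : K → Vec K m
    shifted τ = γ (t + τ)
    small = pos-min t>0 (x<y⇒0<y-x t<1)
    δ = proj₁ small
    δ>0 = proj₁ (proj₂ small)
    δ≤t = proj₁ (proj₂ (proj₂ small))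
    δ≤1-t = proj₂ (proj₂ (proj₂ small))
    I : Pred K 0ℓ
    I τ = abs τ < δ
    0∈I : 0# ∈ I
    0∈I = subst (_< δ) (sym (abs-of-nonneg ≤-refl)) δ>0
    shift∈ : ∀ τ → τ ∈ I → t + τ ∈ [0,1]
    shift∈ τ τ∈ =
        linear₂ (<⇒≤ (≤-<-trans (-x≤abs τ) τ∈)) δ≤t
          (solve 3 (λ t τ δ → t :+ τ :- con (pos 0) := (δ :- :- τ) :+ (t :- δ)) refl t τ δ)
      , linear₂ (<⇒≤ (≤-<-trans (x≤abs τ) τ∈)) δ≤1-t
          (solve 3 (λ t τ δ → con (pos 1) :- (t :+ τ) := (δ :- τ) :+ (con (pos 1) :- t :- δ)) refl t τ δ)
    definable : Definable (CurveGraph I shifted)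
    -- Terms have no absolute value, so the domain is described by -δ < τ < δ.
    definable = definable-resp
      (λ { (τ ∷ p) → mk⇔
        (λ ((-δ<τ , τ<δ) , _ , e) →
            abs-lub-< τ<δ (<-from-difference (solve 2 (λ τ δ → δ :- :- τ := τ :- :- δ) refl τ δ) (x<y⇒0<y-x -δ<τ))
          , trans (sym (Vec.tabulate∘lookup p)) e)
        (λ (τ∈ , e) →
            ( <-from-difference (solve 2 (λ τ δ → τ :- :- δ := δ :- :- τ) refl τ δ) (x<y⇒0<y-x (≤-<-trans (-x≤abs τ) τ∈))
            , ≤-<-trans (x≤abs τ) τ∈)
          , shift∈ τ τ∈ , trans (Vec.tabulate∘lookup p) e) })
      (definable-∩
        (definable-∩ (definable-< (par (- δ)) (var zero)) (definable-< (var zero) (par δ)))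
        (definable-preimage ((par t +̇ var zero) ∷ vars suc) (λ z → (t + lookup z zero) ∷ tabulate (lookup z ∘ suc))
          (λ z → cong ((t + lookup z zero) ∷_) (eval-vars id z suc)) (SmoothArc.definable arc)))

  -- The intermediate point p = γ t is quantified away. In p ++ z the first m variables are p,
  -- followed by t and the value of f; a curve graph carries its parameter in front, the graph of f
  -- its value at the end.
  composite-definable : ∀ {m} {X : Pred (Vec K m) 0ℓ} {f γ} → Definable (CurveGraph [0,1] γ) →
                        (∀ t → t ∈ [0,1] → γ t ∈ X) → Definable (Graph X f) → Definable (FunctionGraph (f ∘ γ))
  composite-definable {m} {X} {f} {γ} definable-γ into definable-f = definable-resp
    (λ z → mk⇔
      (λ (p , onCurve , onGraph) →
        let t∈ , p≡ = subst (CurveGraph [0,1] γ) (curve-point p z) onCurve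
            _ , v≡ = subst (Graph X f) (graph-point p z) onGraph
        in t∈ , trans (sym (Vec.last-∷ʳ (lookup z (suc zero)) p)) (trans v≡ (cong f (trans (Vec.init-∷ʳ (lookup z (suc zero)) p) p≡))))
      (λ (t∈ , v≡) →
        let p = γ (lookup z zero)
        in p , subst (CurveGraph [0,1] γ) (sym (curve-point p z)) (t∈ , refl)
             , subst (Graph X f) (sym (graph-point p z))
                 ( subst X (sym (Vec.init-∷ʳ (lookup z (suc zero)) p)) (into _ t∈)
                 , trans (Vec.last-∷ʳ (lookup z (suc zero)) p) (trans v≡ (cong f (sym (Vec.init-∷ʳ (lookup z (suc zero)) p)))))))
    (definable-∃ᵛ m (definable-∩
      (definable-preimage (var (m ↑ʳ zero) ∷ vars (_↑ˡ 2)) onCurveAt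
        (λ y → cong (lookup y (m ↑ʳ zero) ∷_) (eval-vars id y (_↑ˡ 2))) definable-γ)
      (definable-preimage (vars (_↑ˡ 2) ∷ʳ var (m ↑ʳ suc zero)) onGraphAt
        (λ y → trans (Vec.map-∷ʳ _ _ (vars (_↑ˡ 2))) (cong (_∷ʳ lookup y (m ↑ʳ suc zero)) (eval-vars id y (_↑ˡ 2)))) definable-f)))
    where
    onCurveAt onGraphAt : Vec K (m ℕ.+ 2) → Vec K (suc m)
    onCurveAt y = lookup y (m ↑ʳ zero) ∷ tabulate (lookup y ∘ (_↑ˡ 2))
    onGraphAt y = tabulate (lookup y ∘ (_↑ˡ 2)) ∷ʳ lookup y (m ↑ʳ suc zero)
    prefix : ∀ (p : Vec K m) (z : Vec K 2) → tabulate (lookup (p ++ z) ∘ (_↑ˡ 2)) ≡ p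
    prefix p z = trans (Vec.tabulate-cong (Vec.lookup-++ˡ p z)) (Vec.tabulate∘lookup p)
    curve-point : ∀ p z → onCurveAt (p ++ z) ≡ lookup z zero ∷ p
    curve-point p z = cong₂ _∷_ (Vec.lookup-++ʳ p z zero) (prefix p z)
    graph-point : ∀ p z → onGraphAt (p ++ z) ≡ p ∷ʳ lookup z (suc zero)
    graph-point p z = cong₂ _∷ʳ_ (prefix p z) (Vec.lookup-++ʳ p z (suc zero))

  module Composite {m} {X : Pred (Vec K m) 0ℓ} {f : Vec K m → K} {M : K} {γ : K → Vec K m} {Λ : K}
                   (M≥0 : 0# ≤ M) (M-function : IsC¹MFunction M X f) (arc : SmoothArc γ Λ)
                   (into : ∀ t → t ∈ [0,1] → γ t ∈ X) where
    open IsC¹MFunction M-function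

    definable∘ : Definable (FunctionGraph (f ∘ γ))
    definable∘ = composite-definable {X = X} {f} {γ} (SmoothArc.definable arc) into definable

    -- At an interior t the velocity v is tangent to X, so |Df(v)| ≤ M |v| ≤ M Λ.
    differentiable∘ : ∀ t → t ∈ [0,1] → ∃[ a ] DerivativeAt (f ∘ γ) t a × (0# < t → t < 1# → abs a ≤ M * Λ)
    differentiable∘ t t∈ = let v , d = SmoothArc.differentiable arc t t∈ in
        G (γ t) ∙ v
      , composite-derivative {X = X} {f} {γ} {g = G (γ t)} {v} arc into (isDifferential (γ t) (into t t∈)) d
      , λ t>0 t<1 → ≤-trans
          (bound (γ t) (into t t∈) v (velocity-tangent {X = X} arc into t>0 t<1 d) (norm v) (norm-isNorm v))
          (*-monoʳ-≤ M≥0 (velocity-bound arc d))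

    lipschitz∘ : ∀ {s t} → s ∈ [0,1] → t ∈ [0,1] → abs (f (γ s) - f (γ t)) ≤ M * Λ * abs (s - t)
    lipschitz∘ = lipschitz-from-derivative (*-nonneg M≥0 (lipschitz-constant-nonneg arc)) definable∘ differentiable∘

  -- Adding a last coordinate to an arc

  minus-∷ʳ : ∀ {n} (v w : Vec K n) x y → (v ∷ʳ x) -ᵛ (w ∷ʳ y) ≡ (v -ᵛ w) ∷ʳ (x - y)
  minus-∷ʳ []      []      x y = refl
  minus-∷ʳ (a ∷ v) (b ∷ w) x y = cong (a - b ∷_) (minus-∷ʳ v w x y)

  -- The constants add because the Euclidean norm of (v, x) is at most |v| + |x|.
  arc-∷ʳ : ∀ {n} {γ : K → Vec K n} {h Λ A} → SmoothArc γ Λ → Definable (FunctionGraph h) →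
           (∀ {s t} → s ∈ [0,1] → t ∈ [0,1] → abs (h s - h t) ≤ A * abs (s - t)) →
           (∀ t → t ∈ [0,1] → ∃[ a ] DerivativeAt h t a) →
           SmoothArc (λ t → γ t ∷ʳ h t) (Λ + A)
  arc-∷ʳ {n} {γ} {h} {Λ} {A} arc definable-h lipschitz-h differentiable-h = record
    { definable      = definable
    ; lipschitz      = lipschitz
    ; differentiable = λ t t∈ →
        let v , velocity = SmoothArc.differentiable arc t t∈
            a , slope = differentiable-h t t∈
        in v ∷ʳ a , t∈ , derivative t v a velocity slope
    }
    where
    point-γ : Vec K (suc (suc n)) → Vec K (suc n)
    point-γ z = lookup z zero ∷ tabulate (lookup z ∘ suc ∘ inject₁)
    point-h : Vec K (suc (suc n)) → Vec K 2
    point-h z = lookup z zero ∷ lookup z (suc (maxFin n)) ∷ []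
    definable : Definable (CurveGraph [0,1] (λ t → γ t ∷ʳ h t))
    definable = definable-resp
      (λ { (t ∷ w) → mk⇔
        (λ ((t∈ , p≡) , (_ , x≡)) → t∈ , trans (sym (init-∷ʳ-last w))
          (cong₂ _∷ʳ_ (trans (sym (tabulate-inject₁ w)) p≡) (trans (sym (lookup-maxFin w)) x≡)))
        (λ (t∈ , w≡) →
            (t∈ , trans (tabulate-inject₁ w) (trans (cong init w≡) (Vec.init-∷ʳ (h t) (γ t))))
          , (t∈ , trans (lookup-maxFin w) (trans (cong last w≡) (Vec.last-∷ʳ (h t) (γ t))))) })
      (definable-∩
        (definable-preimage (var zero ∷ vars (suc ∘ inject₁)) point-γ
          (λ z → cong (lookup z zero ∷_) (eval-vars id z (suc ∘ inject₁))) (SmoothArc.definable arc))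
        (definable-preimage (var zero ∷ var (suc (maxFin n)) ∷ []) point-h (λ _ → refl) definable-h))
    lipschitz : ∀ {s t} → s ∈ [0,1] → t ∈ [0,1] →
                norm ((γ s ∷ʳ h s) -ᵛ (γ t ∷ʳ h t)) ≤ (Λ + A) * abs (s - t)
    lipschitz {s} {t} s∈ t∈ = begin
      norm ((γ s ∷ʳ h s) -ᵛ (γ t ∷ʳ h t))     ≡⟨ cong norm (minus-∷ʳ (γ s) (γ t) (h s) (h t)) ⟩
      norm ((γ s -ᵛ γ t) ∷ʳ (h s - h t))      ≤⟨ norm-∷ʳ-≤ (γ s -ᵛ γ t) (h s - h t) ⟩
      norm (γ s -ᵛ γ t) + abs (h s - h t)     ≤⟨ +-mono-≤ (SmoothArc.lipschitz arc s∈ t∈) (lipschitz-h s∈ t∈) ⟩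
      Λ * abs (s - t) + A * abs (s - t)       ≡⟨ solve 3 (λ Λ A x → Λ :* x :+ A :* x := (Λ :+ A) :* x) refl Λ A (abs (s - t)) ⟩
      (Λ + A) * abs (s - t)                   ∎
      where open ≤-Reasoning
    split : ∀ s t v a → (γ s ∷ʳ h s) -ᵛ (γ t ∷ʳ h t) -ᵛ (s - t) ·ᵛ (v ∷ʳ a) ≡
                        (γ s -ᵛ γ t -ᵛ (s - t) ·ᵛ v) ∷ʳ (h s - h t - (s - t) * a)
    split s t v a = trans (cong₂ _-ᵛ_ (minus-∷ʳ (γ s) (γ t) (h s) (h t)) (Vec.map-∷ʳ ((s - t) *_) a v))
      (minus-∷ʳ (γ s -ᵛ γ t) ((s - t) ·ᵛ v) (h s - h t) ((s - t) * a))
    derivative : ∀ t v a → HasDerivative [0,1] γ t v → DerivativeAt h t a → ∀ ε → 0# < ε → ∃[ δ ] 0# < δ ×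
      (∀ s → s ∈ [0,1] → abs (s - t) < δ →
        ∃[ d ] IsNorm ((γ s ∷ʳ h s) -ᵛ (γ t ∷ʳ h t) -ᵛ (s - t) ·ᵛ (v ∷ʳ a)) d × d ≤ ε * abs (s - t))
    derivative t v a (_ , approx-γ) approx-h ε ε>0 =
      let ε′ , ε′>0 , ε′+ε′≡ε = halve ε>0
          δ₁ , δ₁>0 , near-γ = approx-γ ε′ ε′>0
          δ₂ , δ₂>0 , near-h = approx-h ε′ ε′>0
          δ , δ>0 , δ≤δ₁ , δ≤δ₂ = pos-min δ₁>0 δ₂>0
      in δ , δ>0 , λ s s∈ s-t<δ →
        let p = γ s -ᵛ γ t -ᵛ (s - t) ·ᵛ v
            x = h s - h t - (s - t) * a
            d , isNorm , d≤ = near-γ s s∈ (<-≤-trans s-t<δ δ≤δ₁)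
        in norm (p ∷ʳ x) , subst (λ w → IsNorm w (norm (p ∷ʳ x))) (sym (split s t v a)) (norm-isNorm (p ∷ʳ x)) , (begin
          norm (p ∷ʳ x)                            ≤⟨ norm-∷ʳ-≤ p x ⟩
          norm p + abs x                           ≤⟨ +-mono-≤ (subst (_≤ ε′ * abs (s - t)) (norm-unique isNorm) d≤)
                                                               (near-h s s∈ (<-≤-trans s-t<δ δ≤δ₂)) ⟩
          ε′ * abs (s - t) + ε′ * abs (s - t)      ≡⟨ solve 2 (λ ε x → ε :* x :+ ε :* x := (ε :+ ε) :* x) refl ε′ (abs (s - t)) ⟩
          (ε′ + ε′) * abs (s - t)                  ≡⟨ cong (_* abs (s - t)) ε′+ε′≡ε ⟩
          ε * abs (s - t)                          ∎)
      where open ≤-Reasoning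

  -- Interpolation between two functions with a linear weight

  blend : (F G : K → K) (α β : K) → K → K
  blend F G α β t = F t + (α + t * (β - α)) * (G t - F t)

  module Blend {F G : K → K} {A α β : K} (α∈ : α ∈ [0,1]) (β∈ : β ∈ [0,1]) (A≥0 : 0# ≤ A)
               (F≤G : ∀ t → t ∈ [0,1] → F t ≤ G t)
               (lipschitz-F : ∀ {s t} → s ∈ [0,1] → t ∈ [0,1] → abs (F s - F t) ≤ A * abs (s - t))
               (lipschitz-G : ∀ {s t} → s ∈ [0,1] → t ∈ [0,1] → abs (G s - G t) ≤ A * abs (s - t)) where
    private
      κ : K
      κ = β - α
      weight : K → K
      weight t = α + t * κ
      h : K → K
      h = blend F G α β

    weight∈ : ∀ {t} → t ∈ [0,1] → weight t ∈ [0,1]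
    weight∈ {t} (t≥0 , t≤1) =
        ≤-from-difference
          (solve 3 (λ α β t → α :+ t :* (β :- α) :- con (pos 0) := (con (pos 1) :- t) :* α :+ t :* β) refl α β t)
          (+-nonneg (*-nonneg (x≤y⇒0≤y-x t≤1) (proj₁ α∈)) (*-nonneg t≥0 (proj₁ β∈)))
      , ≤-from-difference
          (solve 3 (λ α β t → con (pos 1) :- (α :+ t :* (β :- α)) :=
             (con (pos 1) :- t) :* (con (pos 1) :- α) :+ t :* (con (pos 1) :- β)) refl α β t)
          (+-nonneg (*-nonneg (x≤y⇒0≤y-x t≤1) (x≤y⇒0≤y-x (proj₂ α∈))) (*-nonneg t≥0 (x≤y⇒0≤y-x (proj₂ β∈))))

    private
      |κ|≤1 : abs κ ≤ 1#
      |κ|≤1 = abs-lub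
        (linear₂ (proj₁ α∈) (proj₂ β∈)
          (solve 2 (λ α β → con (pos 1) :- (β :- α) := (α :- con (pos 0)) :+ (con (pos 1) :- β)) refl α β))
        (linear₂ (proj₁ β∈) (proj₂ α∈)
          (solve 2 (λ α β → con (pos 1) :- :- (β :- α) := (β :- con (pos 0)) :+ (con (pos 1) :- α)) refl α β))

      mean-≤ : ∀ {w x y B} → w ∈ [0,1] → abs x ≤ B → abs y ≤ B → abs ((1# - w) * x + w * y) ≤ B
      mean-≤ {w} {x} {y} {B} (w≥0 , w≤1) x≤B y≤B = begin
        abs ((1# - w) * x + w * y)             ≤⟨ abs-triangle ((1# - w) * x) (w * y) ⟩
        abs ((1# - w) * x) + abs (w * y)       ≡⟨ cong₂ _+_ (abs-* (1# - w) x) (abs-* w y) ⟩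
        abs (1# - w) * abs x + abs w * abs y
          ≡⟨ cong₂ (λ p q → p * abs x + q * abs y) (abs-of-nonneg (x≤y⇒0≤y-x w≤1)) (abs-of-nonneg w≥0) ⟩
        (1# - w) * abs x + w * abs y
          ≤⟨ +-mono-≤ (*-monoʳ-≤ (x≤y⇒0≤y-x w≤1) x≤B) (*-monoʳ-≤ w≥0 y≤B) ⟩
        (1# - w) * B + w * B                   ≡⟨ solve 2 (λ w B → (con (pos 1) :- w) :* B :+ w :* B := B) refl w B ⟩
        B                                      ∎
        where open ≤-Reasoning

      |1-t|≤1 : ∀ {t} → t ∈ [0,1] → abs (1# - t) ≤ 1#
      |1-t|≤1 {t} (t≥0 , t≤1) = subst (_≤ 1#) (sym (abs-of-nonneg (x≤y⇒0≤y-x t≤1)))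
        (linear₁ t≥0 (solve 1 (λ t → con (pos 1) :- (con (pos 1) :- t) := t :- con (pos 0)) refl t))

      increment≤A : ∀ {φ : K → K} → (∀ {s t} → s ∈ [0,1] → t ∈ [0,1] → abs (φ s - φ t) ≤ A * abs (s - t)) →
                    ∀ {t} → t ∈ [0,1] → abs (φ 1# - φ t) ≤ A
      increment≤A lipschitz {t} t∈ = ≤-trans (lipschitz 1∈[0,1] t∈)
        (subst (A * abs (1# - t) ≤_) (*-identityʳ A) (*-monoʳ-≤ A≥0 (|1-t|≤1 t∈)))

      -- The increment of h over [0,1] splits into the change at fixed weight α, which is a mean of
      -- the increments of F and G and so at most A, and the change of weight at time 1, which is κ
      -- times the final gap. This trades the uncontrolled gap for the known change of height.
      |κ|*gap₁ : abs κ * (G 1# - F 1#) ≤ A + abs (h 1# - h 0#)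
      |κ|*gap₁ = begin
        abs κ * (G 1# - F 1#)
          ≡⟨ cong (abs κ *_) (abs-of-nonneg (x≤y⇒0≤y-x (F≤G 1# 1∈[0,1]))) ⟨
        abs κ * abs (G 1# - F 1#)
          ≡⟨ abs-* κ (G 1# - F 1#) ⟨
        abs (κ * (G 1# - F 1#))
          ≤⟨ abs-≤-via (- ((1# - α) * (F 1# - F 0#) + α * (G 1# - G 0#))) (h 1# - h 0#)
               (solve 6 (λ α β f₀ f₁ g₀ g₁ → (β :- α) :* (g₁ :- f₁) :=
                  :- ((con (pos 1) :- α) :* (f₁ :- f₀) :+ α :* (g₁ :- g₀)) :+
                  (f₁ :+ (α :+ con (pos 1) :* (β :- α)) :* (g₁ :- f₁) :-
                   (f₀ :+ (α :+ con (pos 0) :* (β :- α)) :* (g₀ :- f₀)))) refl α β (F 0#) (F 1#) (G 0#) (G 1#)) ⟩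
        abs (- ((1# - α) * (F 1# - F 0#) + α * (G 1# - G 0#))) + abs (h 1# - h 0#)
          ≡⟨ cong (_+ abs (h 1# - h 0#)) (abs-neg _) ⟩
        abs ((1# - α) * (F 1# - F 0#) + α * (G 1# - G 0#)) + abs (h 1# - h 0#)
          ≤⟨ +-monoˡ-≤ _ (mean-≤ α∈ (increment≤A lipschitz-F 0∈[0,1]) (increment≤A lipschitz-G 0∈[0,1])) ⟩
        A + abs (h 1# - h 0#) ∎
        where open ≤-Reasoning

      -- Between t and 1 each of F and G changes by at most A, hence the gap by at most 2A, and |κ|
      -- ≤ 1.
      |κ|*gap : ∀ {t} → t ∈ [0,1] → abs κ * (G t - F t) ≤ A + A + A + abs (h 1# - h 0#)
      |κ|*gap {t} t∈ = begin
        abs κ * (G t - F t)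
          ≤⟨ *-monoʳ-≤ (abs-nonneg κ) (linear₂ (-x≤G) (x≤F)
               (solve 5 (λ f g f₁ g₁ A → g₁ :- f₁ :+ (A :+ A) :- (g :- f) :=
                  (A :- :- (g₁ :- g)) :+ (A :- (f₁ :- f))) refl (F t) (G t) (F 1#) (G 1#) A)) ⟩
        abs κ * (G 1# - F 1# + (A + A))
          ≡⟨ solve 3 (λ k d A → k :* (d :+ (A :+ A)) := k :* d :+ k :* (A :+ A)) refl (abs κ) (G 1# - F 1#) A ⟩
        abs κ * (G 1# - F 1#) + abs κ * (A + A)
          ≤⟨ +-mono-≤ |κ|*gap₁ (*-monoˡ-≤ (+-nonneg A≥0 A≥0) |κ|≤1) ⟩
        A + abs (h 1# - h 0#) + 1# * (A + A)
          ≡⟨ solve 2 (λ A d → A :+ d :+ con (pos 1) :* (A :+ A) := A :+ A :+ A :+ d) refl A (abs (h 1# - h 0#)) ⟩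
        A + A + A + abs (h 1# - h 0#) ∎
        where
        open ≤-Reasoning
        -x≤G : - (G 1# - G t) ≤ A
        -x≤G = ≤-trans (-x≤abs _) (increment≤A lipschitz-G t∈)
        x≤F : F 1# - F t ≤ A
        x≤F = ≤-trans (x≤abs _) (increment≤A lipschitz-F t∈)

    -- The increment of h is the increment of F and G averaged at the weight of s, plus the drift (s
    -- - t) κ (G t - F t). The first accounts for A, the second for 3A + |h 1 - h 0|.
    blend-lipschitz : ∀ {s t} → s ∈ [0,1] → t ∈ [0,1] →
                      abs (h s - h t) ≤ (A + A + A + A + abs (h 1# - h 0#)) * abs (s - t)
    blend-lipschitz {s} {t} s∈ t∈ = begin
      abs (h s - h t)
        ≤⟨ abs-≤-via ((1# - weight s) * (F s - F t) + weight s * (G s - G t)) ((s - t) * (κ * (G t - F t)))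
             (solve 8 (λ α κ s t fₛ fₜ gₛ gₜ →
                fₛ :+ (α :+ s :* κ) :* (gₛ :- fₛ) :- (fₜ :+ (α :+ t :* κ) :* (gₜ :- fₜ)) :=
                (con (pos 1) :- (α :+ s :* κ)) :* (fₛ :- fₜ) :+ (α :+ s :* κ) :* (gₛ :- gₜ) :+ (s :- t) :* (κ :* (gₜ :- fₜ)))
                refl α κ s t (F s) (F t) (G s) (G t)) ⟩
      abs ((1# - weight s) * (F s - F t) + weight s * (G s - G t)) + abs ((s - t) * (κ * (G t - F t)))
        ≤⟨ +-mono-≤ (mean-≤ (weight∈ s∈) (lipschitz-F s∈ t∈) (lipschitz-G s∈ t∈))
             (≤-trans (≤-reflexive drift≡) (*-monoʳ-≤ (abs-nonneg (s - t)) (|κ|*gap t∈))) ⟩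
      A * abs (s - t) + abs (s - t) * (A + A + A + abs (h 1# - h 0#))
        ≡⟨ solve 3 (λ A x d → A :* x :+ x :* (A :+ A :+ A :+ d) := (A :+ A :+ A :+ A :+ d) :* x) refl
             A (abs (s - t)) (abs (h 1# - h 0#)) ⟩
      (A + A + A + A + abs (h 1# - h 0#)) * abs (s - t) ∎
      where
      open ≤-Reasoning
      drift≡ : abs ((s - t) * (κ * (G t - F t))) ≡ abs (s - t) * (abs κ * (G t - F t))
      drift≡ = trans (abs-* (s - t) (κ * (G t - F t))) (cong (abs (s - t) *_)
        (trans (abs-* κ (G t - F t)) (cong (abs κ *_) (abs-of-nonneg (x≤y⇒0≤y-x (F≤G t t∈))))))

    -- The product rule. Besides the averaged remainders of F and G there is the error κ (s - t)
    -- times the change of the gap, of second order since the gap is Lipschitz with constant 2A.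
    blend-derivative : ∀ {t a b} → t ∈ [0,1] → DerivativeAt F t a → DerivativeAt G t b →
                       DerivativeAt h t ((1# - weight t) * a + weight t * b + κ * (G t - F t))
    blend-derivative {t} {a} {b} t∈ derivative-F derivative-G ε ε>0 =
      let ε′ , ε′>0 , ε′+ε′≡ε = halve ε>0
          δ₁ , δ₁>0 , near-F = derivative-F ε′ ε′>0
          δ₂ , δ₂>0 , near-G = derivative-G ε′ ε′>0
          δ₃ , δ₃>0 , 2Aδ₃<ε′ = pos-multiple-below (A + A) (+-nonneg A≥0 A≥0) ε′>0
          δ₄ , δ₄>0 , δ₄≤δ₁ , δ₄≤δ₂ = pos-min δ₁>0 δ₂>0
          δ , δ>0 , δ≤δ₃ , δ≤δ₄ = pos-min δ₃>0 δ₄>0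
      in δ , δ>0 , λ s s∈ s-t<δ →
        let x = abs (s - t)
            x≥0 = abs-nonneg (s - t)
            eF = F s - F t - (s - t) * a
            eG = G s - G t - (s - t) * b
            gap = G s - G t - (F s - F t)
            s-t<δ₄ = <-≤-trans s-t<δ δ≤δ₄
            gap≤ = abs-≤-via {gap} (G s - G t) (- (F s - F t)) refl
            gap≤2Ax = ≤-trans gap≤ (+-mono-≤ (lipschitz-G s∈ t∈) (subst (_≤ A * x) (sym (abs-neg (F s - F t))) (lipschitz-F s∈ t∈)))
            2Ax≤ε′ = ≤-trans (*-monoʳ-≤ (+-nonneg A≥0 A≥0) (≤-trans (<⇒≤ s-t<δ) δ≤δ₃)) (<⇒≤ 2Aδ₃<ε′)
        in begin
          abs (h s - h t - (s - t) * ((1# - weight t) * a + weight t * b + κ * (G t - F t)))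
            ≤⟨ abs-≤-via ((1# - weight t) * eF + weight t * eG) (κ * ((s - t) * gap))
                 (solve 10 (λ α κ s t fₛ fₜ gₛ gₜ a b →
                    fₛ :+ (α :+ s :* κ) :* (gₛ :- fₛ) :- (fₜ :+ (α :+ t :* κ) :* (gₜ :- fₜ)) :-
                    (s :- t) :* ((con (pos 1) :- (α :+ t :* κ)) :* a :+ (α :+ t :* κ) :* b :+ κ :* (gₜ :- fₜ)) :=
                    (con (pos 1) :- (α :+ t :* κ)) :* (fₛ :- fₜ :- (s :- t) :* a) :+ (α :+ t :* κ) :* (gₛ :- gₜ :- (s :- t) :* b) :+
                    κ :* ((s :- t) :* (gₛ :- gₜ :- (fₛ :- fₜ)))) refl α κ s t (F s) (F t) (G s) (G t) a b) ⟩
          abs ((1# - weight t) * eF + weight t * eG) + abs (κ * ((s - t) * gap))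
            ≤⟨ +-mono-≤ (mean-≤ (weight∈ t∈) (near-F s s∈ (<-≤-trans s-t<δ₄ δ₄≤δ₁)) (near-G s s∈ (<-≤-trans s-t<δ₄ δ₄≤δ₂)))
                 (≤-trans (≤-reflexive (trans (abs-* κ ((s - t) * gap)) (cong (abs κ *_) (abs-* (s - t) gap))))
                   (*-mono-≤ (abs-nonneg κ) (*-nonneg x≥0 (<⇒≤ ε′>0)) |κ|≤1
                     (*-monoʳ-≤ x≥0 (≤-trans gap≤2Ax
                       (subst (_≤ ε′) (solve 2 (λ A x → (A :+ A) :* x := A :* x :+ A :* x) refl A x) 2Ax≤ε′))))) ⟩
          ε′ * x + 1# * (x * ε′)
            ≡⟨ solve 2 (λ ε x → ε :* x :+ con (pos 1) :* (x :* ε) := (ε :+ ε) :* x) refl ε′ x ⟩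
          (ε′ + ε′) * x
            ≡⟨ cong (_* x) ε′+ε′≡ε ⟩
          ε * x ∎
      where open ≤-Reasoning

  blend-definable : ∀ {F G} α β → Definable (FunctionGraph F) → Definable (FunctionGraph G) →
                    Definable (FunctionGraph (blend F G α β))
  blend-definable {F} {G} α β definable-F definable-G = definable-resp
    (λ z → mk⇔
      (λ (a , b , ((t∈ , a≡) , (_ , b≡)) , v≡) → t∈ , trans v≡ (trans (term≡ a b (lookup z zero))
        (cong₂ (λ a b → a + (α + lookup z zero * (β - α)) * (b - a)) a≡ b≡)))
      (λ (t∈ , v≡) → F (lookup z zero) , G (lookup z zero) , ((t∈ , refl) , (t∈ , refl)) ,
        trans v≡ (sym (term≡ _ _ (lookup z zero)))))
    -- The variables are, in order, the value of G, the value of F, the time and the value of the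
    -- blend.
    (definable-∃ (definable-∃ (definable-∩
      (definable-∩
        (definable-preimage (var (suc (suc zero)) ∷ var (suc zero) ∷ []) (λ y → lookup y (suc (suc zero)) ∷ lookup y (suc zero) ∷ [])
          (λ _ → refl) definable-F)
        (definable-preimage (var (suc (suc zero)) ∷ var zero ∷ []) (λ y → lookup y (suc (suc zero)) ∷ lookup y zero ∷ [])
          (λ _ → refl) definable-G))
      (definable-≡ (var (suc (suc (suc zero))))
        (var (suc zero) +̇ ((par α +̇ (var (suc (suc zero)) *̇ par (β - α))) *̇ (var zero +̇ (par (- 1#) *̇ var (suc zero)))))))))
    where
    term≡ : ∀ a b t → a + (α + t * (β - α)) * (b + - 1# * a) ≡ a + (α + t * (β - α)) * (b - a)
    term≡ a b t = solve 5 (λ a b t α β → a :+ (α :+ t :* (β :- α)) :* (b :+ :- con (pos 1) :* a) :=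
      a :+ (α :+ t :* (β :- α)) :* (b :- a)) refl a b t α β

-- Lower reals and the measure of [0,1]

private
  module ℚ-Solver = Data.Rational.Solver.+-*-Solver

sumℚ : ∀ {n} → (Fin n → ℚ) → ℚ
sumℚ = Vector.foldr ℚ._+_ 0ℚ

partialSumℚ : (ℕ → ℚ) → ℕ → ℚ
partialSumℚ x zero    = 0ℚ
partialSumℚ x (suc n) = partialSumℚ x n ℚ.+ x n

partialSumℚ-suc : ∀ x n → partialSumℚ x (suc n) ≡ x 0 ℚ.+ partialSumℚ (x ∘ suc) n
partialSumℚ-suc x zero    = trans (ℚ.+-identityˡ (x 0)) (sym (ℚ.+-identityʳ (x 0)))
partialSumℚ-suc x (suc n) = trans (cong (ℚ._+ x (suc n)) (partialSumℚ-suc x n)) (ℚ.+-assoc (x 0) _ _)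

-- A simple function has finitely many sets, whereas σ-additivity speaks of sequences; the family is
-- padded with a default value.
extend : ∀ {a} {A : Set a} {n} → A → (Fin n → A) → ℕ → A
extend {n = zero}  d x k       = d
extend {n = suc n} d x zero    = x zero
extend {n = suc n} d x (suc k) = extend d (x ∘ suc) k

extend-cases : ∀ {a} {A : Set a} {n} (d : A) (x : Fin n → A) k →
               extend d x k ≡ d ⊎ (∃[ i ] toℕ i ≡ k × extend d x k ≡ x i)
extend-cases {n = zero}  d x k       = inj₁ refl
extend-cases {n = suc n} d x zero    = inj₂ (zero , refl , refl)
extend-cases {n = suc n} d x (suc k) with extend-cases d (x ∘ suc) k
... | inj₁ e           = inj₁ e
... | inj₂ (i , e , e′) = inj₂ (suc i , cong suc e , e′)

extend-toℕ : ∀ {a} {A : Set a} {n} (d : A) (x : Fin n → A) i → extend d x (toℕ i) ≡ x i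
extend-toℕ d x zero    = refl
extend-toℕ d x (suc i) = extend-toℕ d (x ∘ suc) i

sumℚ-partial : ∀ {n} (x : Fin n → ℚ) → sumℚ x ≡ partialSumℚ (extend 0ℚ x) n
sumℚ-partial {zero}  x = refl
sumℚ-partial {suc n} x = trans (cong (x zero ℚ.+_) (sumℚ-partial (x ∘ suc))) (sym (partialSumℚ-suc (extend 0ℚ x) n))

p-[p-q]≡q : ∀ p q → p ℚ.- (p ℚ.- q) ≡ q
p-[p-q]≡q = solve 2 (λ p q → p :- (p :- q) := q) refl
  where open ℚ-Solver

-- A rational p < s + t has to be split strictly: a is taken between p - t and s, then b between p -
-- a and t.
fromℚ-+ : ∀ s t → fromℚ (s ℚ.+ t) ≤ᴿ fromℚ s +ᴿ fromℚ t
fromℚ-+ s t {p} p<s+t =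
  let a , p-t<a , a<s = ℚ.<-dense (subst (p ℚ.- t ℚ.<_) (+-minus s t) (ℚ.+-monoˡ-< (ℚ.- t) p<s+t))
      b , p-a<b , b<t = ℚ.<-dense (subst₂ ℚ._<_ (minus-+ p t a) (+-minus t a)
        (ℚ.+-monoˡ-< (ℚ.- a) (ℚ.+-monoʳ-< t p-t<a)))
  in a , b , a<s , b<t , subst₂ ℚ._<_ (cancel p a) (ℚ.+-comm b a) (ℚ.+-monoˡ-< a p-a<b)
  where
  open ℚ-Solver
  +-minus : ∀ s t → s ℚ.+ t ℚ.- t ≡ s
  +-minus = solve 2 (λ s t → s :+ t :- t := s) refl
  minus-+ : ∀ p t a → t ℚ.+ (p ℚ.- t) ℚ.- a ≡ p ℚ.- a
  minus-+ = solve 3 (λ p t a → t :+ (p :- t) :- a := p :- a) refl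
  cancel : ∀ p a → p ℚ.- a ℚ.+ a ≡ p
  cancel = solve 2 (λ p a → p :- a :+ a := p) refl

partialSum-≥ : ∀ {x : ℕ → ℚ} {X : ℕ → ℝ̄ 0ℓ} → (∀ k → fromℚ (x k) ≤ᴿ X k) →
               ∀ n → fromℚ (partialSumℚ x n) ≤ᴿ partialSum X n
partialSum-≥ x≤X zero p< = p<
partialSum-≥ {x} x≤X (suc n) p< =
  let a , b , a< , b< , p<a+b = fromℚ-+ (partialSumℚ x n) (x n) p< in
  a , b , partialSum-≥ x≤X n a< , x≤X n b< , p<a+b

partialSum-fromℚ-≤ : ∀ x n → partialSum (fromℚ ∘ x) n ≤ᴿ fromℚ (partialSumℚ x n)
partialSum-fromℚ-≤ x zero    p< = p<
partialSum-fromℚ-≤ x (suc n) (a , b , a< , b< , p<a+b) =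
  ℚ.<-trans p<a+b (ℚ.+-mono-< (partialSum-fromℚ-≤ x n a<) b<)

≤-from-fromℚ : ∀ {p q} → fromℚ p ≤ᴿ fromℚ q → p ℚ.≤ q
≤-from-fromℚ p≤q = ℚ.≮⇒≥ λ q<p → let r , q<r , r<p = ℚ.<-dense q<p in ℚ.<-asym q<r (p≤q r<p)

-- Trades the lower sets for rationals, so that a simple function is integrated by arithmetic in ℚ.
weighted-sum-below : ∀ {n} (c : Fin n → ℚ) (m : Fin n → ℝ̄ 0ℓ) C → 0ℚ ℚ.≤ C → (∀ i → 0ℚ ℚ.< c i) →
  (∀ i → fromℚ 0ℚ ≤ᴿ m i) → (∀ i {a} → 0ℚ ℚ.< a → a ∈ below (m i) → c i ℚ.≤ C) →
  ∀ {p} → p ∈ below (Σᶠ λ i → scale (c i) (m i)) →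
  ∃[ b ] (∀ i → fromℚ (b i) ≤ᴿ m i) × p ℚ.≤ C ℚ.* sumℚ b
weighted-sum-below {zero} c m C C≥0 c>0 m≥0 c≤C {p} p<0 =
  (λ ()) , (λ ()) , subst (p ℚ.≤_) (sym (ℚ.*-zeroʳ C)) (ℚ.<⇒≤ p<0)
weighted-sum-below {suc n} c m C C≥0 c>0 m≥0 c≤C {p} (x , y , (a , a<m , x<ca) , y< , p<x+y)
  with weighted-sum-below (c ∘ suc) (m ∘ suc) C C≥0 (c>0 ∘ suc) (m≥0 ∘ suc) (λ i → c≤C (suc i)) y<
     | ℚ.≤-total a 0ℚ
-- A nonpositive a contributes at most 0, and 0 is an admissible lower bound for the measure.
... | b , b≤m , y≤ | inj₁ a≤0 =
    (0ℚ Vector.∷ b) , (λ { zero → m≥0 zero ; (suc i) → b≤m i })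
  , subst (p ℚ.≤_) (cong (C ℚ.*_) (sym (ℚ.+-identityˡ (sumℚ b))))
      (ℚ.≤-trans (ℚ.<⇒≤ p<x+y) (subst (x ℚ.+ y ℚ.≤_) (ℚ.+-identityˡ _) (ℚ.+-mono-≤ x≤0 y≤)))
  where
  x≤0 : x ℚ.≤ 0ℚ
  x≤0 = ℚ.≤-trans (ℚ.<⇒≤ x<ca) (subst (c zero ℚ.* a ℚ.≤_) (ℚ.*-zeroʳ (c zero))
    (ℚ.*-monoˡ-≤-nonNeg (c zero) {{ℚ.nonNegative (ℚ.<⇒≤ (c>0 zero))}} a≤0))
... | b , b≤m , y≤ | inj₂ a≥0 =
    (a Vector.∷ b) , (λ { zero → λ q<a → closed (m zero) q<a a<m ; (suc i) → b≤m i })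
  , subst (p ℚ.≤_) (sym (ℚ.*-distribˡ-+ C a (sumℚ b)))
      (ℚ.≤-trans (ℚ.<⇒≤ p<x+y) (ℚ.+-mono-≤ (ℚ.≤-trans (ℚ.<⇒≤ x<ca) ca≤Ca) y≤))
  where
  -- The set below m 0 has no greatest element, so some positive rational lies in it.
  c₀≤C : c zero ℚ.≤ C
  c₀≤C = let a′ , a<a′ , a′<m = rounded (m zero) a<m in c≤C zero (ℚ.≤-<-trans a≥0 a<a′) a′<m
  ca≤Ca : c zero ℚ.* a ℚ.≤ C ℚ.* a
  ca≤Ca = ℚ.*-monoʳ-≤-nonNeg a {{ℚ.nonNegative a≥0}} c₀≤C

-- Written in lowest terms by hand, so that numerator and denominator compute in comparisons with
-- elements of the field.
integer : ℤ → ℚ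
integer i = ℚ.mkℚ i 0 (coprime-sym (1-coprimeTo ℤ.∣ i ∣))

integer-mono-< : ∀ {i j} → i ℤ.< j → integer i ℚ.< integer j
integer-mono-< {i} {j} i<j = ℚ.*<* (subst₂ ℤ._<_ (sym (ℤ.*-identityʳ i)) (sym (ℤ.*-identityʳ j)) i<j)

-- Standard parts of finite elements

module StandardPart (F : OrderedField) where
  open OrderedField F
  open OrderedFieldProperties F

  fromℤ-mono-≤ : ∀ {i j} → i ℤ.≤ j → fromℤ i ≤ fromℤ j
  fromℤ-mono-≤ {i} {j} i≤j = linear₁ (nonneg (ℤ.i≤j⇒0≤j-i i≤j))
    (trans (sym (trans (fromℤ-+ j (ℤ.- i)) (cong (fromℤ j +_) (fromℤ-neg i))))
      (solve 1 (λ d → d := d :- con (pos 0)) refl (fromℤ (j ℤ.- i))))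
    where
    nonneg : ∀ {k} → ℤ.0ℤ ℤ.≤ k → 0# ≤ fromℤ k
    nonneg {pos n} _ = fromℕ-nonneg n

  ℚ≤ᴷ-mono : ∀ {p q a b} → p ℚ.≤ q → a ≤ b → q ℚ≤ᴷ a → p ℚ≤ᴷ b
  ℚ≤ᴷ-mono {p@(ℚ.mkℚ _ d _)} {q@(ℚ.mkℚ _ e _)} {a} {b} (ℚ.*≤* p≤q) a≤b q≤a = *-cancelʳ-≤ {z = E} (fromℕ-suc-pos e) (begin
    P * E         ≡⟨ fromℤ-* (↥ p) (↧ q) ⟨
    fromℤ (↥ p ℤ.* ↧ q) ≤⟨ fromℤ-mono-≤ p≤q ⟩
    fromℤ (↥ q ℤ.* ↧ p) ≡⟨ fromℤ-* (↥ q) (↧ p) ⟩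
    Q * D         ≤⟨ *-monoˡ-≤ (fromℕ-nonneg (suc d)) q≤a ⟩
    a * E * D     ≡⟨ solve 3 (λ a e d → a :* e :* d := a :* (d :* e)) refl a E D ⟩
    a * (D * E)   ≤⟨ *-monoˡ-≤ (*-nonneg (fromℕ-nonneg (suc d)) (fromℕ-nonneg (suc e))) a≤b ⟩
    b * (D * E)   ≡⟨ *-assoc b D E ⟨
    b * D * E     ∎)
    where
    open ≤-Reasoning
    P Q D E : Carrier
    P = fromℤ (↥ p)
    Q = fromℤ (↥ q)
    D = fromℕ (↧ₙ p)
    E = fromℕ (↧ₙ q)

  fromℤ-mono-< : ∀ {i j} → i ℤ.< j → fromℤ i < fromℤ j
  fromℤ-mono-< {i} {j} i<j = <-≤-trans
    (subst (fromℤ i <_) (trans (cong (fromℤ i +_) (sym (+-identityʳ 1#))) (trans (+-comm _ _) (sym (fromℤ-+ ℤ.1ℤ i)))) (x<x+pos 1>0))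
    (fromℤ-mono-≤ (ℤ.i<j⇒suc[i]≤j i<j))

  ℚ≤ᴷ⇒≰ᴷℚ : ∀ {p q a} → p ℚ.< q → q ℚ≤ᴷ a → ¬ a ≤ᴷℚ p
  ℚ≤ᴷ⇒≰ᴷℚ {p@(ℚ.mkℚ _ d _)} {q@(ℚ.mkℚ _ e _)} {a} (ℚ.*<* p<q) q≤a a≤p = <-irrefl refl (begin-strict
    P * E               ≡⟨ fromℤ-* (↥ p) (↧ q) ⟨
    fromℤ (↥ p ℤ.* ↧ q) <⟨ fromℤ-mono-< p<q ⟩
    fromℤ (↥ q ℤ.* ↧ p) ≡⟨ fromℤ-* (↥ q) (↧ p) ⟩
    Q * D               ≤⟨ *-monoˡ-≤ (fromℕ-nonneg (suc d)) q≤a ⟩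
    a * E * D           ≡⟨ solve 3 (λ a e d → a :* e :* d := a :* d :* e) refl a E D ⟩
    a * D * E           ≤⟨ *-monoˡ-≤ (fromℕ-nonneg (suc e)) a≤p ⟩
    P * E               ∎)
    where
    open ≤-Reasoning
    P Q D E : Carrier
    P = fromℤ (↥ p)
    Q = fromℤ (↥ q)
    D = fromℕ (↧ₙ p)
    E = fromℕ (↧ₙ q)

  ℚ≤ᴷ-or-≤ᴷℚ : ∀ q a → q ℚ≤ᴷ a ⊎ a ≤ᴷℚ q
  ℚ≤ᴷ-or-≤ᴷℚ q a = ≤-total (fromℤ (↥ q)) (a * fromℕ (↧ₙ q))

  integer-≤ᴷ : ∀ {i a} → fromℤ i ≤ a → integer i ℚ≤ᴷ a
  integer-≤ᴷ {i} {a} = subst (fromℤ i ≤_) (sym (trans (cong (a *_) (+-identityʳ 1#)) (*-identityʳ a)))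

  integer-≤ᴷ⁻¹ : ∀ {i a} → integer i ℚ≤ᴷ a → fromℤ i ≤ a
  integer-≤ᴷ⁻¹ {i} {a} = subst (fromℤ i ≤_) (trans (cong (a *_) (+-identityʳ 1#)) (*-identityʳ a))

  -- The intermediate rational q makes the cut rounded, even if a is infinitely close to a rational.
  below-st : Carrier → ℝ̄ 0ℓ
  below-st a = record
    { below   = λ p → ∃[ q ] p ℚ.< q × q ℚ≤ᴷ a
    ; closed  = λ { p<q (r , q<r , r≤a) → r , ℚ.<-trans p<q q<r , r≤a }
    ; rounded = λ { (r , p<r , r≤a) → let q , p<q , q<r = ℚ.<-dense p<r in q , p<q , r , q<r , r≤a }
    }

  st : ∀ {a} → Finite a → ℝ
  st {a} (n , |a|≤n) = record
    { value     = below-st a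
    -- The cut is strict, so -n itself may fail to belong to it, whereas -(n + 1) does.
    ; inhabited = integer (ℤ.- pos (suc n)) , integer (ℤ.- pos n)
                , integer-mono-< (ℤ.neg-mono-< (ℤ.+<+ (ℕ.n<1+n n)))
                , integer-≤ᴷ {ℤ.- pos n} -n≤a
    ; bounded   = integer (pos (suc n)) , λ { (q , n+1<q , q≤a) →
        <⇒≱ (<-≤-trans (x<x+pos 1>0) (≤-reflexive (+-comm (fromℕ n) 1#)))
          (≤-trans (integer-≤ᴷ⁻¹ {pos (suc n)} (ℚ≤ᴷ-mono (ℚ.<⇒≤ n+1<q) ≤-refl q≤a)) (≤-trans (x≤abs a) |a|≤n)) }
    }
    where
    -n≤a : fromℤ (ℤ.- pos n) ≤ a
    -n≤a = subst (_≤ a) (sym (fromℤ-neg (pos n))) (linear₁ (≤-trans (-x≤abs a) |a|≤n)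
      (solve 2 (λ a n → a :- :- n := n :- :- a) refl a (fromℕ n)))

  st-isSt : ∀ {a} (finite : Finite a) → IsSt a (st finite)
  st-isSt {a} finite = (λ q (r , q<r , r≤a) → ℚ≤ᴷ-mono (ℚ.<⇒≤ q<r) ≤-refl r≤a)
    , λ q (p , p<q , p≮r) → [ (λ q≤a → contradiction (q , p<q , q≤a) p≮r) , id ]′ (ℚ≤ᴷ-or-≤ᴷℚ q a)

  st-mono : ∀ {a b r} → IsSt a r → a ≤ b → (finite : Finite b) → value r ≤ᴿ value (st finite)
  st-mono {r = r} (lower , _) a≤b finite p<r =
    let q , p<q , q<r = rounded (value r) p<r in q , p<q , ℚ≤ᴷ-mono {q} {q} ℚ.≤-refl a≤b (lower q q<r)

  st-nonneg : ∀ {b} → 0# ≤ b → (finite : Finite b) → fromℚ 0ℚ ≤ᴿ value (st finite)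
  st-nonneg b≥0 finite p<0 = 0ℚ , p<0 , integer-≤ᴷ {pos 0} b≥0

-- C is the maximum of 0 and the c i with Q i. Restricting to Q leaves out the coefficients of empty
-- sets, which no value of the integrand bounds.
common-bound : (∀ {ℓ} → ExcludedMiddle ℓ) → ∀ {n} (c : Fin n → ℚ) (Q : Fin n → Set) (r : ℝ̄ 0ℓ) →
               fromℚ 0ℚ ≤ᴿ r → (∀ i → Q i → fromℚ (c i) ≤ᴿ r) →
               ∃[ C ] 0ℚ ℚ.≤ C × fromℚ C ≤ᴿ r × (∀ i → Q i → c i ℚ.≤ C)
common-bound em {zero}  c Q r r≥0 c≤r = 0ℚ , ℚ.≤-refl , (λ p< → r≥0 p<) , λ ()
common-bound em {suc n} c Q r r≥0 c≤r
  with common-bound em (c ∘ suc) (Q ∘ suc) r (λ p< → r≥0 p<) (λ i q p< → c≤r (suc i) q p<) | em {P = Q zero}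
... | C , C≥0 , C≤r , c≤C | no ¬Q₀ =
  C , C≥0 , (λ p< → C≤r p<) , λ { zero Q₀ → contradiction Q₀ ¬Q₀ ; (suc i) Qᵢ → c≤C i Qᵢ }
... | C , C≥0 , C≤r , c≤C | yes Q₀ with ℚ.≤-total (c zero) C
...   | inj₁ c₀≤C = C , C≥0 , (λ p< → C≤r p<) , λ { zero _ → c₀≤C ; (suc i) Qᵢ → c≤C i Qᵢ }
...   | inj₂ C≤c₀ = c zero , ℚ.≤-trans C≥0 C≤c₀ , (λ p< → c≤r zero Q₀ p<)
                  , λ { zero _ → ℚ.≤-refl ; (suc i) Qᵢ → ℚ.≤-trans (c≤C i Qᵢ) C≤c₀ }

-- Length bounds from the measure of the unit interval

module Measure (em : ∀ {ℓ} → ExcludedMiddle ℓ) {L : Language} (𝓚 : Structure L)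
               (μ : Geometry.BerarducciOteroMeasure 𝓚) where
  open Structure 𝓚
  open Syntax L
  open OrderedFieldProperties orderedField
  open StandardPart orderedField
  open Definability 𝓚
  open Geometry 𝓚
  open BerarducciOteroMeasure μ

  definable-∅ : Definable₁ ∅
  definable-∅ = definable₁ {∅} (definable-resp (λ z → mk⇔ (<-irrefl refl) (λ ())) (definable-< (par 0#) (par 0#)))

  definable-[0,1] : Definable₁ [0,1]
  definable-[0,1] = definable₁ {[0,1]} (definable-∩ (definable-≤ (par 0#) (var zero)) (definable-≤ (var zero) (par 1#)))

  σRing-∅ : σRing ∅
  σRing-∅ = generator definable-∅ (0 , λ _ _ ())

  σRing-[0,1] : σRing [0,1]
  σRing-[0,1] = generator definable-[0,1] (1 , λ x y (x≥0 , x≤1) (y≥0 , y≤1) →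
    subst (abs (x - y) ≤_) (sym (+-identityʳ 1#)) (abs-lub
      (linear₂ y≥0 x≤1 (solve 2 (λ x y → con (pos 1) :- (x :- y) := (y :- con (pos 0)) :+ (con (pos 1) :- x)) refl x y))
      (linear₂ x≥0 y≤1 (solve 2 (λ x y → con (pos 1) :- :- (x :- y) := (x :- con (pos 0)) :+ (con (pos 1) :- y)) refl x y))))

  [0,1]⊆Finite : [0,1] ⊆ Finite
  [0,1]⊆Finite (x≥0 , x≤1) = finite-≤ x≥0 x≤1 finite-1

  lebesgue-nonneg : ∀ E → fromℚ 0ℚ ≤ᴿ Lebesgue E
  lebesgue-nonneg E p<0 = let q , p<q , q<0 = ℚ.<-dense p<0 in q , p<q , λ C → 0 , q<0

  lebesgue-≤-cover : ∀ {E} (C : IntervalCover E) → Lebesgue E ≤ᴿ IntervalCover.totalLength C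
  lebesgue-≤-cover C (q , p<q , q<) = closed (IntervalCover.totalLength C) p<q (q< C)

  -- Gives the end points, and likewise the lengths, of a cover by a single interval followed by
  -- degenerate intervals at 0.
  lengths : ℚ → ℕ → ℚ
  lengths x zero    = x
  lengths x (suc _) = 0ℚ

  partialSum-lengths : ∀ {x} → 0ℚ ℚ.≤ x → ∀ n → partialSumℚ (lengths x) n ℚ.≤ x
  partialSum-lengths {x} x≥0 zero          = x≥0
  partialSum-lengths {x} x≥0 (suc zero)    = ℚ.≤-reflexive (ℚ.+-identityˡ x)
  partialSum-lengths {x} x≥0 (suc (suc n)) =
    ℚ.≤-trans (ℚ.≤-reflexive (ℚ.+-identityʳ _)) (partialSum-lengths x≥0 (suc n))

  lebesgue-interval : ∀ {E : Pred ℝ 0ℓ} {l u} → l ℚ.≤ u → (∀ {r} → r ∈ E → l ℚ< r × r <ℚ u) →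
                      Lebesgue E ≤ᴿ fromℚ (u ℚ.- l)
  lebesgue-interval {E} {l} {u} l≤u inside p< =
    let n , p<n = lebesgue-≤-cover cover p<
    in ℚ.<-≤-trans (partialSum-fromℚ-≤ _ n p<n) (subst (ℚ._≤ u ℚ.- l) (sym (partialSumℚ-cong same n)) (partialSum-lengths u-l≥0 n))
    where
    u-l≥0 : 0ℚ ℚ.≤ u ℚ.- l
    u-l≥0 = subst (ℚ._≤ u ℚ.- l) (ℚ.+-inverseʳ l) (ℚ.+-monoˡ-≤ (ℚ.- l) l≤u)
    cover : IntervalCover E
    cover = record
      { left    = lengths l
      ; right   = lengths u
      ; ordered = λ { zero → l≤u ; (suc _) → ℚ.≤-refl }
      ; covers  = λ r∈E → 0 , inside r∈E
      }
    same : ∀ k → lengths u k ℚ.- lengths l k ≡ lengths (u ℚ.- l) k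
    same zero    = refl
    same (suc _) = refl
    partialSumℚ-cong : ∀ {x y : ℕ → ℚ} → (∀ k → x k ≡ y k) → ∀ n → partialSumℚ x n ≡ partialSumℚ y n
    partialSumℚ-cong e zero    = refl
    partialSumℚ-cong e (suc n) = cong₂ ℚ._+_ (partialSumℚ-cong e n) (e n)

  st-[0,1]-above : ∀ {l r} → l ℚ.< 0ℚ → r ∈ stImage [0,1] → l ℚ< r
  st-[0,1]-above {l} {r} l<0 (a , (a≥0 , _) , _ , upper) with em {P = l ℚ< r}
  ... | yes l<r = l<r
  ... | no  l≮r = let l′ , l<l′ , l′<0 = ℚ.<-dense l<0 in
    contradiction (upper l′ (l , l<l′ , l≮r)) (ℚ≤ᴷ⇒≰ᴷℚ l′<0 (integer-≤ᴷ {pos 0} a≥0))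

  st-[0,1]-below : ∀ {u r} → 1ℚ ℚ.< u → r ∈ stImage [0,1] → r <ℚ u
  st-[0,1]-below {u} {r} 1<u (a , (_ , a≤1) , lower , _) = let u′ , 1<u′ , u′<u = ℚ.<-dense 1<u in
    u′ , u′<u , λ u′<r → ℚ≤ᴷ⇒≰ᴷℚ 1<u′ (lower u′ u′<r)
      (subst (a * fromℕ 1 ≤_) (*-identityˡ (fromℕ 1)) (*-monoˡ-≤ (fromℕ-nonneg 1) a≤1))

  lebesgue-[0,1]≤1 : Lebesgue (stImage [0,1]) ≤ᴿ fromℚ 1ℚ
  lebesgue-[0,1]≤1 {p} p< with p ℚ.<? 1ℚ
  ... | yes p<1 = p<1
  ... | no  p≮1 =
    -- The interval from u - q < 0 to u > 1 contains all standard parts of [0,1] and has length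
    -- exactly q, although q lies strictly below the measure.
    let q , p<q , q< = rounded (Lebesgue (stImage [0,1])) p<
        u , 1<u , u<q = ℚ.<-dense (ℚ.≤-<-trans (ℚ.≮⇒≥ p≮1) p<q)
        l = u ℚ.- q
        l<0 = subst (l ℚ.<_) (ℚ.+-inverseʳ q) (ℚ.+-monoˡ-< (ℚ.- q) u<q)
        0<u = ℚ.<-trans (ℚ.positive⁻¹ 1ℚ) 1<u
    in contradiction
      (lebesgue-interval {stImage [0,1]} {l} {u} (ℚ.<⇒≤ (ℚ.<-trans l<0 0<u))
        (λ {r} r∈ → st-[0,1]-above {l} {r} l<0 r∈ , st-[0,1]-below {u} {r} 1<u r∈) q<)
      (ℚ.<-irrefl (sym (p-[p-q]≡q u q)))

  𝓛¹∅≈0 : 𝓛¹ ∅ ≈ᴿ fromℚ 0ℚ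
  𝓛¹∅≈0 = (λ p< → lebesgue-interval {stImage ∅} {0ℚ} {0ℚ} ℚ.≤-refl (λ { (_ , () , _) }) (proj₁ 𝓛¹∅≈Leb p<))
        , (λ p< → proj₂ 𝓛¹∅≈Leb (lebesgue-nonneg (stImage ∅) p<))
    where
    𝓛¹∅≈Leb : 𝓛¹ ∅ ≈ᴿ Lebesgue (stImage ∅)
    𝓛¹∅≈Leb = lebesgue definable-∅ λ ()

  ≐-measurable : ∀ {A B} → σRing A → B ≐ A → Measurable B
  ≐-measurable {A} A∈ (B⊆A , A⊆B) = record
    { core = A ; null = ∅ ; core∈ = A∈ ; null∈ = σRing-∅ ; null≈0 = 𝓛¹∅≈0
    ; lower = A⊆B ; upper = λ x∈B → inj₁ (B⊆A x∈B) }

  σRing-measurable : ∀ {A} → σRing A → Measurable A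
  σRing-measurable A∈ = ≐-measurable A∈ (id , id)

  -- As a function of predicates, 𝓛¹ is not extensional by its type. Taking A as a core of B, with
  -- empty null set, makes it so.
  𝓛¹-resp-≐ : ∀ {A B} → σRing A → B ≐ A → 𝓛¹ B ≈ᴿ 𝓛¹ A
  𝓛¹-resp-≐ A∈ B≐A = completed (≐-measurable A∈ B≐A)

  𝓛¹[0,1]≤1 : 𝓛¹ [0,1] ≤ᴿ fromℚ 1ℚ
  𝓛¹[0,1]≤1 p< = lebesgue-[0,1]≤1 (proj₁ (lebesgue definable-[0,1] [0,1]⊆Finite) p<)

  -- σ-additivity is applied to the cores of the E i and the rest of [0,1], which lie in the
  -- σ-ring itself; the E i are only known to lie in its completion.
  module _ {n} (E : Fin n → Pred K 0ℓ) (measurable : ∀ i → Measurable (E i))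
           (disjoint : ∀ {i j} → i ≢ j → E i ⊥ E j) (inside : ∀ i → E i ⊆ [0,1]) where
    private
      module C i = InCompletion (measurable i)

      cores : ℕ → Pred K 0ℓ
      cores = extend ∅ C.core

      cores-∈ : ∀ k {x} → x ∈ cores k → ∃[ i ] toℕ i ≡ k × x ∈ E i
      cores-∈ k {x} x∈ with extend-cases ∅ C.core k
      ... | inj₁ e            = contradiction (subst (x ∈_) e x∈) λ ()
      ... | inj₂ (i , i≡k , e) = i , i≡k , C.lower i (subst (x ∈_) e x∈)

      cores-σRing : ∀ k → σRing (cores k)
      cores-σRing k with extend-cases ∅ C.core k
      ... | inj₁ e           = subst σRing (sym e) σRing-∅
      ... | inj₂ (i , _ , e) = subst σRing (sym e) (C.core∈ i)

      parts : ℕ → Pred K 0ℓ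
      parts zero    = [0,1] ∖ ⋃ ℕ cores
      parts (suc k) = cores k

      parts-σRing : ∀ k → σRing (parts k)
      parts-σRing zero    = difference σRing-[0,1] (union cores-σRing)
      parts-σRing (suc k) = cores-σRing k

      parts-disjoint : ∀ {k l} → k ≢ l → parts k ⊥ parts l
      parts-disjoint {zero}  {zero}  k≢l _ = k≢l refl
      parts-disjoint {zero}  {suc l} k≢l ((_ , x∉) , x∈) = x∉ (l , x∈)
      parts-disjoint {suc k} {zero}  k≢l (x∈ , _ , x∉) = x∉ (k , x∈)
      parts-disjoint {suc k} {suc l} k≢l (x∈k , x∈l) =
        let i , i≡k , x∈i = cores-∈ k x∈k
            j , j≡l , x∈j = cores-∈ l x∈l
        in disjoint {i} {j} (λ i≡j → k≢l (cong suc (trans (sym i≡k) (trans (cong toℕ i≡j) j≡l)))) (x∈i , x∈j)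

      ⋃parts≐[0,1] : ⋃ ℕ parts ≐ [0,1]
      ⋃parts≐[0,1] = (λ { (zero , x∈ , _) → x∈
                        ; (suc k , x∈) → let i , _ , x∈i = cores-∈ k x∈ in inside i x∈i })
                   , covers
        where
        covers : [0,1] ⊆ ⋃ ℕ parts
        covers {x} x∈ with em {P = x ∈ ⋃ ℕ cores}
        ... | yes (k , x∈k) = suc k , x∈k
        ... | no  x∉        = zero , x∈ , x∉

    measures-sum-≤1 : ∀ (b : Fin n → ℚ) → (∀ i → fromℚ (b i) ≤ᴿ 𝓛¹ (E i)) → sumℚ b ℚ.≤ 1ℚ
    measures-sum-≤1 b b≤ = ≤-from-fromℚ λ {p} p< → 𝓛¹[0,1]≤1
      (proj₁ (𝓛¹-resp-≐ σRing-[0,1] ⋃parts≐[0,1])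
        (proj₂ (σ-additive parts (λ k → σRing-measurable (parts-σRing k)) parts-disjoint)
          -- Part 0 is the rest of [0,1], bounded below by 0; the n cores follow it, hence n + 1
          -- terms.
          (suc n , partialSum-≥ lower-bound (suc n) (subst (p ℚ.<_) sum≡ p<))))
      where
      bounds : ℕ → ℚ
      bounds zero    = 0ℚ
      bounds (suc k) = extend 0ℚ b k
      sum≡ : sumℚ b ≡ partialSumℚ bounds (suc n)
      sum≡ = trans (sumℚ-partial b) (trans (sym (ℚ.+-identityˡ _)) (sym (partialSumℚ-suc bounds n)))
      extend-bound : ∀ {m} (b : Fin m → ℚ) (C : Fin m → Pred K 0ℓ) → (∀ i → fromℚ (b i) ≤ᴿ 𝓛¹ (C i)) →
                     ∀ k → fromℚ (extend 0ℚ b k) ≤ᴿ 𝓛¹ (extend ∅ C k)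
      extend-bound {zero}  b C b≤ k       = λ p< → proj₂ 𝓛¹∅≈0 p<
      extend-bound {suc m} b C b≤ zero    = λ p< → b≤ zero p<
      extend-bound {suc m} b C b≤ (suc k) = extend-bound (b ∘ suc) (C ∘ suc) (b≤ ∘ suc) k
      lower-bound : ∀ k → fromℚ (bounds k) ≤ᴿ 𝓛¹ (parts k)
      lower-bound zero    = nonnegative (σRing-measurable (parts-σRing zero))
      lower-bound (suc k) = extend-bound b C.core (λ i p< → proj₁ (completed (measurable i)) (b≤ i p<)) k

  -- A point of E i bounds its coefficient by the standard part of a speed, hence by st Λ, and a set
  -- of positive measure has a point. As the measures of the disjoint sets add up to at most 1, the
  -- integral of any simple function below the speed is at most st Λ.
  length-≤ : ∀ {n} {γ : K → Vec K n} {Λ} → 0# ≤ Λ → (∀ t s → Speed μ γ t s → s ≤ Λ) →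
             (finite : Finite Λ) → length μ γ ≤ᴿ value (st finite)
  length-≤ {γ = γ} {Λ} Λ≥0 speed≤Λ finite {p} (S , p<) =
    let C , C≥0 , C≤Λ , c≤C = common-bound em c Nonempty (value (st finite)) (st-nonneg Λ≥0 finite) coefficient≤Λ
        q , p<q , q< = rounded integral p<
        b , b≤ , q≤ = weighted-sum-below c (λ i → 𝓛¹ (E i)) C C≥0 positive
          (λ i → nonnegative (measurable i)) (λ i a>0 a< → c≤C i (nonempty i a>0 a<)) q<
        Cb≤C = subst (C ℚ.* sumℚ b ℚ.≤_) (ℚ.*-identityʳ C)
          (ℚ.*-monoˡ-≤-nonNeg C {{ℚ.nonNegative C≥0}} (measures-sum-≤1 E measurable disjoint inside b b≤))
    in C≤Λ (ℚ.<-≤-trans p<q (ℚ.≤-trans q≤ Cb≤C))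
    where
    open SimpleBelow S
    Nonempty : Fin size → Set
    Nonempty i = ∃[ t ] t ∈ E i
    coefficient≤Λ : ∀ i → Nonempty i → fromℚ (c i) ≤ᴿ value (st finite)
    coefficient≤Λ i (t , t∈) q< =
      let r , (s , speed , isSt) , c≤r = below-F i t∈ in st-mono {r = r} isSt (speed≤Λ t s speed) finite (c≤r q<)
    nonempty : ∀ i {a} → 0ℚ ℚ.< a → a ∈ below (𝓛¹ (E i)) → Nonempty i
    nonempty i {a} a>0 a< with em {P = Nonempty i}
    ... | yes t∈ = t∈
    ... | no  ∄t = contradiction
      (proj₁ 𝓛¹∅≈0 (proj₁ (𝓛¹-resp-≐ σRing-∅ ((λ {t} t∈ → contradiction (t , t∈) ∄t) , λ ())) a<)) (ℚ.<-asym a>0)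

-- Cells

module Quasiconvexity (em : ∀ {ℓ} → ExcludedMiddle ℓ) {L : Language} (𝓚 : Structure L)
                      (ominimal : Structure.OMinimal 𝓚) where
  open Structure 𝓚
  open Syntax L
  open OrderedFieldProperties orderedField
  open Definability 𝓚
  open UnitInterval em 𝓚 ominimal
  open EuclideanNorm em 𝓚 ominimal
  open SmoothArcs em 𝓚 ominimal
  open Geometry 𝓚

  -- The arc property with length replaced by a Lipschitz constant. Free of measures and standard
  -- parts, it lets the induction on cells take place entirely in K.
  Quasiconvex : ∀ {n} → Pred (Vec K n) 0ℓ → Set
  Quasiconvex A = ∃[ c ] 0# < c × Finite c × (∀ x y → x ∈ A → y ∈ A →
    ∃[ γ ] SmoothArc γ (c * norm (x -ᵛ y)) × (∀ t → t ∈ [0,1] → γ t ∈ A) × γ 0# ≡ x × γ 1# ≡ y)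

  arc-weaken : ∀ {n} {γ : K → Vec K n} {Λ Λ′} → Λ ≤ Λ′ → SmoothArc γ Λ → SmoothArc γ Λ′
  arc-weaken Λ≤Λ′ arc = record
    { definable      = SmoothArc.definable arc
    ; lipschitz      = λ {s} {t} s∈ t∈ → ≤-trans (SmoothArc.lipschitz arc s∈ t∈) (*-monoˡ-≤ (abs-nonneg (s - t)) Λ≤Λ′)
    ; differentiable = SmoothArc.differentiable arc
    }

  segment : K → K → K → Vec K 1
  segment a b t = [ a + t * (b - a) ]

  segment-arc : ∀ a b → SmoothArc (segment a b) (abs (a - b))
  segment-arc a b = record
    { definable      = definable
    ; lipschitz      = λ {s} {t} _ _ → ≤-reflexive (lipschitz s t)
    -- The remainder of an affine map vanishes identically, so any δ works.
    ; differentiable = λ t t∈ → [ b - a ] , t∈ , λ ε ε>0 → 1# , 1>0 , λ s _ _ →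
        0# , (≤-refl , trans (zeroˡ 0#) (sym (remainder s t))) , *-nonneg (<⇒≤ ε>0) (abs-nonneg (s - t))
    }
    where
    definable : Definable (CurveGraph [0,1] (segment a b))
    definable = definable-resp
      (λ { (t ∷ x ∷ []) → mk⇔ (λ (t∈ , e) → t∈ , cong [_] e) (λ (t∈ , e) → t∈ , cong head e) })
      (definable-∩ (definable-∩ (definable-≤ (par 0#) (var zero)) (definable-≤ (var zero) (par 1#)))
        (definable-≡ (var (suc zero)) (par a +̇ (var zero *̇ par (b - a)))))
    lipschitz : ∀ s t → norm (segment a b s -ᵛ segment a b t) ≡ abs (a - b) * abs (s - t)
    lipschitz s t = begin
      norm [ a + s * (b - a) - (a + t * (b - a)) ]  ≡⟨ norm-singleton _ ⟩
      abs (a + s * (b - a) - (a + t * (b - a)))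
        ≡⟨ cong abs (solve 4 (λ a b s t → a :+ s :* (b :- a) :- (a :+ t :* (b :- a)) := (b :- a) :* (s :- t)) refl a b s t) ⟩
      abs ((b - a) * (s - t))                       ≡⟨ abs-* (b - a) (s - t) ⟩
      abs (b - a) * abs (s - t)                     ≡⟨ cong (_* abs (s - t)) (abs-minus-comm b a) ⟩
      abs (a - b) * abs (s - t)                     ∎
      where open ≡-Reasoning
    remainder : ∀ s t → let w = segment a b s -ᵛ segment a b t -ᵛ (s - t) ·ᵛ [ b - a ] in w ∙ w ≡ 0#
    remainder s t = solve 4 (λ a b s t →
      let w = a :+ s :* (b :- a) :- (a :+ t :* (b :- a)) :- (s :- t) :* (b :- a) in w :* w :+ con (pos 0) := con (pos 0))
      refl a b s t

  segment-quasiconvex : ∀ {C : Pred (Vec K 1) 0ℓ} →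
    (∀ {a b} t → t ∈ [0,1] → [ a ] ∈ C → [ b ] ∈ C → segment a b t ∈ C) → Quasiconvex C
  segment-quasiconvex convex = 1# , 1>0 , finite-1 , λ { (a ∷ []) (b ∷ []) a∈ b∈ →
      segment a b
    , arc-weaken (≤-reflexive (trans (sym (norm-singleton (a - b))) (sym (*-identityˡ _)))) (segment-arc a b)
    , (λ t t∈ → convex t t∈ a∈ b∈)
    , cong [_] (solve 2 (λ a b → a :+ con (pos 0) :* (b :- a) := a) refl a b)
    , cong [_] (solve 2 (λ a b → a :+ con (pos 1) :* (b :- a) := b) refl a b) }

  mean-pos : ∀ {t x y} → t ∈ [0,1] → 0# < x → 0# < y → 0# < (1# - t) * x + t * y
  mean-pos {t} {x} {y} (t≥0 , inj₁ t<1) x>0 y>0 = +-pos-nonneg (*-pos (x<y⇒0<y-x t<1) x>0) (*-nonneg t≥0 (<⇒≤ y>0))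
  mean-pos {t} {x} {y} (t≥0 , inj₂ refl) x>0 y>0 =
    subst (0# <_) (solve 2 (λ x y → y := (con (pos 1) :- con (pos 1)) :* x :+ con (pos 1) :* y) refl x y) y>0

  interval-convex : ∀ {a b x y t} → t ∈ [0,1] → a < x → x < b → a < y → y < b →
                    a < x + t * (y - x) × x + t * (y - x) < b
  interval-convex {a} {b} {x} {y} {t} t∈ a<x x<b a<y y<b =
      <-from-difference (solve 4 (λ a x y t → x :+ t :* (y :- x) :- a := (con (pos 1) :- t) :* (x :- a) :+ t :* (y :- a)) refl a x y t)
        (mean-pos t∈ (x<y⇒0<y-x a<x) (x<y⇒0<y-x a<y))
    , <-from-difference (solve 4 (λ b x y t → b :- (x :+ t :* (y :- x)) := (con (pos 1) :- t) :* (b :- x) :+ t :* (b :- y)) refl b x y t)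
        (mean-pos t∈ (x<y⇒0<y-x x<b) (x<y⇒0<y-x y<b))

  -- Covers graphs, with g = f and W = {0}, and bands, with W = (0,1).
  fibred-quasiconvex : ∀ {m} {X : Pred (Vec K m) 0ℓ} {C : Pred (Vec K (suc m)) 0ℓ} {f g M} (W : Pred K 0ℓ) →
    0# < M → Finite M → IsC¹MFunction M X f → IsC¹MFunction M X g → (∀ x → x ∈ X → f x ≤ g x) →
    W ⊆ [0,1] → (∀ {α β t} → t ∈ [0,1] → α ∈ W → β ∈ W → α + t * (β - α) ∈ W) →
    (∀ z → z ∈ C → init z ∈ X × (∃[ w ] w ∈ W × last z ≡ f (init z) + w * (g (init z) - f (init z)))) →
    (∀ x w → x ∈ X → w ∈ W → (x ∷ʳ (f x + w * (g x - f x))) ∈ C) →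
    Quasiconvex X → Quasiconvex C
  fibred-quasiconvex {m} {X} {C} {f} {g} {M} W M>0 finite-M f-function g-function f≤g W⊆ W-convex to-W from-W
    (c , c>0 , finite-c , arcs) = c′ , c′>0 , finite-c′ , connect
    where
    Mc c′ : K
    Mc = M * c
    -- The base arc contributes c, the blend of two functions with Lipschitz constant M Λ
    -- contributes 4 M c, and the height difference of the end points, at most |x - y|, contributes
    -- 1.
    c′ = c + (Mc + Mc + Mc + Mc + 1#)
    Mc>0 : 0# < Mc
    Mc>0 = *-pos M>0 c>0
    c′>0 : 0# < c′
    c′>0 = +-pos c>0 (+-pos (+-pos (+-pos (+-pos Mc>0 Mc>0) Mc>0) Mc>0) 1>0)
    finite-Mc : Finite Mc
    finite-Mc = finite-* finite-M finite-c
    finite-c′ : Finite c′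
    finite-c′ = finite-+ finite-c (finite-+ (finite-+ (finite-+ (finite-+ finite-Mc finite-Mc) finite-Mc) finite-Mc) finite-1)
    connect : ∀ x y → x ∈ C → y ∈ C →
      ∃[ γ ] SmoothArc γ (c′ * norm (x -ᵛ y)) × (∀ t → t ∈ [0,1] → γ t ∈ C) × γ 0# ≡ x × γ 1# ≡ y
    connect x y x∈ y∈ =
      let p∈ , α , α∈ , x≡ = to-W x x∈
          q∈ , β , β∈ , y≡ = to-W y y∈
          γ , arc , into , source , target = arcs (init x) (init y) p∈ q∈
      in lifted α β α∈ β∈ x≡ y≡ γ arc into source target
      where
      p q : Vec K m
      p = init x
      q = init y
      D : K
      D = norm (x -ᵛ y)
      x-y≡ : (p -ᵛ q) ∷ʳ (last x - last y) ≡ x -ᵛ y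
      x-y≡ = trans (sym (minus-∷ʳ p q (last x) (last y))) (cong₂ _-ᵛ_ (init-∷ʳ-last x) (init-∷ʳ-last y))
      base≤D : norm (p -ᵛ q) ≤ D
      base≤D = subst (λ v → norm (p -ᵛ q) ≤ norm v) x-y≡ (norm≤norm-∷ʳ (p -ᵛ q) (last x - last y))
      height≤D : abs (last y - last x) ≤ D
      height≤D = subst₂ (λ a v → a ≤ norm v) (abs-minus-comm (last x) (last y)) x-y≡
        (abs≤norm-∷ʳ (p -ᵛ q) (last x - last y))
      lifted : ∀ α β → α ∈ W → β ∈ W → last x ≡ f p + α * (g p - f p) → last y ≡ f q + β * (g q - f q) →
        ∀ γ → SmoothArc γ (c * norm (p -ᵛ q)) → (∀ t → t ∈ [0,1] → γ t ∈ X) → γ 0# ≡ p → γ 1# ≡ q →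
        ∃[ γ ] SmoothArc γ (c′ * D) × (∀ t → t ∈ [0,1] → γ t ∈ C) × γ 0# ≡ x × γ 1# ≡ y
      lifted α β α∈ β∈ x≡ y≡ γ arc into source target =
          (λ t → γ t ∷ʳ h t)
        , arc-weaken constant≤ (arc-∷ʳ arc (blend-definable {f ∘ γ} {g ∘ γ} α β F.definable∘ G.definable∘) B.blend-lipschitz
            (λ t t∈ → let a , derivative-f , _ = F.differentiable∘ t t∈
                          b , derivative-g , _ = G.differentiable∘ t t∈
                      in _ , B.blend-derivative t∈ derivative-f derivative-g))
        , (λ t t∈ → from-W (γ t) (α + t * (β - α)) (into t t∈) (W-convex t∈ α∈ β∈))
        , trans (cong₂ _∷ʳ_ source h-source) (init-∷ʳ-last x)
        , trans (cong₂ _∷ʳ_ target h-target) (init-∷ʳ-last y)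
        where
        Λ : K
        Λ = c * norm (p -ᵛ q)
        h : K → K
        h = blend (f ∘ γ) (g ∘ γ) α β
        module F = Composite {X = X} {f} {M} {γ} {Λ} (<⇒≤ M>0) f-function arc into
        module G = Composite {X = X} {g} {M} {γ} {Λ} (<⇒≤ M>0) g-function arc into
        MΛ≥0 : 0# ≤ M * Λ
        MΛ≥0 = *-nonneg (<⇒≤ M>0) (lipschitz-constant-nonneg arc)
        f≤g-on-arc : ∀ t → t ∈ [0,1] → f (γ t) ≤ g (γ t)
        f≤g-on-arc t t∈ = f≤g (γ t) (into t t∈)
        module B = Blend {f ∘ γ} {g ∘ γ} {M * Λ} {α} {β} (W⊆ α∈) (W⊆ β∈) MΛ≥0 f≤g-on-arc F.lipschitz∘ G.lipschitz∘
        h-source : h 0# ≡ last x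
        h-source = trans (solve 4 (λ u v α β → u :+ (α :+ con (pos 0) :* (β :- α)) :* (v :- u) := u :+ α :* (v :- u)) refl
            (f (γ 0#)) (g (γ 0#)) α β)
          (trans (cong (λ p → f p + α * (g p - f p)) source) (sym x≡))
        h-target : h 1# ≡ last y
        h-target = trans (solve 4 (λ u v α β → u :+ (α :+ con (pos 1) :* (β :- α)) :* (v :- u) := u :+ β :* (v :- u)) refl
            (f (γ 1#)) (g (γ 1#)) α β)
          (trans (cong (λ p → f p + β * (g p - f p)) target) (sym y≡))
        constant≤ : Λ + (M * Λ + M * Λ + M * Λ + M * Λ + abs (h 1# - h 0#)) ≤ c′ * D
        constant≤ = begin
          Λ + (M * Λ + M * Λ + M * Λ + M * Λ + abs (h 1# - h 0#))
            ≡⟨ cong₂ (λ a b → Λ + (M * Λ + M * Λ + M * Λ + M * Λ + abs (a - b))) h-target h-source ⟩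
          Λ + (M * Λ + M * Λ + M * Λ + M * Λ + abs (last y - last x))
            ≤⟨ +-mono-≤ Λ≤ (+-mono-≤ (+-mono-≤ (+-mono-≤ (+-mono-≤ MΛ≤ MΛ≤) MΛ≤) MΛ≤) height≤D) ⟩
          c * D + (M * (c * D) + M * (c * D) + M * (c * D) + M * (c * D) + D)
            ≡⟨ solve 3 (λ c M D → c :* D :+ (M :* (c :* D) :+ M :* (c :* D) :+ M :* (c :* D) :+ M :* (c :* D) :+ D) :=
                 (c :+ (M :* c :+ M :* c :+ M :* c :+ M :* c :+ con (pos 1))) :* D) refl c M D ⟩
          c′ * D ∎
          where
          open ≤-Reasoning
          Λ≤ : Λ ≤ c * D
          Λ≤ = *-monoʳ-≤ (<⇒≤ c>0) base≤D
          MΛ≤ : M * Λ ≤ M * (c * D)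
          MΛ≤ = *-monoʳ-≤ (<⇒≤ M>0) Λ≤

  band-weight : ∀ {a b r} → a < r → r < b → ∃[ w ] (0# < w × w < 1#) × r ≡ a + w * (b - a)
  band-weight {a} {b} {r} a<r r<b =
    let y , y>0 , e = inverse-pos (x<y⇒0<y-x (<-trans a<r r<b))
        w = (r - a) * y
        w[b-a]≡r-a : w * (b - a) ≡ r - a
        w[b-a]≡r-a = trans (solve 4 (λ a b r y → (r :- a) :* y :* (b :- a) := (r :- a) :* ((b :- a) :* y)) refl a b r y)
          (trans (cong ((r - a) *_) e) (*-identityʳ (r - a)))
    in w
     , ( *-pos (x<y⇒0<y-x a<r) y>0
       , subst (w <_) e (*-monoˡ-< y>0 (+-monoˡ-< (- a) r<b)))
     , trans (solve 2 (λ a r → r := a :+ (r :- a)) refl a r) (cong (a +_) (sym w[b-a]≡r-a))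

  cell-quasiconvex : ∀ {M n} {C : Pred (Vec K n) 0ℓ} → 0# < M → Finite M → IsMCell M C → Quasiconvex C
  cell-quasiconvex _ _ (point a (C⊆ , ⊆C)) = segment-quasiconvex λ {x} {y} t t∈ x∈ y∈ →
    ⊆C (trans (cong₂ (λ x y → x + t * (y - x)) (C⊆ x∈) (C⊆ y∈)) (solve 2 (λ a t → a :+ t :* (a :- a) := a) refl a t))
  cell-quasiconvex _ _ (interval a b _ (C⊆ , ⊆C)) = segment-quasiconvex λ {x} {y} t t∈ x∈ y∈ →
    let a<x , x<b = C⊆ x∈
        a<y , y<b = C⊆ y∈
    in ⊆C (interval-convex t∈ a<x x<b a<y y<b)
  cell-quasiconvex M>0 finite-M (graph {X = X} {C} f X-cell f-function (C⊆ , ⊆C)) =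
    fibred-quasiconvex (_≡ 0#) M>0 finite-M f-function f-function (λ _ _ → ≤-refl)
      (λ { refl → 0∈[0,1] })
      (λ { {t = t} _ refl refl → solve 1 (λ t → con (pos 0) :+ t :* (con (pos 0) :- con (pos 0)) := con (pos 0)) refl t })
      (λ z z∈ → proj₁ (C⊆ z∈) , 0# , refl , trans (proj₂ (C⊆ z∈)) (sym (0-weight (f (init z)))))
      (λ { x _ x∈ refl → ⊆C (subst X (sym (Vec.init-∷ʳ _ x)) x∈ ,
             trans (Vec.last-∷ʳ _ x) (trans (0-weight (f x)) (cong f (sym (Vec.init-∷ʳ _ x))))) })
      (cell-quasiconvex M>0 finite-M X-cell)
    where
    0-weight : ∀ y → y + 0# * (y - y) ≡ y
    0-weight y = solve 1 (λ y → y :+ con (pos 0) :* (y :- y) := y) refl y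
  cell-quasiconvex M>0 finite-M (band {X = X} {C} f g X-cell f-function g-function f<g (C⊆ , ⊆C)) =
    fibred-quasiconvex (λ w → 0# < w × w < 1#) M>0 finite-M f-function g-function (λ x x∈ → <⇒≤ (f<g x x∈))
      (λ (w>0 , w<1) → <⇒≤ w>0 , <⇒≤ w<1)
      (λ t∈ (α>0 , α<1) (β>0 , β<1) → interval-convex t∈ α>0 α<1 β>0 β<1)
      (λ z z∈ → let z∈X , f<z , z<g = C⊆ z∈ in z∈X , band-weight f<z z<g)
      (λ x w x∈ (w>0 , w<1) →
        let gap>0 = x<y⇒0<y-x (f<g x x∈)
            r = f x + w * (g x - f x)
            above = <-from-difference (solve 3 (λ a b w → a :+ w :* (b :- a) :- a := w :* (b :- a)) refl (f x) (g x) w)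
              (*-pos w>0 gap>0)
            under = <-from-difference (solve 3 (λ a b w → b :- (a :+ w :* (b :- a)) := (con (pos 1) :- w) :* (b :- a)) refl (f x) (g x) w)
              (*-pos (x<y⇒0<y-x w<1) gap>0)
        in ⊆C ( subst X (sym (Vec.init-∷ʳ r x)) x∈
              , subst₂ (λ p s → f p < s) (sym (Vec.init-∷ʳ r x)) (sym (Vec.last-∷ʳ r x)) above
              , subst₂ (λ p s → s < g p) (sym (Vec.init-∷ʳ r x)) (sym (Vec.last-∷ʳ r x)) under))
      (cell-quasiconvex M>0 finite-M X-cell)

  module _ (μ : BerarducciOteroMeasure) where
    open Measure em 𝓚 μ
    open StandardPart orderedField

    quasiconvex⇒whitney : ∀ {n} {A : Pred (Vec K n) 0ℓ} → A ⊆ FinitePoints → Quasiconvex A → WhitneyArcProperty μ A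
    quasiconvex⇒whitney {A = A} finite-A (c , c>0 , finite-c , arcs) = c , c>0 , finite-c , λ x y x∈ y∈ →
      let γ , arc , into , source , target = arcs x y x∈ y∈
          d = norm (x -ᵛ y)
          Λ≥0 = lipschitz-constant-nonneg arc
          finite-Λ = finite-* finite-c (norm-minus-finite (finite-A x∈) (finite-A y∈))
          speed≤Λ : ∀ t s → Speed μ γ t s → s ≤ c * d
          speed≤Λ t s (v , velocity , isNorm) = subst (_≤ c * d) (sym (norm-unique isNorm)) (velocity-bound {γ = γ} arc velocity)
      in record
           { γ          = γ
           ; definable  = SmoothArc.definable arc
           ; continuous = continuous arc
           ; into       = into
           ; source     = source
           ; target     = target
           }
         , (λ t s speed → finite-≤ (proj₁ (proj₂ (proj₂ speed))) (speed≤Λ t s speed) finite-Λ)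
         , d , norm-isNorm (x -ᵛ y) , st finite-Λ , st-isSt finite-Λ , length-≤ {γ = γ} Λ≥0 speed≤Λ finite-Λ
      where
      continuous : ∀ {n} {γ : K → Vec K n} {Λ} → SmoothArc γ Λ → ∀ t → t ∈ [0,1] → ∀ ε → 0# < ε → ∃[ δ ] 0# < δ ×
        (∀ s → s ∈ [0,1] → abs (s - t) < δ → ∃[ d ] IsNorm (γ s -ᵛ γ t) d × d < ε)
      continuous {γ = γ} {Λ} arc t t∈ ε ε>0 =
        let Λ≥0 = lipschitz-constant-nonneg arc
            δ , δ>0 , Λδ<ε = pos-multiple-below Λ Λ≥0 ε>0
        in δ , δ>0 , λ s s∈ s-t<δ → norm (γ s -ᵛ γ t) , norm-isNorm (γ s -ᵛ γ t) ,
          ≤-<-trans (SmoothArc.lipschitz arc s∈ t∈) (≤-<-trans (*-monoʳ-≤ Λ≥0 (<⇒≤ s-t<δ)) Λδ<ε)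

lemma4p7 : (∀ {ℓ} → ExcludedMiddle ℓ) →
    ∀ {L : Language} (𝓚 : Structure L) →
    let open Structure 𝓚
        open Geometry 𝓚 in
    OMinimal → ℵ₁-Saturated →
    (μ : BerarducciOteroMeasure) →
    ∀ (M : K) → 0# < M → Finite M →
    ∀ {n : ℕ} (C : Pred (Vec K n) 0ℓ) → IsMCell M C → C ⊆ FinitePoints →
    WhitneyArcProperty μ C
lemma4p7 em 𝓚 ominimal _ μ M M>0 finite-M C cell finite-C =
  quasiconvex⇒whitney μ finite-C (cell-quasiconvex M>0 finite-M cell)
  where open Quasiconvexity em 𝓚 ominimal
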